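{- Let $r\ge2$, $\lambda$ a partition with $r$ parts (some possibly zero), $N\ge\lambda_1+r-1$, $\mathbf{z}\in(\mathbb{C}^\times)^r$, and $w\in W=S_r$. For an admissible state $\mathfrak{s}$ of the uncolored system $\mathfrak{S}_{\mathbf{z},\lambda}$, $\mathfrak{s}$ is the image under forgetting colors of an admissible state of the colored system $\mathfrak{S}_{\mathbf{z},\lambda,w}$ if and only if $w_0\,\omega\big(\mathfrak{T}(\mathfrak{s})'\big)=w$.
   Context: Grid: $r$ rows labeled $1,\dots,r$ top to bottom, $N+1$ columns labeled $N,\dots,0$ left to right; each vertex has left, top, right, bottom edges. Uncolored system $\mathfrak{S}_{\mathbf{z},\lambda}$: spins $\pm$ on edges; top boundary edges in columns $\lambda_k+r-k$ ($k=1,\dots,r$) are $-$, other top boundary edges $+$; left and bottom boundary edges $+$; right boundary edges $-$. A state is admissible if every vertex has (left, top, right, bottom) equal to one of $(+,+,+,+)$, $(-,-,-,-)$, $(-,+,-,+)$, $(-,+,+,-)$, $(+,-,-,+)$. Colored system $\mathfrak{S}_{\mathbf{z},\lambda,w}$: colors $c_1>\cdots>c_r$; an edge carries $+$ or a color. Top boundary edge in column $\lambda_k+r-k$ carries $c_k$, other top edges $+$; left and bottom boundary edges $+$; right boundary edge of row $k$ carries $c_{w^{ -1}(k)}$. Admissible: every vertex has (left, top, right, bottom) of one of the forms $(+,+,+,+)$, $(c,d,\max(c,d),\min(c,d))$, $(c,+,c,+)$, $(c,+,+,c)$, $(+,c,c,+)$ with $c,d$ colors. Forgetting colors replaces each color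 by $-$. Tableau $\mathfrak{T}(\mathfrak{s})$: in an admissible uncolored state, the row of vertical edges just above row $i$ has exactly $r+1-i$ edges with spin $-$; let $A_{i,i}>\cdots>A_{i,r}$ be their column labels and $a_{i,j}=A_{i,j}-(r-j)$. Then $(a_{i,j})$ is a Gelfand–Tsetlin pattern with top row $\lambda$, and $\mathfrak{T}(\mathfrak{s})$ is the semistandard tableau with entries in $\{1,\dots,r\}$ such that for each $i$ the subtableau of entries $\le r+1-i$ has shape $(a_{i,i},\dots,a_{i,r})$. $T\mapsto T'$ is the Schützenberger (Lusztig) involution of the crystal $\mathcal{B}_\lambda$ of such tableaux. The map $\omega:\mathcal{B}_\lambda\to W$: let $J$ be the concatenation of the blocks $(r-m,\dots,r-1)$, $m=1,\dots,r-1$, of length $M=r(r-1)/2$. For $v$ let $b_1$ be maximal with $e_{J_1}^{b_1}v\ne0$, $b_2$ maximal with $e_{J_2}^{b_2}e_{J_1}^{b_1}v\neq 0$, etc. Put $\beta_{m,p}=b_{m(m-1)/2+p}$ ($1\le p\le m\le r-1$); $\beta_{m,p}$ is circled if $p=m$ and $\beta_{m,m}=0$, or $p<m$ and $\beta_{m,p}=\beta_{m,p+1}$. List, for $m=1,\dots,r-1$ and within each $m$ for $p=m,\dots,1$, the $s_p$ with $\beta_{m,p}$ circled, giving $(s_{j_1},\dots,s_{j_k})$; $\omega(v)=\Pi_{\mathrm{nd}}(s_{j_1},\dots,s_{j_k})$, where $\Pi_{\mathrm{nd}}()=1$, $\Pi_{\mathrm{nd}}(s_{i_1},\dots,s_{i_k})=s_{i_1}\pi$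 if $s_{i_1}\pi>\pi$ in Bruhat order and $\pi$ otherwise, $\pi=\Pi_{\mathrm{nd}}(s_{i_2},\dots,s_{i_k})$. $w_0$ is the longest element of $S_r$. -}

module Defs where

open import Data.Nat using (ℕ; zero; suc; _+_; _∸_; _≤_; _<_; _≡ᵇ_; _<ᵇ_; _⊔_; _⊓_)
open import Data.Bool using (Bool; true; false; if_then_else_)
open import Data.Fin using (Fin; toℕ; fromℕ; inject₁) renaming (zero to fzero; suc to fsuc)
import Data.Fin as F
open import Data.Fin.Permutation using (Permutation′; _⟨$⟩ʳ_; _⟨$⟩ˡ_)
open import Data.List using (List; []; _∷_; _++_; concat; concatMap; reverse; length; replicate; foldr; upTo; allFin)
open import Data.List.Relation.Unary.All using (All)
open import Data.Maybe using (Maybe; just; nothing; _>>=_)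
import Data.Maybe as Maybe
open import Data.Vec using (Vec; lookup; tabulate)
import Data.Vec as V
open import Data.Product using (Σ; _×_; _,_; proj₁; proj₂)
open import Relation.Binary.PropositionalEquality using (_≡_; _≢_)
open import Relation.Nullary using (¬_)

at : {A : Set} → A → List A → ℕ → A
at d []       _       = d
at d (x ∷ _)  zero    = x
at d (_ ∷ xs) (suc n) = at d xs n

oneTo : ℕ → List ℕ
oneTo n = Data.List.map suc (upTo n)

part1 : {r : ℕ} → Vec ℕ r → ℕ
part1 V.[]      = 0
part1 (x V.∷ _) = x

IsPartition : {r : ℕ} → Vec ℕ r → Set
IsPartition {r} lam = (i j : Fin r) → i F.≤ j → lookup lam j ≤ lookup lam i

-- Lattice models.
-- Columns are labelled N,...,0 left to right; column label c is 'toℕ c'.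
-- vert k c : vertical edge in column c just above row k+1 (k = 0 : top boundary,
--            k = r : bottom boundary).
-- horiz i j : horizontal edge in row i+1 between column j and column j-1
--            (j = N+1 : left boundary, j = 0 : right boundary).
-- Vertex (row i+1, column c) has left = horiz i (c+1), top = vert i c,
-- right = horiz i c, bottom = vert (i+1) c.

record State (S : Set) (r N : ℕ) : Set where
  field
    vert  : Fin (suc r) → Fin (suc N) → S
    horiz : Fin r → Fin (suc (suc N)) → S
open State public

data Spin : Set where
  plus minus : Spin

-- Uncolored admissible vertices (left, top, right, bottom)
data UVertex : Spin → Spin → Spin → Spin → Set where
  a1 : UVertex plus plus plus plus
  a2 : UVertex minus minus minus minus
  b2 : UVertex minus plus minus plus
  c1 : UVertex minus plus plus minus
  c2 : UVertex plus minus minus plus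

-- Colored spins: nothing = '+', just c = the color c.
-- Colors c₁ > ... > c_r are encoded as natural numbers: c_k ↦ r - k, so that
-- the order on colors is the usual order on ℕ.
CSpin : Set
CSpin = Maybe ℕ

color : ℕ → ℕ → ℕ   -- color r k = code of c_k  (k 1-based)
color r k = r ∸ k

data CVertex : CSpin → CSpin → CSpin → CSpin → Set where
  ca1 : CVertex nothing nothing nothing nothing
  ca2 : (c d : ℕ) → CVertex (just c) (just d) (just (c ⊔ d)) (just (c ⊓ d))
  cb2 : (c : ℕ) → CVertex (just c) nothing (just c) nothing
  cc1 : (c : ℕ) → CVertex (just c) nothing nothing (just c)
  cc2 : (c : ℕ) → CVertex nothing (just c) (just c) nothing

forget : CSpin → Spin
forget nothing  = plus
forget (just _) = minus

topU : (r : ℕ) → Vec ℕ r → ℕ → Spin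
topU r lam c = foldr (λ k acc → if c ≡ᵇ (lookup lam k + (r ∸ suc (toℕ k))) then minus else acc)
                     plus (allFin r)

topC : (r : ℕ) → Vec ℕ r → ℕ → CSpin
topC r lam c = foldr (λ k acc → if c ≡ᵇ (lookup lam k + (r ∸ suc (toℕ k)))
                                  then just (color r (suc (toℕ k))) else acc)
                     nothing (allFin r)

AdmissibleU : (r N : ℕ) → Vec ℕ r → State Spin r N → Set
AdmissibleU r N lam s =
  ((c : Fin (suc N)) → vert s fzero c ≡ topU r lam (toℕ c)) ×
  ((c : Fin (suc N)) → vert s (fromℕ r) c ≡ plus) ×
  ((i : Fin r) → horiz s i (fromℕ (suc N)) ≡ plus) ×
  ((i : Fin r) → horiz s i fzero ≡ minus) ×
  ((i : Fin r) (c : Fin (suc N)) →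
     UVertex (horiz s i (fsuc c)) (vert s (inject₁ i) c) (horiz s i (inject₁ c)) (vert s (fsuc i) c))

AdmissibleC : (r N : ℕ) → Vec ℕ r → Permutation′ r → State CSpin r N → Set
AdmissibleC r N lam w s =
  ((c : Fin (suc N)) → vert s fzero c ≡ topC r lam (toℕ c)) ×
  ((c : Fin (suc N)) → vert s (fromℕ r) c ≡ nothing) ×
  ((i : Fin r) → horiz s i (fromℕ (suc N)) ≡ nothing) ×
  ((i : Fin r) → horiz s i fzero ≡ just (color r (suc (toℕ (w ⟨$⟩ˡ i))))) ×
  ((i : Fin r) (c : Fin (suc N)) →
     CVertex (horiz s i (fsuc c)) (vert s (inject₁ i) c) (horiz s i (inject₁ c)) (vert s (fsuc i) c))

IsColorForgetImage : (r N : ℕ) → Vec ℕ r → Permutation′ r → State Spin r N → Set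
IsColorForgetImage r N lam w s =
  Σ (State CSpin r N) λ cs →
    AdmissibleC r N lam w cs ×
    ((k : Fin (suc r)) (c : Fin (suc N)) → forget (vert cs k c) ≡ vert s k c) ×
    ((i : Fin r) (j : Fin (suc (suc N))) → forget (horiz cs i j) ≡ horiz s i j)

-- Tableaux: a tableau is the list of its rows (top to bottom), each row a
-- list of entries in {1,...,r} (left to right).

Tableau : Set
Tableau = List (List ℕ)

isMinus : Spin → Bool
isMinus plus  = false
isMinus minus = true

minusCols : {N : ℕ} → (Fin (suc N) → Spin) → List ℕ
minusCols {N} f = concatMap (λ c → if isMinus (f c) then toℕ c ∷ [] else []) (reverse (allFin (suc N)))

-- The tableau 𝔗(𝔰).  Let L_{i} be the list A_{i,i} > ... > A_{i,r} (i 1-based,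
-- stored at position i-1).  The subtableau of entries ≤ v (v = r+1-i) has
-- row k (1 ≤ k ≤ v) of length a_{i,r-v+k} = A_{i,r-v+k} - (v-k), and
-- A_{i,r-v+k} is the k-th element of L_i.
tableauOf : (r N : ℕ) → State Spin r N → Tableau
tableauOf r N s = Data.List.map row (oneTo r)
  where
  Ls : List (List ℕ)
  Ls = Data.List.map (λ k → minusCols (vert s k)) (allFin (suc r))
  shape : ℕ → ℕ → ℕ      -- shape v k = length of row k of the subtableau of entries ≤ v
  shape zero    k = 0
  shape (suc v) k = if suc v <ᵇ k then 0
                    else at 0 (at [] Ls (r ∸ suc v)) (k ∸ 1) ∸ (suc v ∸ k)
  row : ℕ → List ℕ
  row k = concatMap (λ v → replicate (shape v k ∸ shape (v ∸ 1) k) v) (oneTo r)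

-- Crystal operators e_i on tableaux (signature rule on the row reading word:
-- rows read bottom to top, each left to right; an i+1 is matched with a later i;
-- e_i changes the leftmost unmatched i+1 into i).

readingWord : Tableau → List ℕ
readingWord T = concat (reverse T)

unmatched : ℕ → List ℕ → List Bool
unmatched i w = proj₂ (foldr step (0 , []) w)
  where
  step : ℕ → ℕ × List Bool → ℕ × List Bool
  step x (c , ms) =
    if x ≡ᵇ i then (suc c , false ∷ ms)
    else if x ≡ᵇ suc i then
      (if 0 <ᵇ c then (c ∸ 1 , false ∷ ms) else (c , true ∷ ms))
    else (c , false ∷ ms)

changeFirst : ℕ → List ℕ → List Bool → Maybe (List ℕ)
changeFirst i (x ∷ xs) (true ∷ bs)  = just (i ∷ xs)
changeFirst i (x ∷ xs) (false ∷ bs) = Maybe.map (x ∷_) (changeFirst i xs bs)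
changeFirst i _ _ = nothing

eWord : ℕ → List ℕ → Maybe (List ℕ)
eWord i w = changeFirst i w (unmatched i w)

countTrue : List Bool → ℕ
countTrue [] = 0
countTrue (true ∷ bs)  = suc (countTrue bs)
countTrue (false ∷ bs) = countTrue bs

splitBy : List ℕ → List ℕ → List (List ℕ)
splitBy [] _ = []
splitBy (n ∷ ns) w = Data.List.take n w ∷ splitBy ns (Data.List.drop n w)

-- e_i on tableaux (nothing = 0)
eT : ℕ → Tableau → Maybe Tableau
eT i T = Maybe.map (λ w → reverse (splitBy (Data.List.map length (reverse T)) w))
                   (eWord i (readingWord T))

-- ε_i : maximal b with e_i^b T ≠ 0
εT : ℕ → Tableau → ℕ
εT i T = countTrue (unmatched i (readingWord T))

applyE : List ℕ → Tableau → Maybe Tableau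
applyE [] T = just T
applyE (i ∷ is) T = eT i T >>= applyE is

-- e_i^n (stays put if it hits 0, which does not happen for n ≤ ε_i)
ePow : ℕ → ℕ → Tableau → Tableau
ePow i zero T = T
ePow i (suc n) T with eT i T
... | just T' = ePow i n T'
... | nothing = T

highestT : (r : ℕ) → Vec ℕ r → Tableau
highestT r lam = Data.List.map (λ k → replicate (lookup lam k) (suc (toℕ k))) (allFin r)

-- lowest weight tableau of shape λ: column j (of height h_j) filled with r-h_j+1,...,r
lowestT : (r : ℕ) → Vec ℕ r → Tableau
lowestT r lam = Data.List.map (λ k → Data.List.map (λ j → r ∸ height j + suc (toℕ k)) (oneTo (lookup lam k)))
                              (allFin r)
  where
  height : ℕ → ℕ
  height j = foldr (λ l acc → if lookup lam l <ᵇ j then acc else suc acc) 0 (allFin r)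

-- Schützenberger (Lusztig) involution of B_λ, characterised crystal-theoretically:
-- if T = f_{i₁} ⋯ f_{i_k} T_high then T' = e_{r-i₁} ⋯ e_{r-i_k} T_low.
IsLusztig : (r : ℕ) → Vec ℕ r → Tableau → Tableau → Set
IsLusztig r lam T T' =
  Σ (List ℕ) λ is →
    All (λ i → (1 ≤ i) × (i < r)) is ×
    applyE is T ≡ just (highestT r lam) ×
    applyE (Data.List.map (r ∸_) (reverse is)) (lowestT r lam) ≡ just T'

runJ : List ℕ → Tableau → List ℕ × Tableau
runJ [] T = ([] , T)
runJ (j ∷ js) T =
  let b = εT j T
      rest = runJ js (ePow j b T)
  in (b ∷ proj₁ rest , proj₂ rest)

blockJ : ℕ → ℕ → List ℕ
blockJ r m = Data.List.map (λ q → (r ∸ m) + q) (upTo m)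

-- β-blocks [β_{m,1},...,β_{m,m}] for m = k₀, k₀+1, ..., using fuel = number of blocks left
betaBlocks : ℕ → ℕ → ℕ → Tableau → List (List ℕ)
betaBlocks r zero m T = []
betaBlocks r (suc n) m T =
  let res = runJ (blockJ r m) T in proj₁ res ∷ betaBlocks r n (suc m) (proj₂ res)

-- circled positions p of a block (β_{m,p}, p = p₀,...,m), listed from p = m down to p₀
circled : ℕ → List ℕ → List ℕ
circled p [] = []
circled p (b ∷ []) = if b ≡ᵇ 0 then p ∷ [] else []
circled p (b ∷ b' ∷ bs) = circled (suc p) (b' ∷ bs) ++ (if b ≡ᵇ b' then p ∷ [] else [])

-- the word (s_{j₁},...,s_{j_k}) given by the list of indices (j₁,...,j_k)
omegaWord : (r : ℕ) → Tableau → List ℕ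
omegaWord r T = concatMap (circled 1) (betaBlocks r (r ∸ 1) 1 T)

-- The symmetric group S_r, in one-line notation with values 0,...,r-1
-- (π ↦ (π(1)-1, ..., π(r)-1)).

Perm : ℕ → Set
Perm r = Vec ℕ r

idPerm : (r : ℕ) → Perm r
idPerm r = tabulate toℕ

toPerm : {r : ℕ} → Permutation′ r → Perm r
toPerm w = tabulate (λ i → toℕ (w ⟨$⟩ʳ i))

swapℕ : ℕ → ℕ → ℕ → ℕ
swapℕ a b x = if x ≡ᵇ a then b else if x ≡ᵇ b then a else x

-- left multiplication by the transposition (a+1 b+1)
transL : {r : ℕ} → ℕ → ℕ → Perm r → Perm r
transL a b π = V.map (swapℕ a b) π

-- left multiplication by the simple reflection s_p = (p p+1), p ≥ 1
sL : {r : ℕ} → ℕ → Perm r → Perm r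
sL p π = transL (p ∸ 1) p π

w0L : {r : ℕ} → Perm r → Perm r
w0L {r} π = V.map (λ x → r ∸ suc x) π

-- Coxeter length = number of inversions
invCount : List ℕ → ℕ
invCount [] = 0
invCount (x ∷ xs) = foldr (λ y acc → if y <ᵇ x then suc acc else acc) 0 xs + invCount xs

len : {r : ℕ} → Perm r → ℕ
len π = invCount (V.toList π)

data _≤B_ {r : ℕ} : Perm r → Perm r → Set where
  ≤B-refl : {u : Perm r} → u ≤B u
  ≤B-step : {u v : Perm r} → u ≤B v → (a b : ℕ) → len v < len (transL a b v) → u ≤B transL a b v

_<B_ : {r : ℕ} → Perm r → Perm r → Set
u <B v = (u ≤B v) × (u ≢ v)

-- Demazure ("non-decreasing") product Π_nd, as the graph of the recursive definition
data IsΠnd {r : ℕ} : List ℕ → Perm r → Set where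
  nd-[]   : IsΠnd [] (idPerm r)
  nd-up   : {p : ℕ} {ps : List ℕ} {π : Perm r} → IsΠnd ps π → π <B sL p π → IsΠnd (p ∷ ps) (sL p π)
  nd-stay : {p : ℕ} {ps : List ℕ} {π : Perm r} → IsΠnd ps π → ¬ (π <B sL p π) → IsΠnd (p ∷ ps) π

W0OmegaIs : (r : ℕ) → Tableau → Permutation′ r → Set
W0OmegaIs r T w = Σ (Perm r) λ π → IsΠnd (omegaWord r T) π × (w0L π ≡ toPerm w)

-- Colours run through a given uncoloured state in only one way, so it has exactly one colouring up
-- to the right boundary, and the right boundary determines w.  Read as an action on the list of
-- colours, a row sorts neighbouring colours wherever a column meets the column of the row above it,
-- i.e. wherever two entries of the Gelfand–Tsetlin pattern agree: the colours undergo a Demazure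
-- product.  It remains to see that the circled entries of T' mark the same equalities.  The reversed
-- complement of the reading word of T is Knuth equivalent to the reading word of T' (Knuth equivalence
-- commutes with crystal operators, and for the highest weight tableau it is an insertion argument), so
-- the e-strings of T' are f-strings of T.  The latter transform the shape at level i of the pattern
-- into the shifted shape at level i+1, and β_{m,p} is the sum over q ≥ p of a_{m,q} − a_{m+1,q+1},
-- where a_{m,1} ≥ … ≥ a_{m,m} is the shape of the subtableau of entries ≤ m.
module Submission where

open import Defs
open import Data.Nat using (ℕ; _+_; _∸_; _≤_)
open import Data.Vec using (Vec)
open import Data.Fin.Permutation using (Permutation′)
open import Data.Product using (Σ; _×_)
open import Function.Bundles using (_⇔_)

open import Data.Bool using (Bool; true; false; if_then_else_; T)
open import Data.Empty using (⊥-elim)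
open import Data.Fin using (Fin; toℕ; fromℕ; inject₁; fromℕ<) renaming (zero to fzero; suc to fsuc)
open import Data.Fin.Permutation using (_⟨$⟩ʳ_; _⟨$⟩ˡ_; inverseʳ)
open import Data.Fin.Properties using (toℕ-fromℕ; toℕ-inject₁; toℕ-fromℕ<; toℕ-injective; toℕ<n)
import Data.Fin.Properties as Fin
open import Data.Fin.Relation.Unary.Top using (view; ‵fromℕ; ‵inject₁)
open import Data.List using (List; []; _∷_; _++_; map; reverse; concat; concatMap; replicate; foldr; length; take; drop; upTo; allFin; tabulate; zipWith; applyUpTo)
open import Data.List.Properties
open import Data.List.Relation.Unary.All using (All; []; _∷_)
import Data.List.Relation.Unary.All as All
import Data.List.Relation.Unary.All.Properties as All
open import Data.List.Relation.Unary.AllPairs using (AllPairs; []; _∷_)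
import Data.List.Relation.Unary.AllPairs.Properties as AllPairs
open import Data.List.Relation.Unary.Any using (Any; here; there)
open import Data.Maybe using (just; nothing; _>>=_)
open import Data.Maybe.Properties using (just-injective)
open import Data.Nat
open import Data.Nat.ListAction using (sum)
open import Data.Nat.Properties
open import Data.Product as × using (∃; _,_; proj₁; proj₂)
open import Data.Sum as Sum using (_⊎_; inj₁; inj₂)
open import Data.Vec using (lookup)
import Data.Vec as V
import Data.Vec.Properties as V
open import Function using (id; case_of_)
open import Function.Bundles using (mk⇔)
open import Relation.Binary.Definitions using (tri<; tri≈; tri>)
open import Relation.Binary.PropositionalEquality
open import Relation.Nullary using (¬_; yes; no; contradiction)

-- The tableau T' is known only up to Knuth equivalence, and this suffices: ε and the lengths of
-- strings are invariants of the class, so the starred word of T may stand for that of T'. No f_i is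
-- defined; a maximal f_i-string is an `EN` read backwards, from a word with φ equal to 0. The
-- shifted shapes arise because block m lowers the subtableau of entries ≤ m + 1 to its lowest
-- weight, and level v of a lowest weight pattern consists of the last v parts of the shape. Raising
-- instead of lowering keeps the first v parts; it supplies the path to the highest weight tableau
-- on which the existence of T' rests. In the lattice, the colours that have left are listed behind
-- those still inside, the latest first. The final list therefore shows the right boundary from
-- bottom to top, and this reversal is the factor w_0. A word for Π_nd is evaluated from its right
-- end, which is why the top lattice row, m = r - 1, contributes the end of the word, and why within
-- a row the positions are listed from right to left.

Word : Set
Word = List ℕ

-- The signature rule on words.

data Kind : Set where
  self next other : Kind

kindᵇ : Bool → Bool → Kind
kindᵇ true  _     = self
kindᵇ false true  = next
kindᵇ false false = other

-- Abstract, so that with-abstractions over 'kind i x' are not disturbed by unfolding.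
abstract
  kind : ℕ → ℕ → Kind
  kind i x = kindᵇ (x ≡ᵇ i) (x ≡ᵇ suc i)

  kind-def : ∀ i x → kind i x ≡ kindᵇ (x ≡ᵇ i) (x ≡ᵇ suc i)
  kind-def i x = refl

isZero : ℕ → ℕ
isZero zero    = 1
isZero (suc _) = 0

φK : List Kind → ℕ
φK []          = 0
φK (self ∷ w)  = suc (φK w)
φK (next ∷ w)  = pred (φK w)
φK (other ∷ w) = φK w

εK : List Kind → ℕ
εK []          = 0
εK (self ∷ w)  = εK w
εK (next ∷ w)  = isZero (φK w) + εK w
εK (other ∷ w) = εK w

φ ε : ℕ → Word → ℕ
φ i w = φK (map (kind i) w)
ε i w = εK (map (kind i) w)

≡ᵇ-refl : ∀ n → (n ≡ᵇ n) ≡ true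
≡ᵇ-refl zero    = refl
≡ᵇ-refl (suc n) = ≡ᵇ-refl n

≡ᵇ-true : ∀ {m n} → (m ≡ᵇ n) ≡ true → m ≡ n
≡ᵇ-true {m} {n} e = ≡ᵇ⇒≡ m n (subst T (sym e) _)

≡ᵇ-false : ∀ {m n} → m ≢ n → (m ≡ᵇ n) ≡ false
≡ᵇ-false {m} {n} m≢n with m ≡ᵇ n in e
... | true  = contradiction (≡ᵇ-true e) m≢n
... | false = refl

kind-self : ∀ i → kind i i ≡ self
kind-self i rewrite kind-def i i | ≡ᵇ-refl i = refl

kind-next : ∀ i → kind i (suc i) ≡ next
kind-next i rewrite kind-def i (suc i) | ≡ᵇ-false {suc i} {i} 1+n≢n | ≡ᵇ-refl i = refl

kind-other : ∀ {i x} → x ≢ i → x ≢ suc i → kind i x ≡ other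
kind-other {i} {x} p q rewrite kind-def i x | ≡ᵇ-false p | ≡ᵇ-false q = refl

IsKind : Kind → ℕ → ℕ → Set
IsKind self  i x = x ≡ i
IsKind next  i x = x ≡ suc i
IsKind other i x = x ≢ i × x ≢ suc i

kind-spec : ∀ i x → IsKind (kind i x) i x
kind-spec i x with x ≟ i | x ≟ suc i
... | yes refl | _ rewrite kind-self i = refl
... | no _ | yes refl rewrite kind-next i = refl
... | no p | no q rewrite kind-other p q = p , q

kind-elim : ∀ {k i x} → kind i x ≡ k → IsKind k i x
kind-elim refl = kind-spec _ _

-- After cancellation `u` reads i...i (i+1)...(i+1), so the unmatched i of `v` first have to serve
-- the `εK u` letters at its right end.
φK-++ : ∀ u v → φK (u ++ v) ≡ φK u + (φK v ∸ εK u)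
φK-++ []          v = refl
φK-++ (self ∷ u)  v = cong suc (φK-++ u v)
φK-++ (other ∷ u) v = φK-++ u v
φK-++ (next ∷ u)  v rewrite φK-++ u v with φK u
... | zero  = pred[m∸n]≡m∸[1+n] (φK v) (εK u)
... | suc _ = refl

private
  unmatched-lemma : ∀ a b → isZero (a ∸ b) + (b ∸ a) ≡ suc b ∸ a
  unmatched-lemma zero    b rewrite 0∸n≡0 b = refl
  unmatched-lemma (suc a) zero    rewrite 0∸n≡0 a = refl
  unmatched-lemma (suc a) (suc b) = unmatched-lemma a b

εK-++ : ∀ u v → εK (u ++ v) ≡ εK v + (εK u ∸ φK v)
εK-++ []          v = sym (trans (cong (εK v +_) (0∸n≡0 (φK v))) (+-identityʳ _))
εK-++ (self ∷ u)  v = εK-++ u v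
εK-++ (other ∷ u) v = εK-++ u v
εK-++ (next ∷ u)  v rewrite φK-++ u v | εK-++ u v with φK u
... | suc _ = refl
... | zero  = begin
  isZero (φK v ∸ εK u) + (εK v + (εK u ∸ φK v)) ≡⟨ sym (+-assoc (isZero (φK v ∸ εK u)) (εK v) _) ⟩
  isZero (φK v ∸ εK u) + εK v + (εK u ∸ φK v)   ≡⟨ cong (_+ (εK u ∸ φK v)) (+-comm (isZero (φK v ∸ εK u)) (εK v)) ⟩
  εK v + isZero (φK v ∸ εK u) + (εK u ∸ φK v)   ≡⟨ +-assoc (εK v) _ _ ⟩
  εK v + (isZero (φK v ∸ εK u) + (εK u ∸ φK v)) ≡⟨ cong (εK v +_) (unmatched-lemma (φK v) (εK u)) ⟩
  εK v + (suc (εK u) ∸ φK v) ∎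
  where open ≡-Reasoning

-- The tensor product rule for crystals.
φ-++ : ∀ i u v → φ i (u ++ v) ≡ φ i u + (φ i v ∸ ε i u)
φ-++ i u v rewrite map-++ (kind i) u v = φK-++ (map (kind i) u) _

ε-++ : ∀ i u v → ε i (u ++ v) ≡ ε i v + (ε i u ∸ φ i v)
ε-++ i u v rewrite map-++ (kind i) u v = εK-++ (map (kind i) u) _

φ-self∷ : ∀ i w → φ i (i ∷ w) ≡ suc (φ i w)
φ-self∷ i w rewrite kind-self i = refl

ε-self∷ : ∀ i w → ε i (i ∷ w) ≡ ε i w
ε-self∷ i w rewrite kind-self i = refl

φ-next∷ : ∀ i w → φ i (suc i ∷ w) ≡ pred (φ i w)
φ-next∷ i w rewrite kind-next i = refl

ε-next∷ : ∀ i w → ε i (suc i ∷ w) ≡ isZero (φ i w) + ε i w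
ε-next∷ i w rewrite kind-next i = refl

-- E i u v : e_i u = v, where the changed letter is the leftmost unmatched one.
data E (i : ℕ) : Word → Word → Set where
  mkE : ∀ p q → ε i p ≡ 0 → φ i q ≡ 0 → E i (p ++ suc i ∷ q) (p ++ i ∷ q)

private
  φ-before-unmatched : ∀ i p q → ε i p ≡ 0 → φ i q ≡ 0 → φ i (p ++ suc i ∷ q) ≡ φ i p
  φ-before-unmatched i p q εp φq
    rewrite φ-++ i p (suc i ∷ q) | εp | φ-next∷ i q | φq = +-identityʳ _

E-ε : ∀ {i u v} → E i u v → ε i u ≡ suc (ε i v)
E-ε {i} (mkE p q εp φq)
  rewrite ε-++ i p (suc i ∷ q) | ε-++ i p (i ∷ q) | ε-next∷ i q | ε-self∷ i q | εp | φq
        | 0∸n≡0 (φ i (i ∷ q)) | 0∸n≡0 (φ i (suc i ∷ q)) = refl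

E-φ : ∀ {i u v} → E i u v → φ i v ≡ suc (φ i u)
E-φ {i} (mkE p q εp φq)
  rewrite φ-before-unmatched i p q εp φq | φ-++ i p (i ∷ q) | φ-self∷ i q | εp | φq = +-comm (φ i p) 1

-- The unmatched i of `v` cancel the unmatched i + 1 of `u` from the right; when they are too few,
-- the leftmost survives and is still the letter that changes.
E-left : ∀ {i u u′} v → φ i v < ε i u → E i u u′ → E i (u ++ v) (u′ ++ v)
E-left {i} v lt e@(mkE p q εp φq)
  rewrite ++-assoc p (suc i ∷ q) v | ++-assoc p (i ∷ q) v =
  mkE p (q ++ v) εp (trans (φ-++ i q v) (cong₂ _+_ φq (m≤n⇒m∸n≡0 (≤-pred (subst (φ i v <_) ε-eq lt)))))
  where
  ε-eq : ε i (p ++ suc i ∷ q) ≡ suc (ε i q)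
  ε-eq rewrite ε-++ i p (suc i ∷ q) | ε-next∷ i q | εp | φq | 0∸n≡0 (φ i (suc i ∷ q)) = +-identityʳ _

E-right : ∀ {i v v′} u → ε i u ≤ φ i v → E i v v′ → E i (u ++ v) (u ++ v′)
E-right {i} u le (mkE p q εp φq)
  rewrite sym (++-assoc u p (suc i ∷ q)) | sym (++-assoc u p (i ∷ q)) =
  mkE (u ++ p) q
    (trans (ε-++ i u p) (cong₂ _+_ εp (m≤n⇒m∸n≡0 (subst (ε i u ≤_) (φ-before-unmatched i p q εp φq) le))))
    φq

mark : Kind → ℕ → Bool
mark next zero    = true
mark _    _       = false

marks : ℕ → Word → List Bool
marks i []      = []
marks i (x ∷ w) = mark (kind i x) (φ i w) ∷ marks i w

private
  -- A copy of the step function local to `unmatched`, which has no name outside; `foldr-cong` with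
  -- an inferred function identifies the two.
  sigStep : ℕ → ℕ → ℕ × List Bool → ℕ × List Bool
  sigStep i x (c , ms) =
    if x ≡ᵇ i then (suc c , false ∷ ms)
    else if x ≡ᵇ suc i then
      (if 0 <ᵇ c then (c ∸ 1 , false ∷ ms) else (c , true ∷ ms))
    else (c , false ∷ ms)

  φ-cons : Kind → ℕ → ℕ
  φ-cons self  c = suc c
  φ-cons next  c = pred c
  φ-cons other c = c

  sigStep-kind : ∀ i x c ms → sigStep i x (c , ms) ≡ (φ-cons (kind i x) c , mark (kind i x) c ∷ ms)
  sigStep-kind i x c ms rewrite kind-def i x with x ≡ᵇ i | x ≡ᵇ suc i | c
  ... | true  | _     | _     = refl
  ... | false | false | _     = refl
  ... | false | true  | zero  = refl
  ... | false | true  | suc _ = refl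

  signature : ∀ i w → foldr (sigStep i) (0 , []) w ≡ (φ i w , marks i w)
  signature i []      = refl
  signature i (x ∷ w)
    rewrite signature i w | sigStep-kind i x (φ i w) (marks i w) with kind i x
  ... | self  = refl
  ... | next  = refl
  ... | other = refl

  unmatched-marks : ∀ i w → unmatched i w ≡ marks i w
  unmatched-marks i w = trans (cong proj₂ (foldr-cong {f = _} {g = sigStep i} (λ _ _ → refl) refl w))
                              (cong proj₂ (signature i w))

countTrue-marks : ∀ i w → countTrue (marks i w) ≡ ε i w
countTrue-marks i []      = refl
countTrue-marks i (x ∷ w) with kind i x
... | self  = countTrue-marks i w
... | other = countTrue-marks i w
... | next  with φ i w
...   | zero  = cong suc (countTrue-marks i w)
...   | suc _ = countTrue-marks i w

εWord : ∀ i w → countTrue (unmatched i w) ≡ ε i w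
εWord i w = trans (cong countTrue (unmatched-marks i w)) (countTrue-marks i w)

E⇒eWord : ∀ {i u v} → E i u v → eWord i u ≡ just v
E⇒eWord {i} (mkE p₀ q εp φq) rewrite unmatched-marks i (p₀ ++ suc i ∷ q) = go p₀ εp
  where
  go : ∀ p → ε i p ≡ 0 → changeFirst i (p ++ suc i ∷ q) (marks i (p ++ suc i ∷ q)) ≡ just (p ++ i ∷ q)
  go []      _  rewrite kind-next i | φq = refl
  go (x ∷ p) εp with kind i x
  ... | self  rewrite go p εp = refl
  ... | other rewrite go p εp = refl
  ... | next  with φ i p in φp
  ...   | suc _ rewrite φ-before-unmatched i p q εp φq | φp | go p εp = refl

eWord⇒E : ∀ {i u v} → eWord i u ≡ just v → E i u v
eWord⇒E {i} {u₀} {v₀} eq rewrite unmatched-marks i u₀ = go u₀ v₀ eq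
  where
  cons : ∀ {x w w′} → E i w w′ → (kind i x ≡ next → φ i w ≢ 0) → E i (x ∷ w) (x ∷ w′)
  cons {x} (mkE p q εp φq) h = mkE (x ∷ p) q εxp φq
    where
    εxp : ε i (x ∷ p) ≡ 0
    εxp with kind i x
    ... | self  = εp
    ... | other = εp
    ... | next  with φ i p in φp
    ...   | suc _ = εp
    ...   | zero  = contradiction (trans (φ-before-unmatched i p q εp φq) φp) (h refl)
  go : ∀ u v → changeFirst i u (marks i u) ≡ just v → E i u v
  go (x ∷ w) v eq with kind i x in k | φ i w in φw
  go (x ∷ w) v eq | self | _ with changeFirst i w (marks i w) in cw
  go (x ∷ w) .(x ∷ w′) refl | self | _ | just w′ = cons (go w w′ cw) (λ k′ → case trans (sym k) k′ of λ ())
  go (x ∷ w) v eq | other | _ with changeFirst i w (marks i w) in cw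
  go (x ∷ w) .(x ∷ w′) refl | other | _ | just w′ = cons (go w w′ cw) (λ k′ → case trans (sym k) k′ of λ ())
  go (x ∷ w) v eq | next | suc _ with changeFirst i w (marks i w) in cw
  go (x ∷ w) .(x ∷ w′) refl | next | suc _ | just w′ = cons (go w w′ cw) (λ _ φ0 → case trans (sym φw) φ0 of λ ())
  go (x ∷ w) .(i ∷ w) refl | next | zero rewrite kind-elim {next} k = mkE [] w refl φw

E-functional : ∀ {i u v v′} → E i u v → E i u v′ → v ≡ v′
E-functional e e′ = just-injective (trans (sym (E⇒eWord e)) (E⇒eWord e′))

E-total : ∀ i u → ε i u ≡ 0 ⊎ Σ Word (E i u)
E-total i []      = inj₁ refl
E-total i (x ∷ w) with kind i x in k
... | self  = Sum.map₂ (λ (w′ , e) → x ∷ w′ , E-right (x ∷ []) (subst (λ z → εK (z ∷ []) ≤ _) (sym k) z≤n) e) (E-total i w)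
... | other = Sum.map₂ (λ (w′ , e) → x ∷ w′ , E-right (x ∷ []) (subst (λ z → εK (z ∷ []) ≤ _) (sym k) z≤n) e) (E-total i w)
... | next  with φ i w in φw
...   | zero  rewrite kind-elim {next} k = inj₂ (i ∷ w , mkE [] w refl φw)
...   | suc _ = Sum.map₂ (λ (w′ , e) → x ∷ w′ , E-right (x ∷ []) (subst (λ z → εK (z ∷ []) ≤ _) (sym k) (subst (1 ≤_) (sym φw) (s≤s z≤n))) e) (E-total i w)

-- Knuth equivalence commutes with the crystal operators.

infix 4 _≈_

-- Knuth equivalence.
data _≈_ : Word → Word → Set where
  ≈-refl  : ∀ {u} → u ≈ u
  ≈-sym   : ∀ {u v} → u ≈ v → v ≈ u
  ≈-trans : ∀ {u v w} → u ≈ v → v ≈ w → u ≈ w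
  ≈-cong  : ∀ {u u′ v v′} → u ≈ u′ → v ≈ v′ → u ++ v ≈ u′ ++ v′
  knuth₁  : ∀ {y b c} → y < b → b ≤ c → b ∷ c ∷ y ∷ [] ≈ b ∷ y ∷ c ∷ []
  knuth₂  : ∀ {x y z} → x ≤ y → y < z → x ∷ z ∷ y ∷ [] ≈ z ∷ x ∷ y ∷ []

≈-reflexive : ∀ {u v} → u ≡ v → u ≈ v
≈-reflexive refl = ≈-refl

-- A single step, with `≈` between the results: this is strong enough for the induction over `≈`,
-- and longer strings follow by iterating `≈-E`.
record Similar (i : ℕ) (u v : Word) : Set where
  constructor similar
  field
    φ-≡  : φ i u ≡ φ i v
    ε-≡  : ε i u ≡ ε i v
    step : ε i u ≡ 0 ⊎ ∃ λ u′ → ∃ λ v′ → E i u u′ × E i v v′ × u′ ≈ v′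
open Similar

private
  E₁ : ∀ {i x y z k₂ k₃} → kind i x ≡ next → kind i y ≡ k₂ → kind i z ≡ k₃ → φK (k₂ ∷ k₃ ∷ []) ≡ 0 →
       E i (x ∷ y ∷ z ∷ []) (i ∷ y ∷ z ∷ [])
  E₁ k refl refl h with refl ← kind-elim k = mkE [] _ refl h

  E₂ : ∀ {i x y z k₁ k₃} → kind i x ≡ k₁ → kind i y ≡ next → kind i z ≡ k₃ → εK (k₁ ∷ []) ≡ 0 → φK (k₃ ∷ []) ≡ 0 →
       E i (x ∷ y ∷ z ∷ []) (x ∷ i ∷ z ∷ [])
  E₂ {x = x} refl k refl h h′ with refl ← kind-elim k = mkE (x ∷ []) _ h h′

  E₃ : ∀ {i x y z k₁ k₂} → kind i x ≡ k₁ → kind i y ≡ k₂ → kind i z ≡ next → εK (k₁ ∷ k₂ ∷ []) ≡ 0 →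
       E i (x ∷ y ∷ z ∷ []) (x ∷ y ∷ i ∷ [])
  E₃ {x = x} {y} refl refl k h with refl ← kind-elim k = mkE (x ∷ y ∷ []) [] h refl

  ≤∧≢suc : ∀ {m n} → m ≤ suc n → m ≢ suc n → m ≤ n
  ≤∧≢suc p q = ≤-pred (≤∧≢⇒< p q)

  -- With the three kinds known, φ and ε compute, which reduces the Knuth relations to a finite
  -- table.
  kinds₁ : ∀ {i y b c ky kb kc} → kind i y ≡ ky → kind i b ≡ kb → kind i c ≡ kc →
    φK (kb ∷ kc ∷ ky ∷ []) ≡ φK (kb ∷ ky ∷ kc ∷ []) → εK (kb ∷ kc ∷ ky ∷ []) ≡ εK (kb ∷ ky ∷ kc ∷ []) →
    (εK (kb ∷ kc ∷ ky ∷ []) ≡ 0 ⊎ ∃ λ u → ∃ λ v → E i (b ∷ c ∷ y ∷ []) u × E i (b ∷ y ∷ c ∷ []) v × u ≈ v) →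
    Similar i (b ∷ c ∷ y ∷ []) (b ∷ y ∷ c ∷ [])
  kinds₁ refl refl refl = similar

  kinds₂ : ∀ {i x y z kx ky kz} → kind i x ≡ kx → kind i y ≡ ky → kind i z ≡ kz →
    φK (kx ∷ kz ∷ ky ∷ []) ≡ φK (kz ∷ kx ∷ ky ∷ []) → εK (kx ∷ kz ∷ ky ∷ []) ≡ εK (kz ∷ kx ∷ ky ∷ []) →
    (εK (kx ∷ kz ∷ ky ∷ []) ≡ 0 ⊎ ∃ λ u → ∃ λ v → E i (x ∷ z ∷ y ∷ []) u × E i (z ∷ x ∷ y ∷ []) v × u ≈ v) →
    Similar i (x ∷ z ∷ y ∷ []) (z ∷ x ∷ y ∷ [])
  kinds₂ refl refl refl = similar

  -- Some combinations of kinds contradict y < b ≤ c, others have ε = 0. In the rest, with one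
  -- exception, e_i changes the same letter on both sides, and the relation persists.
  similar-knuth₁ : ∀ i {y b c} → y < b → b ≤ c → Similar i (b ∷ c ∷ y ∷ []) (b ∷ y ∷ c ∷ [])
  similar-knuth₁ i {y} {b} {c} y<b b≤c with kind i y in ky | kind i b in kb | kind i c in kc
  ... | self | self | self = kinds₁ ky kb kc refl refl (inj₁ refl)
  ... | self | self | next = ⊥-elim (<-irrefl (trans (kind-elim ky) (sym (kind-elim kb))) y<b)
  ... | self | self | other = kinds₁ ky kb kc refl refl (inj₁ refl)
  ... | self | next | self = kinds₁ ky kb kc refl refl (inj₁ refl)
  -- The exception: b = c = i + 1 and y = i. Here e_i changes b on one side and c on the other, and
  -- the first Knuth relation turns into the second.
  ... | self | next | next = kinds₁ ky kb kc refl refl (inj₂ (_ , _ , E₁ kb kc ky refl , E₃ kb ky kc refl , subst₂ (λ p q → i ∷ p ∷ y ∷ [] ≈ q ∷ y ∷ i ∷ []) (sym (kind-elim kc)) (sym (kind-elim kb)) (subst (λ y → i ∷ suc i ∷ y ∷ [] ≈ suc i ∷ y ∷ i ∷ []) (sym (kind-elim ky)) (knuth₂ ≤-refl (n<1+n i)))))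
  ... | self | next | other = kinds₁ ky kb kc refl refl (inj₁ refl)
  ... | self | other | self = kinds₁ ky kb kc refl refl (inj₁ refl)
  ... | self | other | next = ⊥-elim (<-irrefl (kind-elim ky) (<-≤-trans y<b (≤∧≢suc (subst (b ≤_) (kind-elim kc) b≤c) (proj₂ (kind-elim kb)))))
  ... | self | other | other = kinds₁ ky kb kc refl refl (inj₁ refl)
  ... | next | self | self = ⊥-elim (<-asym (n<1+n i) (subst₂ _<_ (kind-elim ky) (kind-elim kb) y<b))
  ... | next | self | next = ⊥-elim (<-asym (n<1+n i) (subst₂ _<_ (kind-elim ky) (kind-elim kb) y<b))
  ... | next | self | other = ⊥-elim (<-asym (n<1+n i) (subst₂ _<_ (kind-elim ky) (kind-elim kb) y<b))
  ... | next | next | self = ⊥-elim (<-irrefl (trans (kind-elim ky) (sym (kind-elim kb))) y<b)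
  ... | next | next | next = ⊥-elim (<-irrefl (trans (kind-elim ky) (sym (kind-elim kb))) y<b)
  ... | next | next | other = ⊥-elim (<-irrefl (trans (kind-elim ky) (sym (kind-elim kb))) y<b)
  ... | next | other | self = ⊥-elim (<-asym (n<1+n i) (subst₂ _<_ (kind-elim ky) (kind-elim kc) (<-≤-trans y<b b≤c)))
  ... | next | other | next = ⊥-elim (<-irrefl (trans (kind-elim ky) (sym (kind-elim kc))) (<-≤-trans y<b b≤c))
  ... | next | other | other = kinds₁ ky kb kc refl refl (inj₂ (_ , _ , E₃ kb kc ky refl , E₂ kb ky kc refl refl , knuth₁ (<-trans (n<1+n i) (subst (_< b) (kind-elim ky) y<b)) b≤c))
  ... | other | self | self = kinds₁ ky kb kc refl refl (inj₁ refl)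
  ... | other | self | next = kinds₁ ky kb kc refl refl (inj₂ (_ , _ , E₂ kb kc ky refl refl , E₃ kb ky kc refl , knuth₁ y<b (≤-reflexive (kind-elim kb))))
  ... | other | self | other = kinds₁ ky kb kc refl refl (inj₁ refl)
  ... | other | next | self = kinds₁ ky kb kc refl refl (inj₁ refl)
  ... | other | next | next = kinds₁ ky kb kc refl refl (inj₂ (_ , _ , E₁ kb kc ky refl , E₁ kb ky kc refl , knuth₁ (≤∧≢⇒< (≤-pred (subst (y <_) (kind-elim kb) y<b)) (proj₁ (kind-elim ky))) (subst (i ≤_) (sym (kind-elim kc)) (n≤1+n i))))
  ... | other | next | other = kinds₁ ky kb kc refl refl (inj₂ (_ , _ , E₁ kb kc ky refl , E₁ kb ky kc refl , knuth₁ (≤∧≢⇒< (≤-pred (subst (y <_) (kind-elim kb) y<b)) (proj₁ (kind-elim ky))) (≤-trans (n≤1+n i) (subst (_≤ c) (kind-elim kb) b≤c))))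
  ... | other | other | self = kinds₁ ky kb kc refl refl (inj₁ refl)
  ... | other | other | next = kinds₁ ky kb kc refl refl (inj₂ (_ , _ , E₂ kb kc ky refl refl , E₃ kb ky kc refl , knuth₁ y<b (≤∧≢suc (subst (b ≤_) (kind-elim kc) b≤c) (proj₂ (kind-elim kb)))))
  ... | other | other | other = kinds₁ ky kb kc refl refl (inj₁ refl)

  similar-knuth₂ : ∀ i {x y z} → x ≤ y → y < z → Similar i (x ∷ z ∷ y ∷ []) (z ∷ x ∷ y ∷ [])
  similar-knuth₂ i {x} {y} {z} x≤y y<z with kind i x in kx | kind i y in ky | kind i z in kz
  ... | self | self | self = kinds₂ kx ky kz refl refl (inj₁ refl)
  ... | self | self | next = kinds₂ kx ky kz refl refl (inj₁ refl)
  ... | self | self | other = kinds₂ kx ky kz refl refl (inj₁ refl)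
  ... | self | next | self = ⊥-elim (<-asym (n<1+n i) (subst₂ _<_ (kind-elim ky) (kind-elim kz) y<z))
  ... | self | next | next = ⊥-elim (<-irrefl (trans (kind-elim ky) (sym (kind-elim kz))) y<z)
  ... | self | next | other = kinds₂ kx ky kz refl refl (inj₂ (_ , _ , E₃ kx kz ky refl , E₃ kz kx ky refl , knuth₂ (≤-reflexive (kind-elim kx)) (<-trans (n<1+n i) (subst (_< z) (kind-elim ky) y<z))))
  ... | self | other | self = kinds₂ kx ky kz refl refl (inj₁ refl)
  ... | self | other | next = ⊥-elim (proj₁ (kind-elim ky) (≤-antisym (≤-pred (subst (y <_) (kind-elim kz) y<z)) (subst (_≤ y) (kind-elim kx) x≤y)))
  ... | self | other | other = kinds₂ kx ky kz refl refl (inj₁ refl)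
  ... | next | self | self = kinds₂ kx ky kz refl refl (inj₁ refl)
  ... | next | self | next = ⊥-elim (1+n≰n (subst₂ _≤_ (kind-elim kx) (kind-elim ky) x≤y))
  ... | next | self | other = kinds₂ kx ky kz refl refl (inj₁ refl)
  ... | next | next | self = ⊥-elim (<-asym (n<1+n i) (subst₂ _<_ (kind-elim ky) (kind-elim kz) y<z))
  ... | next | next | next = ⊥-elim (<-irrefl (trans (kind-elim ky) (sym (kind-elim kz))) y<z)
  ... | next | next | other = kinds₂ kx ky kz refl refl (inj₂ (_ , _ , E₁ kx kz ky refl , E₂ kz kx ky refl refl , knuth₂ (subst (i ≤_) (sym (kind-elim ky)) (n≤1+n i)) y<z))
  ... | next | other | self = ⊥-elim (<-asym (n<1+n i) (subst₂ _<_ (kind-elim kx) (kind-elim kz) (≤-<-trans x≤y y<z)))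
  ... | next | other | next = ⊥-elim (<-irrefl (trans (kind-elim kx) (sym (kind-elim kz))) (≤-<-trans x≤y y<z))
  ... | next | other | other = kinds₂ kx ky kz refl refl (inj₂ (_ , _ , E₁ kx kz ky refl , E₂ kz kx ky refl refl , knuth₂ (≤-trans (n≤1+n i) (subst (_≤ y) (kind-elim kx) x≤y)) y<z))
  ... | other | self | self = kinds₂ kx ky kz refl refl (inj₁ refl)
  ... | other | self | next = kinds₂ kx ky kz refl refl (inj₁ refl)
  ... | other | self | other = kinds₂ kx ky kz refl refl (inj₁ refl)
  ... | other | next | self = ⊥-elim (<-asym (n<1+n i) (subst₂ _<_ (kind-elim ky) (kind-elim kz) y<z))
  ... | other | next | next = ⊥-elim (<-irrefl (trans (kind-elim ky) (sym (kind-elim kz))) y<z)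
  ... | other | next | other = kinds₂ kx ky kz refl refl (inj₂ (_ , _ , E₃ kx kz ky refl , E₃ kz kx ky refl , knuth₂ (≤∧≢suc (subst (x ≤_) (kind-elim ky) x≤y) (proj₂ (kind-elim kx))) (<-trans (n<1+n i) (subst (_< z) (kind-elim ky) y<z))))
  ... | other | other | self = kinds₂ kx ky kz refl refl (inj₁ refl)
  ... | other | other | next = kinds₂ kx ky kz refl refl (inj₂ (_ , _ , E₂ kx kz ky refl refl , E₁ kz kx ky refl , knuth₂ x≤y (≤∧≢⇒< (≤-pred (subst (y <_) (kind-elim kz) y<z)) (proj₁ (kind-elim ky)))))
  ... | other | other | other = kinds₂ kx ky kz refl refl (inj₁ refl)

similar-refl : ∀ i u → Similar i u u
similar-refl i u = similar refl refl (Sum.map₂ (λ (u′ , e) → u′ , u′ , e , e , ≈-refl) (E-total i u))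

-- The tensor product rule chooses the factor by φ and ε alone, so e_i acts on the same side in both
-- products.
similar-cong : ∀ i {u u′ v v′} → u ≈ u′ → v ≈ v′ → Similar i u u′ → Similar i v v′ → Similar i (u ++ v) (u′ ++ v′)
similar-cong i {u} {u′} {v} {v′} u≈u′ v≈v′ su sv = similar φ-eq ε-eq st
  where
  φ-eq : φ i (u ++ v) ≡ φ i (u′ ++ v′)
  φ-eq rewrite φ-++ i u v | φ-++ i u′ v′ | φ-≡ su | φ-≡ sv | ε-≡ su = refl
  ε-eq : ε i (u ++ v) ≡ ε i (u′ ++ v′)
  ε-eq rewrite ε-++ i u v | ε-++ i u′ v′ | φ-≡ sv | ε-≡ sv | ε-≡ su = refl
  st : ε i (u ++ v) ≡ 0 ⊎ ∃ λ w → ∃ λ w′ → E i (u ++ v) w × E i (u′ ++ v′) w′ × w ≈ w′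
  st with φ i v <? ε i u | step su | step sv
  ... | yes lt | inj₁ ε0 | _ = contradiction (subst (φ i v <_) ε0 lt) n≮0
  ... | yes lt | inj₂ (_ , _ , e , e′ , r) | _ =
    inj₂ (_ , _ , E-left v lt e , E-left v′ (subst₂ _<_ (φ-≡ sv) (ε-≡ su) lt) e′ , ≈-cong r v≈v′)
  ... | no ≮ | _ | inj₁ ε0 = inj₁ (trans (ε-++ i u v) (cong₂ _+_ ε0 (m≤n⇒m∸n≡0 (≮⇒≥ ≮))))
  ... | no ≮ | _ | inj₂ (_ , _ , e , e′ , r) =
    inj₂ (_ , _ , E-right u (≮⇒≥ ≮) e , E-right u′ (subst₂ _≤_ (ε-≡ su) (φ-≡ sv) (≮⇒≥ ≮)) e′ , ≈-cong u≈u′ r)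

≈-similar : ∀ i {u v} → u ≈ v → Similar i u v
≈-similar i (≈-refl {u}) = similar-refl i u
≈-similar i (≈-sym r) with ≈-similar i r
... | similar p q s = similar (sym p) (sym q)
  (Sum.map (trans (sym q)) (λ (_ , _ , e , e′ , r′) → _ , _ , e′ , e , ≈-sym r′) s)
≈-similar i (≈-trans {v = v} r r′) with ≈-similar i r | ≈-similar i r′
... | similar p q s | similar p′ q′ s′ = similar (trans p p′) (trans q q′) (st s s′)
  where
  st : _ → _ → _
  st (inj₁ z) _        = inj₁ z
  st (inj₂ _) (inj₁ z) = inj₁ (trans q z)
  st (inj₂ (_ , _ , e , e₁ , t)) (inj₂ (_ , _ , e₂ , e′ , t′)) with refl ← E-functional e₁ e₂ =
    inj₂ (_ , _ , e , e′ , ≈-trans t t′)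
≈-similar i (≈-cong r r′)  = similar-cong i r r′ (≈-similar i r) (≈-similar i r′)
≈-similar i (knuth₁ p q)   = similar-knuth₁ i p q
≈-similar i (knuth₂ p q)   = similar-knuth₂ i p q

≈-ε : ∀ i {u v} → u ≈ v → ε i u ≡ ε i v
≈-ε i r = ε-≡ (≈-similar i r)

≈-E : ∀ {i u u′ v} → u ≈ v → E i u u′ → ∃ λ v′ → E i v v′ × u′ ≈ v′
≈-E {i} r e with step (≈-similar i r)
... | inj₁ ε0 = case trans (sym ε0) (E-ε e) of λ ()
... | inj₂ (_ , v′ , e₁ , e′ , r′) with refl ← E-functional e e₁ = v′ , e′ , r′

-- Duality of words, and strings of operators.

-- Reversing a word and complementing its letters exchanges e_i with f_{r-i}.
star : ℕ → Word → Word
star r w = map (suc r ∸_) (reverse w)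

star-++ : ∀ r u v → star r (u ++ v) ≡ star r v ++ star r u
star-++ r u v rewrite reverse-++ u v = map-++ _ (reverse v) (reverse u)

star-∷ : ∀ r x w → star r (x ∷ w) ≡ star r w ++ (suc r ∸ x) ∷ []
star-∷ r x w = star-++ r (x ∷ []) w

flipKind : Kind → Kind
flipKind self  = next
flipKind next  = self
flipKind other = other

private
  kind-star : ∀ {r i x} → i < r → x ≤ r → kind (r ∸ i) (suc r ∸ x) ≡ flipKind (kind i x)
  kind-star {r} {i} {x} i<r x≤r with kind i x in k
  ... | self  rewrite kind-elim {self} k | +-∸-assoc 1 (<⇒≤ i<r) = kind-next (r ∸ i)
  ... | next  rewrite kind-elim {next} k = kind-self (r ∸ i)
  ... | other with x≢i , x≢i+1 ← kind-elim {other} k =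
    kind-other (λ eq → x≢i+1 (∸-cancelˡ-≡ (m≤n⇒m≤1+n x≤r) (s≤s (<⇒≤ i<r)) eq))
               (λ eq → x≢i (∸-cancelˡ-≡ (m≤n⇒m≤1+n x≤r) (m≤n⇒m≤1+n (<⇒≤ i<r)) (trans eq (sym (+-∸-assoc 1 (<⇒≤ i<r))))))

ε-star : ∀ {r i w} → i < r → All (_≤ r) w → ε (r ∸ i) (star r w) ≡ φ i w
φ-star : ∀ {r i w} → i < r → All (_≤ r) w → φ (r ∸ i) (star r w) ≡ ε i w

ε-star {w = []} _ _ = refl
ε-star {r} {i} {x ∷ w} i<r (px ∷ pw)
  rewrite star-∷ r x w | ε-++ (r ∸ i) (star r w) ((suc r ∸ x) ∷ []) | ε-star i<r pw | kind-star i<r px with kind i x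
... | self  = refl
... | next  = pred-∸ (φ i w)
  where
  pred-∸ : ∀ n → n ∸ 1 ≡ pred n
  pred-∸ zero    = refl
  pred-∸ (suc n) = refl
... | other = refl

φ-star {w = []} _ _ = refl
φ-star {r} {i} {x ∷ w} i<r (px ∷ pw)
  rewrite star-∷ r x w | φ-++ (r ∸ i) (star r w) ((suc r ∸ x) ∷ []) | φ-star i<r pw | ε-star i<r pw | kind-star i<r px with kind i x
... | self  = trans (cong (ε i w +_) (0∸n≡0 (φ i w))) (+-identityʳ _)
... | next  = trans (+-comm (ε i w) _) (cong (_+ ε i w) (1∸n (φ i w)))
  where
  1∸n : ∀ n → 1 ∸ n ≡ isZero n
  1∸n zero          = refl
  1∸n (suc zero)    = refl
  1∸n (suc (suc n)) = refl
... | other = trans (cong (ε i w +_) (0∸n≡0 (φ i w))) (+-identityʳ _)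

private
  star-split : ∀ r p x q → star r (p ++ x ∷ q) ≡ star r q ++ (suc r ∸ x) ∷ star r p
  star-split r p x q = begin
    star r (p ++ x ∷ q)                            ≡⟨ star-++ r p (x ∷ q) ⟩
    star r (x ∷ q) ++ star r p                     ≡⟨ cong (_++ star r p) (star-∷ r x q) ⟩
    (star r q ++ (suc r ∸ x) ∷ []) ++ star r p     ≡⟨ ++-assoc (star r q) _ _ ⟩
    star r q ++ (suc r ∸ x) ∷ star r p             ∎
    where open ≡-Reasoning

E-star : ∀ {r i u v} → i < r → All (_≤ r) u → E i u v → E (r ∸ i) (star r v) (star r u)
E-star {r} {i} i<r pu (mkE p q εp φq)
  rewrite star-split r p i q | star-split r p (suc i) q | +-∸-assoc 1 (<⇒≤ i<r) =
  mkE (star r q) (star r p)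
      (trans (ε-star i<r (All.++⁻ʳ (suc i ∷ []) (All.++⁻ʳ p pu))) φq)
      (trans (φ-star i<r (All.++⁻ˡ p pu)) εp)

E-bounded : ∀ {r i u v} → All (_≤ r) u → E i u v → All (_≤ r) v
E-bounded {r} pu (mkE p q _ _) with All.++⁻ʳ p pu
... | ps ∷ pq = All.++⁺ (All.++⁻ˡ p pu) (≤-trans (n≤1+n _) ps ∷ pq)

-- `EN i n u v` doubles as the f_i-string from v to u; it is a maximal one when `φ i u ≡ 0`.
data EN (i : ℕ) : ℕ → Word → Word → Set where
  done : ∀ {u} → EN i 0 u u
  _◅_  : ∀ {n u v w} → E i u v → EN i n v w → EN i (suc n) u w

_◅◅_ : ∀ {i m n u v w} → EN i m u v → EN i n v w → EN i (m + n) u w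
done     ◅◅ t = t
(e ◅ s) ◅◅ t = e ◅ (s ◅◅ t)

EN-φ : ∀ {i n u v} → EN i n u v → φ i v ≡ n + φ i u
EN-φ done    = refl
EN-φ {i} {suc n} (e ◅ s) = trans (EN-φ s) (trans (cong (n +_) (E-φ e)) (+-suc n _))

EN-left : ∀ {i n u u′} v → φ i v ≡ 0 → EN i n u u′ → EN i n (u ++ v) (u′ ++ v)
EN-left v φv done    = done
EN-left v φv (e ◅ s) = E-left v (subst₂ _<_ (sym φv) (sym (E-ε e)) (s≤s z≤n)) e ◅ EN-left v φv s

EN-right : ∀ {i n v v′} u → ε i u ≡ 0 → EN i n v v′ → EN i n (u ++ v) (u ++ v′)
EN-right u εu done    = done
EN-right u εu (e ◅ s) = E-right u (subst (_≤ _) (sym εu) z≤n) e ◅ EN-right u εu s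

EN-bounded : ∀ {r i n u v} → All (_≤ r) u → EN i n u v → All (_≤ r) v
EN-bounded pu done    = pu
EN-bounded pu (e ◅ s) = EN-bounded (E-bounded pu e) s

≈-EN : ∀ {i n u u′ v} → u ≈ v → EN i n u u′ → ∃ λ v′ → EN i n v v′ × u′ ≈ v′
≈-EN r done    = _ , done , r
≈-EN r (e ◅ s) with v₁ , e′ , r′ ← ≈-E r e with v₂ , s′ , r″ ← ≈-EN r′ s = v₂ , (e′ ◅ s′) , r″

EN-snoc : ∀ {i n u v w} → EN i n u v → E i v w → EN i (suc n) u w
EN-snoc done     e = e ◅ done
EN-snoc (e′ ◅ s) e = e′ ◅ EN-snoc s e

EN-star : ∀ {r i n u v} → i < r → All (_≤ r) u → EN i n u v → EN (r ∸ i) n (star r v) (star r u)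
EN-star i<r pu done    = done
EN-star i<r pu (e ◅ s) = EN-snoc (EN-star i<r (E-bounded pu e) s) (E-star i<r pu e)

-- Crystal operators on tableaux

concat-splitBy : ∀ (ns : List ℕ) w → sum ns ≡ length w → concat (splitBy ns w) ≡ w
concat-splitBy []       []      _  = refl
concat-splitBy (n ∷ ns) w       eq = begin
  take n w ++ concat (splitBy ns (drop n w))
    ≡⟨ cong (take n w ++_) (concat-splitBy ns (drop n w) len-drop) ⟩
  take n w ++ drop n w ≡⟨ take++drop≡id n w ⟩
  w ∎
  where
  open ≡-Reasoning
  len-drop : sum ns ≡ length (drop n w)
  len-drop = trans (sym (m+n∸m≡n n _)) (trans (cong (_∸ n) eq) (sym (length-drop n w)))

map-length-splitBy : ∀ (ns : List ℕ) (w : Word) → sum ns ≡ length w → map length (splitBy ns w) ≡ ns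
map-length-splitBy []       w eq = refl
map-length-splitBy (n ∷ ns) w eq =
  cong₂ _∷_ (trans (length-take n w) (m≤n⇒m⊓n≡m (subst (n ≤_) eq (m≤m+n n _))))
            (map-length-splitBy ns (drop n w)
              (trans (sym (m+n∸m≡n n _)) (trans (cong (_∸ n) eq) (sym (length-drop n w)))))

sum-map-length : ∀ (ws : List Word) → sum (map length ws) ≡ length (concat ws)
sum-map-length []       = refl
sum-map-length (w ∷ ws) = trans (cong (length w +_) (sum-map-length ws)) (sym (length-++ w))

E-length : ∀ {i u v} → E i u v → length u ≡ length v
E-length (mkE p q _ _) = trans (length-++ p) (sym (length-++ p))

shapeT : Tableau → List ℕ
shapeT = map length

private
  splitT : Tableau → Word → Tableau
  splitT T w = reverse (splitBy (map length (reverse T)) w)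

  module _ {i T v} (e : E i (readingWord T) v) where
    sum-eq : sum (map length (reverse T)) ≡ length v
    sum-eq = trans (sum-map-length (reverse T)) (E-length e)

    readingWord-splitT : readingWord (splitT T v) ≡ v
    readingWord-splitT rewrite reverse-involutive (splitBy (map length (reverse T)) v) =
      concat-splitBy (map length (reverse T)) v sum-eq

    shapeT-splitT : shapeT (splitT T v) ≡ shapeT T
    shapeT-splitT = begin
      map length (reverse (splitBy (map length (reverse T)) v)) ≡⟨ reverse-map length (splitBy (map length (reverse T)) v) ⟩
      reverse (map length (splitBy (map length (reverse T)) v)) ≡⟨ cong reverse (map-length-splitBy (map length (reverse T)) v sum-eq) ⟩
      reverse (map length (reverse T)) ≡⟨ cong reverse (reverse-map length T) ⟩
      reverse (reverse (map length T)) ≡⟨ reverse-involutive (map length T) ⟩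
      map length T ∎
      where open ≡-Reasoning

-- `eT` cuts the new word at the old row lengths. Word and shape are tracked together because only
-- both determine a tableau (`readingWord-injective`).
E⇒eT : ∀ {i T v} → E i (readingWord T) v → ∃ λ T′ → eT i T ≡ just T′ × readingWord T′ ≡ v × shapeT T′ ≡ shapeT T
E⇒eT {i} {T} {v} e rewrite E⇒eWord e = splitT T v , refl , readingWord-splitT {T = T} e , shapeT-splitT {T = T} e

eT⇒E : ∀ {i T T′} → eT i T ≡ just T′ → E i (readingWord T) (readingWord T′)
eT⇒E {i} {T} eq with eWord i (readingWord T) in we
eT⇒E {i} {T} refl | just v = subst (E i (readingWord T)) (sym (readingWord-splitT {T = T} (eWord⇒E we))) (eWord⇒E we)

++-split : ∀ (u v : Word) {u′ v′} → length u ≡ length v → u ++ u′ ≡ v ++ v′ → u ≡ v × u′ ≡ v′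
++-split []      []      _  eq = refl , eq
++-split (x ∷ u) (y ∷ v) le eq with refl , eq′ ← ∷-injective eq =
  ×.map₁ (cong (x ∷_)) (++-split u v (suc-injective le) eq′)

concat-injective : ∀ (us vs : List Word) → map length us ≡ map length vs → concat us ≡ concat vs → us ≡ vs
concat-injective []       []       _  _ = refl
concat-injective (u ∷ us) (v ∷ vs) le ce with u≡v , ce′ ← ++-split u v (proj₁ (∷-injective le)) ce =
  cong₂ _∷_ u≡v (concat-injective us vs (proj₂ (∷-injective le)) ce′)

readingWord-injective : ∀ {T T′} → shapeT T ≡ shapeT T′ → readingWord T ≡ readingWord T′ → T ≡ T′
readingWord-injective {T} {T′} se we = reverse-injective (concat-injective (reverse T) (reverse T′)
  (trans (reverse-map length T) (trans (cong reverse se) (sym (reverse-map length T′)))) we)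

εT-ε : ∀ i T → εT i T ≡ ε i (readingWord T)
εT-ε i T = εWord i (readingWord T)

ePow-EN : ∀ {i n T v} → EN i n (readingWord T) v → readingWord (ePow i n T) ≡ v
ePow-EN done = refl
ePow-EN {i} {T = T} (e ◅ s) with T′ , eq , refl , _ ← E⇒eT {T = T} e rewrite eq = ePow-EN s

applyE-++ : ∀ is js T → applyE (is ++ js) T ≡ (applyE is T >>= applyE js)
applyE-++ []       js T = refl
applyE-++ (i ∷ is) js T with eT i T
... | just T′ = applyE-++ is js T′
... | nothing = refl

-- The path that IsLusztig prescribes from the lowest weight tableau L is defined, and it ends at a
-- tableau equivalent to the reversed complement of T.
dual-path : ∀ {r H L} → (readingWord L ≈ star r (readingWord H)) → ∀ is T → All (_≤ r) (readingWord T) →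
  All (λ i → 1 ≤ i × i < r) is → applyE is T ≡ just H →
  ∃ λ T′ → applyE (map (r ∸_) (reverse is)) L ≡ just T′ × readingWord T′ ≈ star r (readingWord T)
dual-path {L = L} L≈H [] T _ _ refl = L , refl , L≈H
dual-path {r} {H} {L} L≈H (i ∷ is) T T≤r ((_ , i<r) ∷ his) eq with eT i T in eqT
... | just T₁
  with e ← eT⇒E {i} {T} eqT
  with T₁′ , eq₁ , r₁ ← dual-path {L = L} L≈H is T₁ (E-bounded T≤r e) his eq
  with v , e′ , r₂ ← ≈-E (≈-sym r₁) (E-star i<r T≤r e)
  with T′ , eq₂ , refl , _ ← E⇒eT {T = T₁′} e′ = T′ , path , ≈-sym r₂
  where
  path : applyE (map (r ∸_) (reverse (i ∷ is))) L ≡ just T′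
  path rewrite unfold-reverse i is | map-++ (r ∸_) (reverse is) (i ∷ [])
             | applyE-++ (map (r ∸_) (reverse is)) ((r ∸ i) ∷ []) L | eq₁ | eq₂ = refl

-- Maximal e_{r-i}-strings starting at T are read off from maximal f_i-strings starting at v.
εT-string : ∀ {r i n v v′ T} → i < r → All (_≤ r) v′ → EN i n v′ v → φ i v′ ≡ 0 →
  readingWord T ≈ star r v → εT (r ∸ i) T ≡ n × readingWord (ePow (r ∸ i) n T) ≈ star r v′
εT-string {r} {i} {n} {v} {v′} {T} i<r v≤r s φ0 T≈v
  with w , s′ , r′ ← ≈-EN (≈-sym T≈v) (EN-star i<r v≤r s) =
  trans (εT-ε (r ∸ i) T) (trans (≈-ε (r ∸ i) T≈v) (trans (ε-star i<r (EN-bounded v≤r s)) (trans (EN-φ s) (trans (cong (n +_) φ0) (+-identityʳ n))))) ,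
  subst (_≈ star r v′) (sym (ePow-EN {T = T} s′)) (≈-sym r′)

-- The lowest weight tableau by row insertion.

private
  data Ascending : ℕ → Word → Set where
    []  : ∀ {x} → Ascending x []
    _∷_ : ∀ {x z w} → x ≤ z → Ascending z w → Ascending x (z ∷ w)

  weaken : ∀ {x y w} → x ≤ y → Ascending y w → Ascending x w
  weaken p []      = []
  weaken p (q ∷ a) = ≤-trans p q ∷ a

  replicate-asc : ∀ n {x w} → Ascending x w → Ascending x (replicate n x ++ w)
  replicate-asc zero    a = a
  replicate-asc (suc n) a = ≤-refl ∷ replicate-asc n a

replicate-snoc : ∀ {A : Set} n (x : A) w → replicate (suc n) x ++ w ≡ replicate n x ++ x ∷ w
replicate-snoc zero    x w = refl
replicate-snoc (suc n) x w = cong (x ∷_) (replicate-snoc n x w)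

replicate-+ : ∀ {A : Set} m n (x : A) → replicate (m + n) x ≡ replicate m x ++ replicate n x
replicate-+ zero    n x = refl
replicate-+ (suc m) n x = cong (x ∷_) (replicate-+ m n x)

≈-congˡ : ∀ u {v v′} → v ≈ v′ → u ++ v ≈ u ++ v′
≈-congˡ u = ≈-cong (≈-refl {u})

≈-congʳ : ∀ {u u′} v → u ≈ u′ → u ++ v ≈ u′ ++ v
≈-congʳ v r = ≈-cong r (≈-refl {v})

module ≈-Reasoning where
  infix  1 begin_
  infixr 2 _≈⟨_⟩_ _≡⟨_⟩≈_
  infix  3 _∎≈

  begin_ : ∀ {u v} → u ≈ v → u ≈ v
  begin r = r
  _≈⟨_⟩_ : ∀ u {v w} → u ≈ v → v ≈ w → u ≈ w
  u ≈⟨ r ⟩ s = ≈-trans r s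
  _≡⟨_⟩≈_ : ∀ u {v w} → u ≡ v → v ≈ w → u ≈ w
  u ≡⟨ r ⟩≈ s = ≈-trans (≈-reflexive r) s
  _∎≈ : ∀ u → u ≈ u
  u ∎≈ = ≈-refl

private
  -- The appended y travels left past the larger letters of the row; in each use of `knuth₁` the
  -- left neighbour of the letter passed is the witness.
  pass : ∀ {x y w} → y < x → Ascending x w → x ∷ (w ++ y ∷ []) ≈ x ∷ y ∷ w
  pass y<x []                              = ≈-refl
  pass {x} {y} y<x (_∷_ {z = z} {w} x≤z a) =
    ≈-trans (≈-congˡ (x ∷ []) (pass (<-≤-trans y<x x≤z) a)) (≈-congʳ w (knuth₁ y<x x≤z))

  -- The bumped x leaves to the left, past the letters y inserted before.
  bump : ∀ {x y} → y < x → ∀ n → replicate n y ++ x ∷ y ∷ [] ≈ x ∷ replicate (suc n) y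
  bump         y<x zero    = ≈-refl
  bump {x} {y} y<x (suc n) =
    ≈-trans (≈-congˡ (y ∷ []) (bump y<x n)) (≈-congʳ (replicate n y) (knuth₂ ≤-refl y<x))

-- Row insertion of y^n into the row x^n w.
insert-row : ∀ {x y w} → y < x → Ascending x w → ∀ n →
  (replicate n x ++ w) ++ replicate n y ≈ replicate n x ++ replicate n y ++ w
insert-row {w = w} y<x a zero = ≈-reflexive (++-identityʳ w)
insert-row {x} {y} {w} y<x a (suc n) = begin
  (xs′ ++ w) ++ ys′                     ≡⟨ cong₂ _++_ (replicate-snoc n x w) (trans (sym (++-identityʳ ys′)) (replicate-snoc n y [])) ⟩≈
  (xs ++ x ∷ w) ++ (ys ++ y ∷ [])       ≡⟨ sym (++-assoc (xs ++ x ∷ w) ys _) ⟩≈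
  ((xs ++ x ∷ w) ++ ys) ++ y ∷ []       ≈⟨ ≈-congʳ (y ∷ []) (insert-row y<x (≤-refl ∷ a) n) ⟩
  (xs ++ (ys ++ x ∷ w)) ++ y ∷ []       ≡⟨ trans (++-assoc xs _ _) (cong (xs ++_) (++-assoc ys _ _)) ⟩≈
  xs ++ (ys ++ x ∷ (w ++ y ∷ []))       ≈⟨ ≈-congˡ xs (≈-congˡ ys (pass y<x a)) ⟩
  xs ++ (ys ++ x ∷ y ∷ w)               ≡⟨ cong (xs ++_) (sym (++-assoc ys (x ∷ y ∷ []) w)) ⟩≈
  xs ++ ((ys ++ x ∷ y ∷ []) ++ w)       ≈⟨ ≈-congˡ xs (≈-congʳ w (bump y<x n)) ⟩
  xs ++ (x ∷ ys′ ++ w)                  ≡⟨ sym (replicate-snoc n x (ys′ ++ w)) ⟩≈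
  xs′ ++ ys′ ++ w                       ∎≈
  where
  open ≈-Reasoning
  xs  = replicate n x
  xs′ = replicate (suc n) x
  ys  = replicate n y
  ys′ = replicate (suc n) y

-- Lowest weight tableau of the shape (l k, …, l (k + d - 1)) in the letters x, x+1, …, x+d-1:
-- its first row is the word lowRow l k d x 0.
module _ (l : ℕ → ℕ) where
  -- The first p columns are already filled. The columns up to `l (k + d)` have full height and
  -- begin with x; the remaining ones are shorter and begin with a larger letter.
  lowRow : ℕ → ℕ → ℕ → ℕ → Word
  lowRow k zero    x p = []
  lowRow k (suc d) x p = replicate (l (k + d) ∸ p) x ++ lowRow k d (suc x) (l (k + d))

  lowRows : ℕ → ℕ → ℕ → Tableau
  lowRows k zero    x = []
  lowRows k (suc d) x = lowRow k (suc d) x 0 ∷ lowRows (suc k) d (suc x)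

  highWord : ℕ → Word
  highWord zero    = []
  highWord (suc t) = replicate (l t) (suc t) ++ highWord t

  private
    lowRow-asc : ∀ k d x p → Ascending x (lowRow k d x p)
    lowRow-asc k zero    x p = []
    lowRow-asc k (suc d) x p = replicate-asc (l (k + d) ∸ p) (weaken (n≤1+n x) (lowRow-asc k d (suc x) _))

  readingWord-∷ : ∀ R T → readingWord (R ∷ T) ≡ readingWord T ++ R
  readingWord-∷ R T rewrite unfold-reverse R T | sym (concat-++ (reverse T) (R ∷ [])) | ++-identityʳ R = refl

  module _ (l-mono : ∀ j → l (suc j) ≤ l j) where
    -- The letters y^a, inserted into the first row, bump its leading (y+1)^a, and these are
    -- inserted into the rows below in the same manner until a new bottom row arises.
    insert-low : ∀ k d y → readingWord (lowRows k d (suc y)) ++ replicate (l (k + d)) y ≈ readingWord (lowRows k (suc d) y)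
    insert-low k zero    y = ≈-reflexive (sym (trans (readingWord-∷ (lowRow k 1 y 0) []) (++-identityʳ _)))
    insert-low k (suc d) y = begin
      readingWord (lowRows k (suc d) (suc y)) ++ replicate a y
        ≡⟨ trans (cong (_++ replicate a y) (readingWord-∷ (lowRow k (suc d) (suc y) 0) (lowRows (suc k) d (suc (suc y))))) (++-assoc low _ _) ⟩≈
      low ++ (lowRow k (suc d) (suc y) 0 ++ replicate a y)
        ≡⟨ cong (λ z → low ++ (z ++ replicate a y)) row-split ⟩≈
      low ++ ((replicate a (suc y) ++ row) ++ replicate a y)
        ≈⟨ ≈-congˡ low (insert-row (n<1+n y) (replicate-asc (l (k + d) ∸ a) (weaken (n≤1+n _) (lowRow-asc k d _ _))) a) ⟩
      low ++ (replicate a (suc y) ++ (replicate a y ++ row))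
        ≡⟨ sym (++-assoc low _ _) ⟩≈
      (low ++ replicate a (suc y)) ++ (replicate a y ++ row)
        ≈⟨ ≈-congʳ _ (subst (λ z → low ++ replicate (l z) (suc y) ≈ readingWord (lowRows (suc k) (suc d) (suc y))) (sym (+-suc k d)) (insert-low (suc k) d (suc y))) ⟩
      readingWord (lowRows (suc k) (suc d) (suc y)) ++ lowRow k (suc (suc d)) y 0
        ≡⟨ sym (readingWord-∷ (lowRow k (suc (suc d)) y 0) (lowRows (suc k) (suc d) (suc y))) ⟩≈
      readingWord (lowRows k (suc (suc d)) y) ∎≈
      where
      open ≈-Reasoning
      a   = l (k + suc d)
      low = readingWord (lowRows (suc k) d (suc (suc y)))
      row = replicate (l (k + d) ∸ a) (suc y) ++ lowRow k d (suc (suc y)) (l (k + d))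
      a≤  : a ≤ l (k + d)
      a≤ = subst (λ z → l z ≤ l (k + d)) (sym (+-suc k d)) (l-mono (k + d))
      row-split : lowRow k (suc d) (suc y) 0 ≡ replicate a (suc y) ++ row
      row-split = trans (cong (λ n → replicate n (suc y) ++ lowRow k d (suc (suc y)) (l (k + d))) (sym (m+[n∸m]≡n a≤)))
        (trans (cong (_++ lowRow k d (suc (suc y)) (l (k + d))) (replicate-+ a _ (suc y))) (++-assoc (replicate a (suc y)) _ _))

    star-replicate : ∀ r n x → star r (replicate n x) ≡ replicate n (suc r ∸ x)
    star-replicate r zero    x = refl
    star-replicate r (suc n) x = trans (star-∷ r x (replicate n x)) (trans (cong (_++ _) (star-replicate r n x))
      (trans (sym (replicate-snoc n (suc r ∸ x) [])) (++-identityʳ _)))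

    -- `star` reverses, so the next row of the highest weight tableau appears at the right end of
    -- the word, ready for insertion.
    low≈star-high : ∀ r t → t ≤ r → readingWord (lowRows 0 t (suc (r ∸ t))) ≈ star r (highWord t)
    low≈star-high r zero    _   = ≈-refl
    low≈star-high r (suc t) t<r = ≈-sym (begin
      star r (replicate (l t) (suc t) ++ highWord t)
        ≡⟨ star-++ r (replicate (l t) (suc t)) (highWord t) ⟩≈
      star r (highWord t) ++ star r (replicate (l t) (suc t))
        ≈⟨ ≈-cong (≈-sym (low≈star-high r t (<⇒≤ t<r))) (≈-reflexive (star-replicate r (l t) (suc t))) ⟩
      readingWord (lowRows 0 t (suc (r ∸ t))) ++ replicate (l t) (r ∸ t)
        ≈⟨ insert-low 0 t (r ∸ t) ⟩
      readingWord (lowRows 0 (suc t) (r ∸ t))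
        ≡⟨ cong (λ z → readingWord (lowRows 0 (suc t) z)) (∸-suc t<r) ⟩≈
      readingWord (lowRows 0 (suc t) (suc (r ∸ suc t))) ∎≈)
      where
      open ≈-Reasoning
      ∸-suc : ∀ {m n} → m < n → n ∸ m ≡ suc (n ∸ suc m)
      ∸-suc {m} {suc n} m<n = +-∸-assoc 1 (≤-pred m<n)

-- Maximal strings on words composed of rows.

rowsWord : (ℕ → Word) → ℕ → Word
rowsWord row zero    = []
rowsWord row (suc t) = row t ++ rowsWord row t

rowsWord-cong : ∀ {f g} → (∀ j → f j ≡ g j) → ∀ t → rowsWord f t ≡ rowsWord g t
rowsWord-cong h zero    = refl
rowsWord-cong h (suc t) = cong₂ _++_ (h t) (rowsWord-cong h t)

Σ< : (ℕ → ℕ) → ℕ → ℕ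
Σ< f zero    = 0
Σ< f (suc t) = f t + Σ< f t

Neutral : ℕ → Word → Set
Neutral i = All (λ x → kind i x ≡ other)

module _ {i : ℕ} where
  neutral-φ : ∀ {w} → Neutral i w → φ i w ≡ 0
  neutral-φ []                = refl
  neutral-φ (k ∷ n) rewrite k = neutral-φ n

  neutral-ε : ∀ {w} → Neutral i w → ε i w ≡ 0
  neutral-ε []                = refl
  neutral-ε (k ∷ n) rewrite k = neutral-ε n

  φ-neutral-++ : ∀ {u} v → Neutral i u → φ i (u ++ v) ≡ φ i v
  φ-neutral-++ {u} v n rewrite φ-++ i u v | neutral-φ n | neutral-ε n = refl

  ε-neutral-++ : ∀ {u} v → Neutral i u → ε i (u ++ v) ≡ ε i v
  ε-neutral-++ {u} v n rewrite ε-++ i u v | neutral-ε n | 0∸n≡0 (φ i v) = +-identityʳ _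

  φ-selfs : ∀ n → φ i (replicate n i) ≡ n
  φ-selfs zero    = refl
  φ-selfs (suc n) = trans (φ-self∷ i (replicate n i)) (cong suc (φ-selfs n))

  ε-selfs : ∀ n → ε i (replicate n i) ≡ 0
  ε-selfs zero    = refl
  ε-selfs (suc n) = trans (ε-self∷ i (replicate n i)) (ε-selfs n)

  φ-nexts : ∀ n → φ i (replicate n (suc i)) ≡ 0
  φ-nexts zero    = refl
  φ-nexts (suc n) = trans (φ-next∷ i (replicate n (suc i))) (cong pred (φ-nexts n))

  ε-nexts : ∀ n → ε i (replicate n (suc i)) ≡ n
  ε-nexts zero    = refl
  ε-nexts (suc n) = trans (ε-next∷ i (replicate n (suc i))) (cong₂ (λ a b → isZero a + b) (φ-nexts n) (ε-nexts n))

  φ-++-0 : ∀ u {v} → φ i v ≡ 0 → φ i (u ++ v) ≡ φ i u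
  φ-++-0 u {v} φv rewrite φ-++ i u v | φv | 0∸n≡0 (ε i u) = +-identityʳ _

  nexts⇒selfs : ∀ n → EN i n (replicate n (suc i)) (replicate n i)
  nexts⇒selfs zero    = done
  nexts⇒selfs (suc n) = mkE [] (replicate n (suc i)) refl (φ-nexts n)
                        ◅ EN-right (i ∷ []) (ε-self∷ i []) (nexts⇒selfs n)

  private
    φ-bracket : ∀ {w} c d → Neutral i w → φ i (replicate c (suc i) ++ w ++ replicate d i) ≡ d ∸ c
    φ-bracket {w} c d n rewrite φ-++ i (replicate c (suc i)) (w ++ replicate d i) | φ-nexts c | ε-nexts c
      | φ-neutral-++ (replicate d i) n | φ-selfs d = refl

    ε-bracket : ∀ {w} c d → Neutral i w → ε i (replicate c (suc i) ++ w ++ replicate d i) ≡ c ∸ d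
    ε-bracket {w} c d n rewrite ε-++ i (replicate c (suc i)) (w ++ replicate d i) | ε-nexts c
      | φ-neutral-++ (replicate d i) n | φ-selfs d | ε-neutral-++ (replicate d i) n | ε-selfs d = refl

  module Rows {pre post : ℕ → Word} (pre-n : ∀ j → Neutral i (pre j)) (post-n : ∀ j → Neutral i (post j)) where

    row : (ℕ → ℕ) → (ℕ → ℕ) → ℕ → Word
    row a b j = pre j ++ replicate (a j) i ++ replicate (b j) (suc i) ++ post j

    W : (ℕ → ℕ) → (ℕ → ℕ) → ℕ → Word
    W a b = rowsWord (row a b)

    private
      ++-assoc₃ : ∀ (u v w z : Word) → (u ++ v ++ w) ++ z ≡ u ++ v ++ w ++ z
      ++-assoc₃ u v w z = trans (++-assoc u (v ++ w) z) (cong (u ++_) (++-assoc v w z))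

    -- If the letters i+1 of each row are matched by the letters i of the row above,
    -- f_i^max turns the remaining a j ∸ b (suc j) letters i of row j into i+1.
    module _ {a b a′ b′ : ℕ → ℕ} (fit : ∀ j → b (suc j) ≤ a j)
             (a′-def : ∀ j → a′ j ≡ b (suc j)) (b′-def : ∀ j → b′ j ≡ (a j ∸ b (suc j)) + b j) where
      private
        -- The word is cut inside the rows, between their letters i and i + 1. A block then contains
        -- the letters i + 1 of one row together with the letters i of the row above that match
        -- them; `w` is the neutral end of the lower row.
        string : ∀ t {w} → Neutral i w →
          EN i (Σ< (λ j → a j ∸ b (suc j)) t) (replicate (b t) (suc i) ++ w ++ W a′ b′ t)
                                              (replicate (b t) (suc i) ++ w ++ W a b t) ×
          φ i (replicate (b t) (suc i) ++ w ++ W a′ b′ t) ≡ 0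
        string zero {w} n =
          done , trans (φ-++-0 (replicate (b 0) (suc i)) (trans (cong (φ i) (++-identityʳ w)) (neutral-φ n))) (φ-nexts (b 0))
        string (suc t) {w} n with ih , φv′ ← string t (post-n t) =
          -- The two factors do not interact: `v′` has no unmatched i and `u` no unmatched i + 1, so
          -- their strings are run one after the other.
          subst₂ (EN i _) eq′ eq (EN-left v′ φv′ u′⇒u ◅◅ EN-right u εu ih) ,
          trans (cong (φ i) (sym eq′)) (trans (φ-++-0 u′ φv′) (trans (φ-++-0 (X c) (φ-nexts (A ∸ c))) (trans (φ-bracket c c nw) (n∸n≡0 c))))
          where
          c = b (suc t)
          A = a t
          nw : Neutral i (w ++ pre t)
          nw = All.++⁺ n (pre-n t)
          X : ℕ → Word
          X d = replicate c (suc i) ++ (w ++ pre t) ++ replicate d i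
          u u′ v v′ : Word
          u  = X A
          u′ = X c ++ replicate (A ∸ c) (suc i)
          v  = replicate (b t) (suc i) ++ post t ++ W a b t
          v′ = replicate (b t) (suc i) ++ post t ++ W a′ b′ t
          εu : ε i u ≡ 0
          εu = trans (ε-bracket c A nw) (m≤n⇒m∸n≡0 (fit t))
          u′⇒u : EN i (A ∸ c) u′ u
          u′⇒u = subst (EN i (A ∸ c) u′)
            (trans (++-assoc₃ (replicate c (suc i)) (w ++ pre t) (replicate c i) _)
              (cong (λ z → replicate c (suc i) ++ (w ++ pre t) ++ z)
                (trans (sym (replicate-+ c (A ∸ c) i)) (cong (λ z → replicate z i) (m+[n∸m]≡n (fit t))))))
            (EN-right (X c) (trans (ε-bracket c c nw) (n∸n≡0 c)) (nexts⇒selfs (A ∸ c)))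
          open ≡-Reasoning
          regroup : ∀ d z → X d ++ z ≡ replicate c (suc i) ++ w ++ (pre t ++ replicate d i ++ z)
          regroup d z = trans (++-assoc₃ (replicate c (suc i)) (w ++ pre t) (replicate d i) z)
            (cong (replicate c (suc i) ++_) (++-assoc w (pre t) _))
          eq : u ++ v ≡ replicate c (suc i) ++ w ++ W a b (suc t)
          eq = trans (regroup A v) (cong (λ z → replicate c (suc i) ++ w ++ z)
                 (sym (trans (++-assoc (pre t) _ _) (cong (pre t ++_) (++-assoc₃ (replicate A i) (replicate (b t) (suc i)) (post t) _)))))
          eq′ : u′ ++ v′ ≡ replicate c (suc i) ++ w ++ W a′ b′ (suc t)
          eq′ = begin
            (X c ++ replicate (A ∸ c) (suc i)) ++ v′ ≡⟨ ++-assoc (X c) _ _ ⟩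
            X c ++ replicate (A ∸ c) (suc i) ++ v′ ≡⟨ regroup c _ ⟩
            replicate c (suc i) ++ w ++ (pre t ++ replicate c i ++ replicate (A ∸ c) (suc i) ++ v′)
              ≡⟨ cong (λ z → replicate c (suc i) ++ w ++ (pre t ++ replicate c i ++ z)) (trans (sym (++-assoc (replicate (A ∸ c) (suc i)) _ _)) (cong (_++ post t ++ W a′ b′ t) (sym (replicate-+ (A ∸ c) (b t) (suc i))))) ⟩
            replicate c (suc i) ++ w ++ (pre t ++ replicate c i ++ replicate (A ∸ c + b t) (suc i) ++ post t ++ W a′ b′ t)
              ≡⟨ cong₂ (λ y z → replicate c (suc i) ++ w ++ (pre t ++ replicate y i ++ replicate z (suc i) ++ post t ++ W a′ b′ t)) (sym (a′-def t)) (sym (b′-def t)) ⟩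
            replicate c (suc i) ++ w ++ (pre t ++ replicate (a′ t) i ++ replicate (b′ t) (suc i) ++ post t ++ W a′ b′ t)
              ≡⟨ cong (λ z → replicate c (suc i) ++ w ++ z) (sym (trans (++-assoc (pre t) _ _) (cong (pre t ++_) (++-assoc₃ (replicate (a′ t) i) (replicate (b′ t) (suc i)) (post t) _)))) ⟩
            replicate c (suc i) ++ w ++ W a′ b′ (suc t) ∎

      f-string : ∀ t → b t ≡ 0 → EN i (Σ< (λ j → a j ∸ b (suc j)) t) (W a′ b′ t) (W a b t) × φ i (W a′ b′ t) ≡ 0
      f-string t bt with s ← string t [] rewrite bt = s

    -- If only row s contains letters i, and sufficiently many of them to match the letters
    -- i+1 below it, then e_i^max turns the letters i+1 in the rows up to s into i.
    module _ {a b a′ b′ : ℕ → ℕ} {s : ℕ}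
             (a-below : ∀ j → s < j → a j ≡ 0) (a-above : ∀ j → j < s → a j ≡ 0) (b-below : ∀ j → suc s < j → b j ≡ 0)
             (fit : b (suc s) ≤ a s)
             (a′-def : ∀ j → j ≤ s → a′ j ≡ a j + b j) (b′-def : ∀ j → j ≤ s → b′ j ≡ 0)
             (a′-same : ∀ j → s < j → a′ j ≡ a j) (b′-same : ∀ j → s < j → b′ j ≡ b j) where
      private
        row-step : ∀ {t w} → t ≤ s → φ i w ≡ 0 → ε i (pre t ++ replicate (a t) i) ≡ 0 →
          EN i (b t) (row a b t ++ w) (row a′ b′ t ++ w)
        row-step {t} {w} t≤s φw εp = subst₂ (EN i (b t)) eq eq′
          (EN-right p εp (EN-left (post t ++ w) (trans (φ-neutral-++ w (post-n t)) φw) (nexts⇒selfs (b t))))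
          where
          p = pre t ++ replicate (a t) i
          eq : p ++ (replicate (b t) (suc i) ++ post t ++ w) ≡ row a b t ++ w
          eq = trans (++-assoc (pre t) _ _) (sym (trans (++-assoc (pre t) _ w) (cong (pre t ++_) (++-assoc₃ (replicate (a t) i) _ (post t) w))))
          eq′ : p ++ (replicate (b t) i ++ post t ++ w) ≡ row a′ b′ t ++ w
          eq′ rewrite a′-def t t≤s | b′-def t t≤s | replicate-+ (a t) (b t) i =
            trans (++-assoc (pre t) _ _) (sym (trans (++-assoc (pre t) _ w) (cong (pre t ++_)
              (trans (++-assoc (replicate (a t) i ++ replicate (b t) i) (post t) w) (++-assoc (replicate (a t) i) _ _)))))

        ε-head : ∀ t → ε i (pre t ++ replicate (a t) i) ≡ 0
        ε-head t = trans (ε-neutral-++ (replicate (a t) i) (pre-n t)) (ε-selfs (a t))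

        ε-row′ : ∀ t → t ≤ s → ε i (row a′ b′ t) ≡ 0
        ε-row′ t t≤s rewrite b′-def t t≤s = trans (ε-neutral-++ _ (pre-n t))
          (trans (ε-++ i (replicate (a′ t) i) (post t)) (cong₂ _+_ (neutral-ε (post-n t)) (trans (cong (_∸ φ i (post t)) (ε-selfs (a′ t))) (0∸n≡0 (φ i (post t))))))

        -- Above row s there are no letters i, so every i + 1 is unmatched and gets changed.
        upper : ∀ t → t ≤ s → (∃ λ n → EN i n (W a b t) (W a′ b′ t)) × φ i (W a b t) ≡ 0
        upper zero    _   = (0 , done) , refl
        upper (suc t) t<s with (n , ih) , φt ← upper t (<⇒≤ t<s) =
          (_ , (row-step (<⇒≤ t<s) φt (ε-head t) ◅◅ EN-right (row a′ b′ t) (ε-row′ t (<⇒≤ t<s)) ih)) ,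
          trans (φ-++-0 (row a b t) φt) φ-row
          where
          φ-row : φ i (row a b t) ≡ 0
          φ-row rewrite a-above t t<s = trans (φ-neutral-++ _ (pre-n t))
            (trans (φ-++-0 (replicate (b t) (suc i)) (neutral-φ (post-n t))) (φ-nexts (b t)))

        lower : ℕ → Word
        lower zero    = []
        lower (suc d) = row a b (suc s + d) ++ lower d

        lower-W : ∀ d → W a b (suc s + d) ≡ lower d ++ W a b (suc s)
        lower-W zero    rewrite +-identityʳ s = refl
        lower-W (suc d) rewrite +-suc s d = trans (cong (row a b (suc s + d) ++_) (lower-W d)) (sym (++-assoc (row a b (suc s + d)) _ _))

        lower-W′ : ∀ d → W a′ b′ (suc s + d) ≡ lower d ++ W a′ b′ (suc s)
        lower-W′ zero    rewrite +-identityʳ s = refl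
        lower-W′ (suc d) rewrite +-suc s d | a′-same (suc s + d) (s≤s (m≤m+n s d)) | b′-same (suc s + d) (s≤s (m≤m+n s d)) =
          trans (cong (row a b (suc s + d) ++_) (lower-W′ d)) (sym (++-assoc (row a b (suc s + d)) _ _))

        ε-lower : ∀ d → ε i (lower d) ≤ b (suc s)
        ε-lower zero    = z≤n
        ε-lower (suc d) rewrite a-below (suc s + d) (s≤s (m≤m+n s d)) = ≤-trans (≤-reflexive (ε-++ i (pre (suc s + d) ++ nexts ++ post (suc s + d)) (lower d))) (bound d refl)
          where
          nexts = replicate (b (suc s + d)) (suc i)
          ε-row : ε i (pre (suc s + d) ++ nexts ++ post (suc s + d)) ≡ b (suc s + d)
          ε-row = trans (ε-neutral-++ _ (pre-n (suc s + d))) (trans (ε-++ i nexts (post (suc s + d)))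
            (cong₂ _+_ (neutral-ε (post-n (suc s + d))) (cong₂ _∸_ (ε-nexts (b (suc s + d))) (neutral-φ (post-n (suc s + d))))))
          bound : ∀ d′ → d ≡ d′ → ε i (lower d) + (ε i (pre (suc s + d) ++ nexts ++ post (suc s + d)) ∸ φ i (lower d)) ≤ b (suc s)
          bound zero     refl = ≤-trans (m∸n≤m _ 0) (≤-reflexive (trans ε-row (cong b (+-identityʳ (suc s)))))
          bound (suc d′) refl = ≤-trans (≤-reflexive (trans (cong (ε i (lower (suc d′)) +_)
            (trans (cong (_∸ φ i (lower (suc d′))) (trans ε-row (b-below _ (s≤s (subst (suc s ≤_) (sym (+-suc s d′)) (s≤s (m≤m+n s d′))))))) (0∸n≡0 (φ i (lower (suc d′)))))) (+-identityʳ _))) (ε-lower (suc d′))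

      e-string : ∀ d → ∃ λ n → EN i n (W a b (suc s + d)) (W a′ b′ (suc s + d))
      e-string d with (n , ih) , φs ← upper s ≤-refl =
        _ , subst₂ (EN i _) eq eq′ (EN-right p εp (EN-left (post s ++ W a b s) φz (nexts⇒selfs (b s)) ◅◅
          EN-right (replicate (b s) i) (ε-selfs (b s)) (EN-right (post s) (neutral-ε (post-n s)) ih)))
        where
        p : Word
        p = lower d ++ pre s ++ replicate (a s) i
        φz : φ i (post s ++ W a b s) ≡ 0
        φz = trans (φ-neutral-++ (W a b s) (post-n s)) φs
        εp : ε i p ≡ 0
        εp rewrite ε-++ i (lower d) (pre s ++ replicate (a s) i) | ε-head s
                 | φ-neutral-++ (replicate (a s) i) (pre-n s) | φ-selfs (a s) = m≤n⇒m∸n≡0 (≤-trans (ε-lower d) fit)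
        eq : p ++ (replicate (b s) (suc i) ++ post s ++ W a b s) ≡ W a b (suc s + d)
        eq = trans (++-assoc₃ (lower d) (pre s) (replicate (a s) i) _)
          (sym (trans (lower-W d) (cong (lower d ++_) (trans (++-assoc (pre s) _ _) (cong (pre s ++_) (++-assoc₃ (replicate (a s) i) _ (post s) _))))))
        eq′ : p ++ (replicate (b s) i ++ post s ++ W a′ b′ s) ≡ W a′ b′ (suc s + d)
        eq′ = sym (trans (lower-W′ d) (trans (cong (λ z → lower d ++ z) row′) (sym (++-assoc₃ (lower d) (pre s) (replicate (a s) i) _))))
          where
          row′ : W a′ b′ (suc s) ≡ pre s ++ replicate (a s) i ++ replicate (b s) i ++ post s ++ W a′ b′ s
          row′ rewrite a′-def s ≤-refl | b′-def s ≤-refl | replicate-+ (a s) (b s) i =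
            trans (++-assoc (pre s) _ _) (cong (pre s ++_) (trans (++-assoc (replicate (a s) i ++ replicate (b s) i) (post s) _) (++-assoc (replicate (a s) i) _ _)))

-- Gelfand-Tsetlin patterns and changes of a single level.

-- A Gelfand–Tsetlin pattern is a function g: g v 0, g v 1, … is the shape of the subtableau of
-- entries ≤ v.  segment g m d j lists the entries m + 1, …, m + d of row j.
segment : (ℕ → ℕ → ℕ) → ℕ → ℕ → ℕ → Word
segment g m zero    j = []
segment g m (suc d) j = replicate (g (suc m) j ∸ g m j) (suc m) ++ segment g (suc m) d j

tableauWord : (ℕ → ℕ → ℕ) → ℕ → Word
tableauWord g r = rowsWord (segment g 0 r) r

segment-split : ∀ g m d e j → segment g m (d + e) j ≡ segment g m d j ++ segment g (m + d) e j
segment-split g m zero    e j rewrite +-identityʳ m = refl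
segment-split g m (suc d) e j rewrite +-suc m d =
  trans (cong (replicate (g (suc m) j ∸ g m j) (suc m) ++_) (segment-split g (suc m) d e j)) (sym (++-assoc (replicate (g (suc m) j ∸ g m j) (suc m)) _ _))

segment-cong : ∀ {g g′ : ℕ → ℕ → ℕ} m d j → (∀ v → m ≤ v → v ≤ m + d → g v j ≡ g′ v j) → segment g m d j ≡ segment g′ m d j
segment-cong m zero    j h = refl
segment-cong m (suc d) j h = cong₂ _++_
  (cong₂ (λ a b → replicate (a ∸ b) (suc m)) (h (suc m) (n≤1+n m) (subst (suc m ≤_) (sym (+-suc m d)) (s≤s (m≤m+n m d)))) (h m ≤-refl (m≤m+n m _)))
  (segment-cong (suc m) d j (λ v p q → h v (<⇒≤ p) (subst (v ≤_) (sym (+-suc m d)) q)))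

tableauWord-cong : ∀ {g g′ : ℕ → ℕ → ℕ} r → (∀ v j → v ≤ r → g v j ≡ g′ v j) → tableauWord g r ≡ tableauWord g′ r
tableauWord-cong r h = rowsWord-cong (λ j → segment-cong 0 r j (λ v _ q → h v j q)) r

segment-bounds : ∀ g m d j → All (λ x → m < x × x ≤ m + d) (segment g m d j)
segment-bounds g m zero    j = []
segment-bounds g m (suc d) j = All.++⁺
  (All.replicate⁺ (g (suc m) j ∸ g m j) (≤-refl , subst (suc m ≤_) (sym (+-suc m d)) (s≤s (m≤m+n m d))))
  (All.map (λ {x} (p , q) → <⇒≤ p , subst (x ≤_) (sym (+-suc m d)) q) (segment-bounds g (suc m) d j))

tableauWord-bounded : ∀ g r t → All (_≤ r) (rowsWord (segment g 0 r) t)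
tableauWord-bounded g r zero    = []
tableauWord-bounded g r (suc t) = All.++⁺ (All.map proj₂ (segment-bounds g 0 r t)) (tableauWord-bounded g r t)

Σ<-cong : ∀ {f g : ℕ → ℕ} → (∀ j → f j ≡ g j) → ∀ t → Σ< f t ≡ Σ< g t
Σ<-cong h zero    = refl
Σ<-cong h (suc t) = cong₂ _+_ (h t) (Σ<-cong h t)

private
  ∸-cancel : ∀ x {y z} → y ≤ z → (x ∸ y) ∸ (z ∸ y) ≡ x ∸ z
  ∸-cancel x {y} {z} y≤z = trans (∸-+-assoc x y (z ∸ y)) (cong (x ∸_) (m+[n∸m]≡n y≤z))

  ∸-triangle : ∀ {x y z} → z ≤ y → y ≤ x → (x ∸ y) + (y ∸ z) ≡ x ∸ z
  ∸-triangle {x} {y} {z} z≤y y≤x = trans (sym (+-∸-assoc (x ∸ y) z≤y)) (cong (_∸ z) (m∸n+n≡m y≤x))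

-- One level s + 1 of a pattern is modified; only the letters s+1, s+2 of the tableau are concerned.
module Level (s b : ℕ) (g g′ : ℕ → ℕ → ℕ) (same : ∀ v j → v ≢ suc s → g′ v j ≡ g v j)
             (grow : ∀ j → g (suc s) j ≤ g (2+ s) j) (strip : ∀ j → g (2+ s) (suc j) ≤ g (suc s) j) where
  private
    r = s + 2+ b

    pre-neutral : ∀ j → Neutral (suc s) (segment g 0 s j)
    pre-neutral j = All.map (λ (_ , q) → kind-other (<⇒≢ (s≤s q)) (<⇒≢ (m≤n⇒m≤1+n (s≤s q)))) (segment-bounds g 0 s j)

    post-neutral : ∀ j → Neutral (suc s) (segment g (2+ s) b j)
    post-neutral j = All.map (λ (p , _) → kind-other (λ eq → <⇒≢ (<⇒≤ p) (sym eq)) (λ eq → <⇒≢ p (sym eq))) (segment-bounds g (2+ s) b j)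

    module R = Rows {suc s} {segment g 0 s} {segment g (2+ s) b} pre-neutral post-neutral

    a b₁ a′ b₁′ : ℕ → ℕ
    a   j = g (suc s) j ∸ g s j
    b₁  j = g (2+ s) j ∸ g (suc s) j
    a′  j = g′ (suc s) j ∸ g′ s j
    b₁′ j = g′ (2+ s) j ∸ g′ (suc s) j

    W-g : ∀ t → R.W a b₁ t ≡ rowsWord (segment g 0 r) t
    W-g = rowsWord-cong (λ j → sym (segment-split g 0 s (2+ b) j))

    W-g′ : ∀ t → R.W a′ b₁′ t ≡ rowsWord (segment g′ 0 r) t
    W-g′ = rowsWord-cong (λ j → sym (trans (segment-split g′ 0 s (2+ b) j) (cong₂ _++_
      (segment-cong 0 s j (λ v _ q → same v j (<⇒≢ (s≤s q))))
      (cong (λ z → replicate (g′ (suc s) j ∸ g′ s j) (suc s) ++ replicate (g′ (2+ s) j ∸ g′ (suc s) j) (2+ s) ++ z)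
        (segment-cong (2+ s) b j (λ v p _ → same v j (λ eq → <⇒≢ p (sym eq))))))))

    same-s : ∀ j → g′ s j ≡ g s j
    same-s j = same s j (<⇒≢ ≤-refl)

    same-2+s : ∀ j → g′ (2+ s) j ≡ g (2+ s) j
    same-2+s j = same (2+ s) j 1+n≢n

  -- Since level s is the shift of level s + 1, interlacing with level s + 2 says precisely that the
  -- letters s + 1 of row j suffice to match the letters s + 2 of row j + 1. The surplus, g (s+1) j
  -- - g (s+2) (j+1), is the contribution of row j to the string.
  f-step : (∀ j → g s j ≡ g (suc s) (suc j)) → (∀ j → g′ (suc s) j ≡ g (2+ s) (suc j)) → g (2+ s) r ≡ 0 →
    EN (suc s) (Σ< (λ j → g (suc s) j ∸ g (2+ s) (suc j)) r) (tableauWord g′ r) (tableauWord g r) × φ (suc s) (tableauWord g′ r) ≡ 0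
  f-step low new top rewrite sym (W-g r) | sym (W-g′ r) =
    subst (λ n → EN (suc s) n (R.W a′ b₁′ r) (R.W a b₁ r)) (Σ<-cong count r) (proj₁ string) , proj₂ string
    where
    count : ∀ j → (g (suc s) j ∸ g s j) ∸ (g (2+ s) (suc j) ∸ g (suc s) (suc j)) ≡ g (suc s) j ∸ g (2+ s) (suc j)
    count j rewrite low j = ∸-cancel (g (suc s) j) (grow (suc j))
    string = R.f-string {a} {b₁} {a′} {b₁′}
      (λ j → subst (λ z → g (2+ s) (suc j) ∸ g (suc s) (suc j) ≤ g (suc s) j ∸ z) (sym (low j)) (∸-monoˡ-≤ (g (suc s) (suc j)) (strip j)))
      (λ j → cong₂ _∸_ (new j) (trans (same-s j) (low j)))
      (λ j → trans (cong₂ _∸_ (same-2+s j) (new j)) (trans (sym (∸-triangle (strip j) (grow j))) (trans (+-comm (g (2+ s) j ∸ g (suc s) j) _) (cong (_+ (g (2+ s) j ∸ g (suc s) j)) (sym (count j))))))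
      r (trans (cong (_∸ g (suc s) r) top) (0∸n≡0 (g (suc s) r)))

  -- Levels s and s + 1 are truncations of one shape, so the letter s + 1 occurs in row s only.
  e-step : (∀ j → j < s → g s j ≡ g (suc s) j) → (∀ j → s ≤ j → g s j ≡ 0) → (∀ j → s < j → g (suc s) j ≡ 0) →
    (∀ j → suc s < j → g (2+ s) j ≡ 0) → (∀ j → j ≤ s → g′ (suc s) j ≡ g (2+ s) j) → (∀ j → s < j → g′ (suc s) j ≡ 0) →
    ∃ λ n → EN (suc s) n (tableauWord g r) (tableauWord g′ r)
  e-step high₁ high₀ mid₀ top₀ new new₀ rewrite sym (W-g r) | sym (W-g′ r) | +-suc s (suc b) = R.e-string {a} {b₁} {a′} {b₁′} {s}
    (λ j p → trans (cong (_∸ g s j) (mid₀ j p)) (0∸n≡0 (g s j)))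
    (λ j p → trans (cong (g (suc s) j ∸_) (high₁ j p)) (n∸n≡0 (g (suc s) j)))
    (λ j p → trans (cong (_∸ g (suc s) j) (top₀ j p)) (0∸n≡0 (g (suc s) j)))
    (subst₂ _≤_ (cong (g (2+ s) (suc s) ∸_) (sym (mid₀ (suc s) ≤-refl))) (cong (g (suc s) s ∸_) (sym (high₀ s ≤-refl))) (strip s))
    (λ j p → trans (cong₂ _∸_ (new j p) (same-s j)) (trans (sym (∸-triangle (s≤mid j) (grow j))) (+-comm (g (2+ s) j ∸ g (suc s) j) _)))
    (λ j p → trans (cong₂ _∸_ (same-2+s j) (new j p)) (n∸n≡0 (g (2+ s) j)))
    (λ j p → cong₂ _∸_ (trans (new₀ j p) (sym (mid₀ j p))) (same-s j))
    (λ j p → cong₂ _∸_ (same-2+s j) (trans (new₀ j p) (sym (mid₀ j p))))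
    (suc b)
    where
    s≤mid : ∀ j → g s j ≤ g (suc s) j
    s≤mid j with j <? s
    ... | yes j<s = ≤-reflexive (high₁ j j<s)
    ... | no j≮s  = subst (_≤ g (suc s) j) (sym (high₀ j (≮⇒≥ j≮s))) z≤n

record IsGT (r : ℕ) (G : ℕ → ℕ → ℕ) : Set where
  field
    beyond : ∀ {v j} → v ≤ j → G v j ≡ 0
    grow   : ∀ {v} j → v < r → G v j ≤ G (suc v) j
    strip  : ∀ {v} j → v < r → G (suc v) (suc j) ≤ G v j

private
  abstract
    -- The pattern in the middle of block m: levels above m are untouched, levels k + 1 to m are
    -- processed, the others wait. Going from k + 1 to k moves the single level k + 1 from `old` to
    -- `new`.
    stage : (G new old : ℕ → ℕ → ℕ) → ℕ → ℕ → ℕ → ℕ → ℕ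
    stage G new old m k v j with m <? v | k <? v
    ... | yes _ | _     = G v j
    ... | no _  | yes _ = new v j
    ... | no _  | no _  = old v j

    stage-above : ∀ {G new old m} {k v} j → m < v → stage G new old m k v j ≡ G v j
    stage-above {m = m} {k} {v} j m<v with m <? v
    ... | yes _  = refl
    ... | no m≮v = contradiction m<v m≮v

    stage-new : ∀ {G new old m} {k v} j → v ≤ m → k < v → stage G new old m k v j ≡ new v j
    stage-new {m = m} {k} {v} j v≤m k<v with m <? v | k <? v
    ... | yes m<v | _      = contradiction m<v (≤⇒≯ v≤m)
    ... | no _    | yes _  = refl
    ... | no _    | no k≮v = contradiction k<v k≮v

    stage-old : ∀ {G new old m} {k v} j → v ≤ m → v ≤ k → stage G new old m k v j ≡ old v j
    stage-old {m = m} {k} {v} j v≤m v≤k with m <? v | k <? v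
    ... | yes m<v | _       = contradiction m<v (≤⇒≯ v≤m)
    ... | no _    | yes k<v = contradiction k<v (≤⇒≯ v≤k)
    ... | no _    | no _    = refl

    stage-same : ∀ {G new old m} {k} v j → v ≢ suc k → stage G new old m k v j ≡ stage G new old m (suc k) v j
    stage-same {m = m} {k} v j v≢ with m <? v | k <? v | suc k <? v
    ... | yes _ | _       | _        = refl
    ... | no _  | yes _   | yes _    = refl
    ... | no _  | no _    | no _     = refl
    ... | no _  | yes k<v | no k≮v   = contradiction (≤-antisym (≮⇒≥ k≮v) k<v) v≢
    ... | no _  | no k≮v  | yes k<v  = contradiction (<-trans (n<1+n k) k<v) k≮v

-- The β-blocks and their circles.

suffixSums : List ℕ → List ℕ
suffixSums []       = []
suffixSums (d ∷ ds) = (d + sum ds) ∷ suffixSums ds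

zeroPositions : ℕ → List ℕ → List ℕ
zeroPositions p []       = []
zeroPositions p (d ∷ ds) = zeroPositions (suc p) ds ++ (if d ≡ᵇ 0 then p ∷ [] else [])

-- Neighbouring suffix sums agree exactly where a difference vanishes. The last sum is itself a
-- difference, so the separate rule for p = m is the same condition.
circled-suffixSums : ∀ p ds → circled p (suffixSums ds) ≡ zeroPositions p ds
circled-suffixSums p []            = refl
circled-suffixSums p (d ∷ [])      rewrite +-identityʳ d = refl
circled-suffixSums p (d ∷ d′ ∷ ds) =
  cong₂ (λ a b → a ++ (if b then p ∷ [] else [])) (circled-suffixSums (suc p) (d′ ∷ ds)) (+-≡ᵇ d (d′ + sum ds))
  where
  +-≡ᵇ : ∀ m n → (m + n ≡ᵇ n) ≡ (m ≡ᵇ 0)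
  +-≡ᵇ zero    n = ≡ᵇ-refl n
  +-≡ᵇ (suc m) n = ≡ᵇ-false (λ eq → <⇒≢ (s≤s (m≤n+m n m)) (sym eq))

Σ<-front : ∀ f t → Σ< f (suc t) ≡ f 0 + Σ< (λ j → f (suc j)) t
Σ<-front f zero    = refl
Σ<-front f (suc t) = trans (cong (f (suc t) +_) (Σ<-front f t)) (trans (sym (+-assoc (f (suc t)) (f 0) _))
  (trans (cong (_+ Σ< (λ j → f (suc j)) t) (+-comm (f (suc t)) (f 0))) (+-assoc (f 0) (f (suc t)) _)))

Σ<-extend : ∀ f {n} k → (∀ j → n ≤ j → f j ≡ 0) → Σ< f (k + n) ≡ Σ< f n
Σ<-extend f zero    h = refl
Σ<-extend f (suc k) h = cong₂ _+_ (h _ (m≤n+m _ k)) (Σ<-extend f k h)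

-- Indices r - s, ..., r - 1; under `star` they stand for f_s, ..., f_1 in this order.
descending : ℕ → ℕ → List ℕ
descending r zero    = []
descending r (suc s) = (r ∸ suc s) ∷ descending r s

blockJ-descending : ∀ r m → m ≤ r → blockJ r m ≡ descending r m
blockJ-descending r m m≤r = trans (map-upTo ((r ∸ m) +_) m) (go m (λ q → (r ∸ m) + q) m≤r (λ q → refl))
  where
  go : ∀ n f → n ≤ r → (∀ q → f q ≡ (r ∸ n) + q) → applyUpTo f n ≡ descending r n
  go zero    f _   h = refl
  go (suc n) f n<r h = cong₂ _∷_ (trans (h 0) (+-identityʳ _))
    (go n (λ q → f (suc q)) (<⇒≤ n<r) (λ q → trans (h (suc q)) (trans (+-suc (r ∸ suc n) q) (cong (_+ q) (sym (+-∸-assoc 1 n<r))))))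

diff : (ℕ → ℕ → ℕ) → ℕ → ℕ → ℕ
diff G m q = G m q ∸ G (suc m) (suc q)

diffs : (ℕ → ℕ → ℕ) → ℕ → ℕ → ℕ → List ℕ
diffs G m c zero    = []
diffs G m c (suc n) = diff G m c ∷ diffs G m (suc c) n

circledWord : (ℕ → ℕ → ℕ) → ℕ → ℕ → List ℕ
circledWord G m zero    = []
circledWord G m (suc n) = zeroPositions 1 (diffs G m 0 m) ++ circledWord G (suc m) n

module Strings {r : ℕ} {G : ℕ → ℕ → ℕ} (gt : IsGT r G) where
  open IsGT gt

  private
    sum-diffs : ∀ m c n → sum (diffs G m c n) ≡ Σ< (λ j → diff G m (j + c)) n
    sum-diffs m c zero    = refl
    sum-diffs m c (suc n) = trans (cong (diff G m c +_) (trans (sum-diffs m (suc c) n) (Σ<-cong (λ j → cong (diff G m) (+-suc j c)) n)))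
      (sym (Σ<-front (λ j → diff G m (j + c)) n))

    sum-diffs-all : ∀ m c n → c + n ≡ m → m < r → Σ< (λ j → diff G m (j + c)) r ≡ sum (diffs G m c n)
    sum-diffs-all m c n eq m<r with k , refl ← m≤n⇒∃[o]m+o≡n (≤-trans (≤-trans (m≤n+m n c) (≤-reflexive eq)) (<⇒≤ m<r)) =
      trans (cong (Σ< (λ j → diff G m (j + c))) (+-comm n k)) (trans (Σ<-extend _ k zeros) (sym (sum-diffs m c n)))
      where
      zeros : ∀ j → n ≤ j → diff G m (j + c) ≡ 0
      zeros j n≤j = trans (cong (_∸ G (suc m) (suc (j + c))) (beyond (≤-trans (≤-reflexive (trans (sym eq) (+-comm c n))) (+-monoˡ-≤ c n≤j)))) (0∸n≡0 (G (suc m) (suc (j + c))))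

    ∸-of : ∀ {c n m} → c + n ≡ m → m ∸ n ≡ c
    ∸-of {c} {n} refl = m+n∸n≡m c n

    ∸-of-suc : ∀ {c n m} → c + suc n ≡ m → m ∸ n ≡ suc c
    ∸-of-suc {c} {n} refl rewrite +-suc c n = m+n∸n≡m (suc c) n

    bound-s : ∀ {c s m} → c + s ≡ m → s ≤ m
    bound-s {c} {s} refl = m≤n+m s c

    2+s≤ : ∀ {c s m} → c + suc s ≡ m → m < r → ∃ λ b → s + 2+ b ≡ r
    2+s≤ {c} {s} refl m<r with b , eq ← m≤n⇒∃[o]m+o≡n (≤-trans (s≤s (m≤n+m (suc s) c)) m<r) =
      b , trans (+-suc s (suc b)) (trans (cong suc (+-suc s b)) eq)

  -- `fOld m` is the lowest weight pattern whose shape is level m of G: its level v is made of the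
  -- last v parts. `fNew m` is the same for level m + 1, where the next block begins.
  fNew fOld : ℕ → ℕ → ℕ → ℕ
  fNew m v j = G (suc m) (j + suc (m ∸ v))
  fOld m v j = G m (j + (m ∸ v))

  -- The pattern obtained from G after the operators f_i^max, i = m, …, k+1, of the m-th block.
  fStage : ℕ → ℕ → ℕ → ℕ → ℕ
  fStage m = stage G (fNew m) (fOld m) m

  private
    -- The operator f_{s+1} of block m; c operators of the block precede it, and c is also the shift
    -- accumulated at level s + 1.
    module FStep {m c s : ℕ} (eq : c + suc s ≡ m) (m<r : m < r) where
      up : ∀ j → fStage m (suc s) (2+ s) j ≡ G (suc m) (j + c)
      -- The first operator of a block sees the untouched level m + 1, each later one the level
      -- rewritten just before.
      up j = go c eq
        where
        go : ∀ c → c + suc s ≡ m → fStage m (suc s) (2+ s) j ≡ G (suc m) (j + c)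
        go zero    refl = trans (stage-above j ≤-refl) (cong (G (2+ s)) (sym (+-identityʳ j)))
        go (suc c) refl = trans (stage-new j (s≤s (m≤n+m (suc s) c)) ≤-refl)
          (cong (λ z → G (2+ (c + suc s)) (j + suc z)) (m+n∸n≡m c (suc s)))

      mid : ∀ j → fStage m (suc s) (suc s) j ≡ G m (j + c)
      mid j = trans (stage-old j (bound-s eq) ≤-refl) (cong (λ z → G m (j + z)) (∸-of eq))

      low : ∀ j → fStage m (suc s) s j ≡ G m (j + suc c)
      low j = trans (stage-old j (<⇒≤ (bound-s eq)) (n≤1+n s)) (cong (λ z → G m (j + z)) (∸-of-suc eq))

      mid′ : ∀ j → fStage m s (suc s) j ≡ G (suc m) (j + suc c)
      mid′ j = trans (stage-new j (bound-s eq) ≤-refl) (cong (λ z → G (suc m) (j + suc z)) (∸-of eq))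

      string : EN (suc s) (sum (diffs G m c (suc s))) (tableauWord (fStage m s) r) (tableauWord (fStage m (suc s)) r) ×
               φ (suc s) (tableauWord (fStage m s) r) ≡ 0
      string with b , req ← 2+s≤ eq m<r =
        subst (λ n → EN (suc s) n (tableauWord (fStage m s) r) (tableauWord (fStage m (suc s)) r))
              (trans (Σ<-cong (λ j → cong₂ _∸_ (mid j) (up (suc j))) r) (sum-diffs-all m c (suc s) eq m<r)) (proj₁ res) ,
        proj₂ res
        where
        res = subst (λ r′ → EN (suc s) (Σ< (λ j → fStage m (suc s) (suc s) j ∸ fStage m (suc s) (2+ s) (suc j)) r′) (tableauWord (fStage m s) r′) (tableauWord (fStage m (suc s)) r′) ×
                           φ (suc s) (tableauWord (fStage m s) r′) ≡ 0) req
          (Level.f-step s b (fStage m (suc s)) (fStage m s) stage-same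
            (λ j → subst₂ _≤_ (sym (mid j)) (sym (up j)) (grow (j + c) m<r))
            (λ j → subst₂ _≤_ (sym (up (suc j))) (sym (mid j)) (strip (j + c) m<r))
            (λ j → trans (low j) (trans (cong (G m) (+-suc j c)) (sym (mid (suc j)))))
            (λ j → trans (mid′ j) (trans (cong (G (suc m)) (+-suc j c)) (sym (up (suc j)))))
            (trans (up _) (beyond (≤-trans m<r (≤-trans (≤-reflexive (sym req)) (m≤m+n _ c))))))

  -- The operator preceded by c others has a string as long as the sum of the differences from index
  -- c on; so the lengths form the list of suffix sums.
  run-block : ∀ {m} s c {T} → c + s ≡ m → m < r → readingWord T ≈ star r (tableauWord (fStage m s) r) →
    proj₁ (runJ (descending r s) T) ≡ suffixSums (diffs G m c s) ×
    readingWord (proj₂ (runJ (descending r s) T)) ≈ star r (tableauWord (fStage m 0) r)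
  run-block zero    c _  _   T≈ = refl , T≈
  run-block {m} (suc s) c {T} eq m<r T≈
    with str , φ0 ← FStep.string {m} {c} {s} eq m<r
    with eps , T≈′ ← εT-string {T = T} (≤-<-trans (bound-s eq) m<r) (tableauWord-bounded (fStage m s) r r) str φ0 T≈
    rewrite eps
    with ih , T≈″ ← run-block s (suc c) (trans (sym (+-suc c s)) eq) m<r T≈′ =
    cong (_ ∷_) ih , T≈″

  fStage-next : ∀ m v j → fStage m 0 v j ≡ fStage (suc m) (suc m) v j
  fStage-next m zero    j = trans (stage-old j z≤n z≤n) (trans (trans (beyond (m≤n+m m j)) (sym (beyond (m≤n+m (suc m) j)))) (sym (stage-old j z≤n z≤n)))
  fStage-next m (suc v) j with <-cmp m v
  ... | tri< m<v _ _ = trans (stage-above j (m≤n⇒m≤1+n m<v)) (sym (stage-above j (s≤s m<v)))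
  ... | tri≈ _ refl _ = trans (stage-above j ≤-refl) (sym (trans (stage-old j ≤-refl ≤-refl) (cong (G (suc m)) (trans (cong (j +_) (n∸n≡0 m)) (+-identityʳ j)))))
  ... | tri> _ _ v<m = trans (stage-new j v<m (s≤s z≤n)) (trans (cong (λ z → G (suc m) (j + z)) (sym (+-∸-assoc 1 v<m))) (sym (stage-old j (m≤n⇒m≤1+n v<m) (m≤n⇒m≤1+n v<m))))

  circled-betaBlocks : ∀ n m {T} → m + n ≡ r → readingWord T ≈ star r (tableauWord (fStage m m) r) →
    concatMap (circled 1) (betaBlocks r n m T) ≡ circledWord G m n
  circled-betaBlocks zero    m _  _  = refl
  circled-betaBlocks (suc n) m {T} eq T≈
    rewrite blockJ-descending r m (≤-trans (m≤m+n m (suc n)) (≤-reflexive eq))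
    with m<r ← subst (m <_) eq (subst (m <_) (sym (+-suc m n)) (s≤s (m≤m+n m n)))
    with bs , T≈′ ← run-block m 0 {T} refl m<r T≈ =
    cong₂ _++_ (trans (cong (circled 1) bs) (circled-suffixSums 1 (diffs G m 0 m)))
      (circled-betaBlocks n (suc m) (trans (sym (+-suc m n)) eq)
        (≈-trans T≈′ (≈-reflexive (cong (star r) (tableauWord-cong r (λ v j _ → fStage-next m v j))))))

  omegaWord-circled : ∀ T → 2 ≤ r → readingWord T ≈ star r (tableauWord G r) → omegaWord r T ≡ circledWord G 1 (r ∸ 1)
  omegaWord-circled T 2≤r T≈ = circled-betaBlocks (r ∸ 1) 1 (m+[n∸m]≡n (<⇒≤ 2≤r))
    (≈-trans T≈ (≈-reflexive (cong (star r) (tableauWord-cong r (λ v j _ → start v j)))))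
    where
    -- Level 1 has a single part, so the entries ≤ 1 already have lowest weight and the blocks can
    -- start at m = 1.
    start : ∀ v j → G v j ≡ fStage 1 1 v j
    start zero          j = trans (beyond z≤n) (sym (trans (stage-old j z≤n z≤n) (beyond (m≤n+m 1 j))))
    start (suc zero)    j = sym (trans (stage-old j ≤-refl ≤-refl) (cong (G 1) (+-identityʳ j)))
    start (suc (suc v)) j = sym (stage-above j (s≤s (s≤s z≤n)))

  -- The path to the highest weight tableau.

  abstract
    -- Level v of the highest weight pattern of shape f, the counterpart of the shifts in `fOld`.
    trunc : ℕ → (ℕ → ℕ) → ℕ → ℕ
    trunc v f j with j <? v
    ... | yes _ = f j
    ... | no _  = 0

    trunc-< : ∀ {v} f {j} → j < v → trunc v f j ≡ f j
    trunc-< {v} f {j} j<v with j <? v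
    ... | yes _  = refl
    ... | no j≮v = contradiction j<v j≮v

    trunc-≥ : ∀ {v} f {j} → v ≤ j → trunc v f j ≡ 0
    trunc-≥ {v} f {j} v≤j with j <? v
    ... | yes j<v = contradiction j<v (≤⇒≯ v≤j)
    ... | no _    = refl

    trunc-G : ∀ v j → trunc v (G v) j ≡ G v j
    trunc-G v j with j <? v
    ... | yes _  = refl
    ... | no j≮v = sym (beyond (≮⇒≥ j≮v))

  -- The pattern obtained from G after the operators e_i^max, i = m, …, k+1, that bring the
  -- subtableau of entries ≤ m+1 to its highest weight, that of entries ≤ m being already there.
  eStage : ℕ → ℕ → ℕ → ℕ → ℕ
  eStage m = stage G (λ v → trunc v (G (suc m))) (λ v → trunc v (G m)) m

  private
    module EStep {m c s : ℕ} (eq : c + suc s ≡ m) (m<r : m < r) where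
      up : ∀ j → eStage m (suc s) (2+ s) j ≡ trunc (2+ s) (G (suc m)) j
      up j = go c eq
        where
        go : ∀ c → c + suc s ≡ m → eStage m (suc s) (2+ s) j ≡ trunc (2+ s) (G (suc m)) j
        go zero    refl = trans (stage-above j ≤-refl) (sym (trunc-G (2+ s) j))
        go (suc c) refl = stage-new j (s≤s (m≤n+m (suc s) c)) ≤-refl

      mid : ∀ j → eStage m (suc s) (suc s) j ≡ trunc (suc s) (G m) j
      mid j = stage-old j (bound-s eq) ≤-refl

      low : ∀ j → eStage m (suc s) s j ≡ trunc s (G m) j
      low j = stage-old j (<⇒≤ (bound-s eq)) (n≤1+n s)

      mid′ : ∀ j → eStage m s (suc s) j ≡ trunc (suc s) (G (suc m)) j
      mid′ j = stage-new j (bound-s eq) ≤-refl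

      mid≤up : ∀ j → trunc (suc s) (G m) j ≤ trunc (2+ s) (G (suc m)) j
      mid≤up j with j <? suc s
      ... | no j≮   = subst (λ z → z ≤ trunc (2+ s) (G (suc m)) j) (sym (trunc-≥ (G m) (≮⇒≥ j≮))) z≤n
      ... | yes j≤s = subst₂ _≤_ (sym (trunc-< (G m) j≤s)) (sym (trunc-< (G (suc m)) (m≤n⇒m≤1+n j≤s))) (grow j m<r)

      up≤mid : ∀ j → trunc (2+ s) (G (suc m)) (suc j) ≤ trunc (suc s) (G m) j
      up≤mid j with j <? suc s
      ... | no j≮   = subst (λ z → z ≤ trunc (suc s) (G m) j) (sym (trunc-≥ (G (suc m)) (s≤s (≮⇒≥ j≮)))) z≤n
      ... | yes j≤s = subst₂ _≤_ (sym (trunc-< (G (suc m)) (s≤s j≤s))) (sym (trunc-< (G m) j≤s)) (strip j m<r)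

      string : ∃ λ n → EN (suc s) n (tableauWord (eStage m (suc s)) r) (tableauWord (eStage m s) r)
      string with b , req ← 2+s≤ eq m<r =
        subst (λ r → ∃ λ n → EN (suc s) n (tableauWord (eStage m (suc s)) r) (tableauWord (eStage m s) r)) req
          (Level.e-step s b (eStage m (suc s)) (eStage m s) stage-same
            (λ j → subst₂ _≤_ (sym (mid j)) (sym (up j)) (mid≤up j))
            (λ j → subst₂ _≤_ (sym (up (suc j))) (sym (mid j)) (up≤mid j))
            (λ j p → trans (low j) (trans (trunc-< (G m) p) (sym (trans (mid j) (trunc-< (G m) (m≤n⇒m≤1+n p))))))
            (λ j p → trans (low j) (trunc-≥ (G m) p))
            (λ j p → trans (mid j) (trunc-≥ (G m) p))
            (λ j p → trans (up j) (trunc-≥ (G (suc m)) p))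
            (λ j p → trans (mid′ j) (trans (trunc-< (G (suc m)) (s≤s p)) (sym (trans (up j) (trunc-< (G (suc m)) (m≤n⇒m≤1+n (s≤s p)))))))
            (λ j p → trans (mid′ j) (trunc-≥ (G (suc m)) p)))

  eStage-next : ∀ m v j → eStage m 0 v j ≡ eStage (suc m) (suc m) v j
  eStage-next m zero    j = trans (stage-old j z≤n z≤n) (trans (trans (trunc-≥ (G m) z≤n) (sym (trunc-≥ (G (suc m)) z≤n))) (sym (stage-old j z≤n z≤n)))
  eStage-next m (suc v) j with <-cmp m v
  ... | tri< m<v _ _ = trans (stage-above j (m≤n⇒m≤1+n m<v)) (sym (stage-above j (s≤s m<v)))
  ... | tri≈ _ refl _ = trans (stage-above j ≤-refl) (sym (trans (stage-old j ≤-refl ≤-refl) (trunc-G (suc m) j)))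
  ... | tri> _ _ v<m = trans (stage-new j v<m (s≤s z≤n)) (sym (stage-old j (m≤n⇒m≤1+n v<m) (m≤n⇒m≤1+n v<m)))

  Reachable : Tableau → Tableau → Set
  Reachable T H = Σ (List ℕ) λ is → All (λ i → 1 ≤ i × i < r) is × applyE is T ≡ just H

  -- The path is stored as a map on `Reachable`, so climbs compose as functions. The shape serves at
  -- the end, to recognise `highestT` from its word.
  Climb : Tableau → Word → Set
  Climb T w = Σ Tableau λ T′ → readingWord T′ ≡ w × shapeT T′ ≡ shapeT T × (∀ {H} → Reachable T′ H → Reachable T H)

  climb-EN : ∀ {i n T v} → 1 ≤ i → i < r → EN i n (readingWord T) v → Climb T v
  climb-EN {T = T} p q done = T , refl , refl , id
  climb-EN {i} {T = T} p q (e ◅ s) with T₁ , eq , refl , sh₁ ← E⇒eT {T = T} e with T₂ , rw , sh₂ , f ← climb-EN p q s =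
    T₂ , rw , trans sh₂ sh₁ , λ z → let is , ps , eqs = f z in i ∷ is , (p , q) ∷ ps , trans (cong (_>>= applyE is) eq) eqs

  climb-trans : ∀ {T w w′} → Climb T w → (∀ {T₁} → readingWord T₁ ≡ w → Climb T₁ w′) → Climb T w′
  climb-trans (T₁ , rw , sh , f) g with T₂ , rw′ , sh′ , f′ ← g rw = T₂ , rw′ , trans sh′ sh , λ z → f (f′ z)

  climb-block : ∀ {m} s c {T} → c + s ≡ m → m < r → readingWord T ≡ tableauWord (eStage m s) r → Climb T (tableauWord (eStage m 0) r)
  climb-block zero    c {T} _ _ rw = T , rw , refl , id
  climb-block {m} (suc s) c {T} eq m<r rw = climb-trans
    (climb-EN (s≤s z≤n) (≤-<-trans (bound-s eq) m<r)
      (subst (λ w → EN (suc s) (proj₁ string) w (tableauWord (eStage m s) r)) (sym rw) (proj₂ string)))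
    (climb-block s (suc c) (trans (sym (+-suc c s)) eq) m<r)
    where open EStep {m} {c} {s} eq m<r using (string)

  climb : ∀ n m {T} → m + n ≡ r → readingWord T ≡ tableauWord (eStage m m) r → Climb T (tableauWord (eStage r r) r)
  climb zero    m {T} eq rw with refl ← trans (sym (+-identityʳ m)) eq = T , rw , refl , id
  climb (suc n) m {T} eq rw = climb-trans (climb-block m 0 refl (subst (m <_) (trans (sym (+-suc m n)) eq) (s≤s (m≤m+n m n))) rw)
    (λ rw₁ → climb n (suc m) (trans (sym (+-suc m n)) eq) (trans rw₁ (tableauWord-cong r (λ v j _ → eStage-next m v j))))

  climb-to-highest : ∀ {T} → readingWord T ≡ tableauWord G r → Climb T (tableauWord (λ v → trunc v (G r)) r)
  climb-to-highest {T} rw =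
    let T′ , rw′ , rest = climb r 0 {T} refl (trans rw (tableauWord-cong r (λ v j _ → start v j)))
    in  T′ , trans rw′ (tableauWord-cong r (λ v j v≤r → stage-old j v≤r v≤r)) , rest
    where
    start : ∀ v j → G v j ≡ eStage 0 0 v j
    start zero    j = trans (beyond z≤n) (sym (trans (stage-old j z≤n z≤n) (trunc-≥ (G 0) z≤n)))
    start (suc v) j = sym (stage-above j (s≤s z≤n))

  tableauWord-trunc : tableauWord (λ v → trunc v (G r)) r ≡ highWord (G r) r
  tableauWord-trunc = rows r ≤-refl
    where
    H = λ v → trunc v (G r)
    H-const : ∀ {j m} → j ≢ m → H (suc m) j ∸ H m j ≡ 0
    H-const {j} {m} j≢m with <-cmp j m
    ... | tri< j<m _ _ rewrite trunc-< (G r) j<m | trunc-< (G r) (m≤n⇒m≤1+n j<m) = n∸n≡0 (G r j)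
    ... | tri≈ _ eq _ = contradiction eq j≢m
    ... | tri> _ _ m<j rewrite trunc-≥ (G r) m<j = 0∸n≡0 (H m j)
    empty : ∀ m d j → (∀ n → m ≤ n → n < m + d → j ≢ n) → segment H m d j ≡ []
    empty m zero    j h = refl
    empty m (suc d) j h rewrite H-const (h m ≤-refl (subst (m <_) (sym (+-suc m d)) (s≤s (m≤m+n m d)))) =
      empty (suc m) d j (λ n p q → h n (<⇒≤ p) (subst (n <_) (sym (+-suc m d)) q))
    row : ∀ {t} → t < r → segment H 0 r t ≡ replicate (G r t) (suc t)
    row {t} t<r with d , eq ← m≤n⇒∃[o]m+o≡n t<r = begin
      segment H 0 r t                                   ≡⟨ cong (λ z → segment H 0 z t) (trans (sym eq) (sym (+-suc t d))) ⟩
      segment H 0 (t + suc d) t                         ≡⟨ segment-split H 0 t (suc d) t ⟩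
      segment H 0 t t ++ replicate (H (suc t) t ∸ H t t) (suc t) ++ segment H (suc t) d t
        ≡⟨ cong₂ _++_ (empty 0 t t (λ n _ n<t eq → <⇒≢ n<t (sym eq)))
             (cong₂ (λ n w → replicate n (suc t) ++ w) (cong₂ _∸_ (trunc-< {suc t} (G r) ≤-refl) (trunc-≥ (G r) {t} ≤-refl)) (empty (suc t) d t (λ n p _ → <⇒≢ p))) ⟩
      replicate (G r t) (suc t) ++ []                   ≡⟨ ++-identityʳ _ ⟩
      replicate (G r t) (suc t)                         ∎
      where open ≡-Reasoning
    rows : ∀ t → t ≤ r → rowsWord (segment H 0 r) t ≡ highWord (G r) t
    rows zero    _   = refl
    rows (suc t) t<r = cong₂ _++_ (row t<r) (rows t (<⇒≤ t<r))

-- Colourings of a row and of a state.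

minusCol : Spin → ℕ → List ℕ
minusCol plus  c = []
minusCol minus c = c ∷ []

colourList : CSpin → List ℕ
colourList nothing  = []
colourList (just x) = x ∷ []

-- The last index is the leftmost column, so the list runs from left to right and decreases.
cols : ∀ n → (Fin n → Spin) → List ℕ
cols zero    f = []
cols (suc n) f = minusCol (f (fromℕ n)) n ++ cols n (λ c → f (inject₁ c))

colours : ∀ n → (Fin n → CSpin) → List ℕ
colours zero    f = []
colours (suc n) f = colourList (f (fromℕ n)) ++ colours n (λ c → f (inject₁ c))

cols-cong : ∀ n {f g : Fin n → Spin} → (∀ c → f c ≡ g c) → cols n f ≡ cols n g
cols-cong zero    h = refl
cols-cong (suc n) h = cong₂ (λ s l → minusCol s n ++ l) (h (fromℕ n)) (cols-cong n (λ c → h (inject₁ c)))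

cols-bounded : ∀ n f → All (_< n) (cols n f)
cols-bounded zero    f = []
cols-bounded (suc n) f with f (fromℕ n)
... | plus  = All.map m≤n⇒m≤1+n (cols-bounded n _)
... | minus = ≤-refl ∷ All.map m≤n⇒m≤1+n (cols-bounded n _)

cols-plus : ∀ n {f} → (∀ c → f c ≡ plus) → cols n f ≡ []
cols-plus zero    h = refl
cols-plus (suc n) h rewrite h (fromℕ n) = cols-plus n (λ c → h (inject₁ c))

colours-nothing : ∀ n {f} → (∀ c → f c ≡ nothing) → colours n f ≡ []
colours-nothing zero    h = refl
colours-nothing (suc n) h rewrite h (fromℕ n) = colours-nothing n (λ c → h (inject₁ c))

tabulate-snoc : ∀ {A : Set} n (f : Fin (suc n) → A) → tabulate f ≡ tabulate (λ c → f (inject₁ c)) ++ f (fromℕ n) ∷ []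
tabulate-snoc zero    f = refl
tabulate-snoc (suc n) f = cong (f fzero ∷_) (tabulate-snoc n (λ c → f (fsuc c)))

minusCols-cols : ∀ {N} (f : Fin (suc N) → Spin) → minusCols f ≡ cols (suc N) f
minusCols-cols {N} f = go (suc N) id (λ _ → refl)
  where
  g : Fin (suc N) → List ℕ
  g c = if isMinus (f c) then toℕ c ∷ [] else []
  go : ∀ n (k : Fin n → Fin (suc N)) → (∀ c → toℕ (k c) ≡ toℕ c) → concatMap g (reverse (tabulate k)) ≡ cols n (λ c → f (k c))
  go zero    k h = refl
  go (suc n) k h = trans
    (cong (concatMap g) (trans (cong reverse (tabulate-snoc n k)) (reverse-++ (tabulate (λ c → k (inject₁ c))) (k (fromℕ n) ∷ []))))
    (cong₂ _++_ last (go n (λ c → k (inject₁ c)) (λ c → trans (h (inject₁ c)) (toℕ-inject₁ c))))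
    where
    last : g (k (fromℕ n)) ≡ minusCol (f (k (fromℕ n))) n
    last with f (k (fromℕ n))
    ... | plus  = refl
    ... | minus = cong (_∷ []) (trans (h (fromℕ n)) (toℕ-fromℕ n))

-- Carry x A X B Y z : the part of a row to the right of an edge that carries the colour x.  On top
-- there are the colours X in the columns A, below the colours Y in the columns B, and z leaves on
-- the right.  The colour x either meets a colour d from above, or falls and the next colour d from
-- above is carried on.
data Carry : ℕ → List ℕ → List ℕ → List ℕ → List ℕ → ℕ → Set where
  done : ∀ {x} → Carry x [] [] [] [] x
  meet : ∀ {x c d A X B Y z} → All (_< c) B → Carry (x ⊔ d) A X B Y z → Carry x (c ∷ A) (d ∷ X) (c ∷ B) ((x ⊓ d) ∷ Y) z
  fall : ∀ {x a c d A X B Y z} → a < c → All (_< a) B → Carry d A X B Y z → Carry x (a ∷ A) (d ∷ X) (c ∷ B) (x ∷ Y) z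

-- The left boundary is +, so the first colour met on top turns right and is carried on; all that
-- leaves below lies to the right of its column.
data Row : List ℕ → List ℕ → List ℕ → List ℕ → ℕ → Set where
  row : ∀ {a x A X B Y z} → All (_< a) B → Carry x A X B Y z → Row (a ∷ A) (x ∷ X) B Y z

module _ where
  private
    -- Either a colour is being carried, or the next column with a colour on top starts a `Row`
    -- afresh. The bound on `A` becomes the condition a < c of `fall`.
    FromLeft : ℕ → CSpin → List ℕ → List ℕ → List ℕ → List ℕ → ℕ → Set
    FromLeft n (just x) A X B Y z = Carry x A X B Y z
    FromLeft n nothing  A X B Y z = All (_< n) A × Row A X B Y z

    widen : ∀ {n A} → All (_< n) A → All (_< suc n) A
    widen = All.map m≤n⇒m≤1+n

    fallRow : ∀ {n x A X B Y z} → All (_< n) A → Row A X B Y z → Carry x A X (n ∷ B) (x ∷ Y) z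
    fallRow (a<n ∷ _) (row B<a c) = fall a<n B<a c

    scan : ∀ n (h : Fin (suc n) → CSpin) (t b : Fin n → CSpin) z → h fzero ≡ just z →
      (∀ c → CVertex (h (fsuc c)) (t c) (h (inject₁ c)) (b c)) →
      FromLeft n (h (fromℕ n)) (cols n (λ c → forget (t c))) (colours n t) (cols n (λ c → forget (b c))) (colours n b) z
    scan zero    h t b z hz v rewrite hz = done
    scan (suc n) h t b z hz v
      with cols-bounded n (λ c → forget (b (inject₁ c)))
         | h (fsuc (fromℕ n)) | t (fromℕ n) | h (inject₁ (fromℕ n)) | b (fromℕ n) | v (fromℕ n)
         | scan n (λ j → h (inject₁ j)) (λ c → t (inject₁ c)) (λ c → b (inject₁ c)) z hz (λ c → v (inject₁ c))
    ... | bd | _ | _ | _ | _ | ca1     | A<n , r = widen A<n , r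
    ... | bd | _ | _ | _ | _ | ca2 x d | c       = meet bd c
    ... | bd | _ | _ | _ | _ | cb2 x   | c       = c
    ... | bd | _ | _ | _ | _ | cc1 x   | A<n , r = fallRow A<n r
    ... | bd | _ | _ | _ | _ | cc2 x   | c       = (≤-refl ∷ widen (cols-bounded n _)) , row bd c

  colouredRow : ∀ n (h : Fin (suc n) → CSpin) (t b : Fin n → CSpin) z → h fzero ≡ just z → h (fromℕ n) ≡ nothing →
    (∀ c → CVertex (h (fsuc c)) (t c) (h (inject₁ c)) (b c)) →
    Row (cols n (λ c → forget (t c))) (colours n t) (cols n (λ c → forget (b c))) (colours n b) z
  colouredRow n h t b z hz hl v with h (fromℕ n) | scan n h t b z hz v | hl
  ... | nothing | _ , r | refl = r

private
  snoc : ∀ {A : Set} {n} → (Fin n → A) → A → Fin (suc n) → A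
  snoc {n = zero}  f a _        = a
  snoc {n = suc n} f a fzero    = f fzero
  snoc {n = suc n} f a (fsuc j) = snoc (λ j → f (fsuc j)) a j

  snoc-last : ∀ {A : Set} n (f : Fin n → A) a → snoc f a (fromℕ n) ≡ a
  snoc-last zero    f a = refl
  snoc-last (suc n) f a = snoc-last n _ a

  snoc-inject₁ : ∀ {A : Set} n (f : Fin n → A) a j → snoc f a (inject₁ j) ≡ f j
  snoc-inject₁ (suc n) f a fzero    = refl
  snoc-inject₁ (suc n) f a (fsuc j) = snoc-inject₁ n _ a j

-- Colours enter at the left and the top and leave at the right and the bottom, so a state can be
-- coloured vertex by vertex.
colourVertex : ∀ {l t r b} x y → UVertex l t r b → forget x ≡ l → forget y ≡ t →
  ∃ λ x′ → ∃ λ y′ → CVertex x y x′ y′ × forget x′ ≡ r × forget y′ ≡ b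
colourVertex nothing  nothing  a1 _ _ = _ , _ , ca1 , refl , refl
colourVertex (just x) (just y) a2 _ _ = _ , _ , ca2 x y , refl , refl
colourVertex (just x) nothing  b2 _ _ = _ , _ , cb2 x , refl , refl
colourVertex (just x) nothing  c1 _ _ = _ , _ , cc1 x , refl , refl
colourVertex nothing  (just y) c2 _ _ = _ , _ , cc2 y , refl , refl

colourRow : ∀ n (H : Fin (suc n) → Spin) (B : Fin n → Spin) (t : Fin n → CSpin) x →
  (∀ c → UVertex (H (fsuc c)) (forget (t c)) (H (inject₁ c)) (B c)) → forget x ≡ H (fromℕ n) →
  ∃ λ (h : Fin (suc n) → CSpin) → ∃ λ (b : Fin n → CSpin) → h (fromℕ n) ≡ x ×
    (∀ c → CVertex (h (fsuc c)) (t c) (h (inject₁ c)) (b c)) ×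
    (∀ j → forget (h j) ≡ H j) × (∀ c → forget (b c) ≡ B c)
colourRow zero    H B t x v hx = (λ _ → x) , (λ ()) , refl , (λ ()) , (λ { fzero → hx }) , λ ()
colourRow (suc n) H B t x v hx
  with x′ , y′ , v′ , fx′ , fy′ ← colourVertex x (t (fromℕ n)) (v (fromℕ n)) hx refl
  with h , b , hl , vs , fh , fb ← colourRow n (λ j → H (inject₁ j)) (λ c → B (inject₁ c)) (λ c → t (inject₁ c)) x′ (λ c → v (inject₁ c)) fx′ =
  h₁ , b₁ , snoc-last (suc n) h x , vertices , forget-h , forget-b
  where
  h₁ = snoc h x
  b₁ = snoc b y′
  vertices : ∀ c → CVertex (h₁ (fsuc c)) (t c) (h₁ (inject₁ c)) (b₁ c)
  vertices c with view c
  ... | ‵fromℕ rewrite snoc-last (suc n) h x | snoc-inject₁ (suc n) h x (fromℕ n) | hl | snoc-last n b y′ = v′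
  ... | ‵inject₁ c rewrite snoc-inject₁ (suc n) h x (fsuc c) | snoc-inject₁ (suc n) h x (inject₁ c) | snoc-inject₁ n b y′ c = vs c
  forget-h : ∀ j → forget (h₁ j) ≡ H j
  forget-h j with view j
  ... | ‵fromℕ rewrite snoc-last (suc n) h x = hx
  ... | ‵inject₁ j rewrite snoc-inject₁ (suc n) h x j = fh j
  forget-b : ∀ c → forget (b₁ c) ≡ B c
  forget-b c with view c
  ... | ‵fromℕ rewrite snoc-last n b y′ = fy′
  ... | ‵inject₁ c rewrite snoc-inject₁ n b y′ c = fb c

colourState : ∀ r n (V : Fin (suc r) → Fin n → Spin) (H : Fin r → Fin (suc n) → Spin) (t : Fin n → CSpin) →
  (∀ c → forget (t c) ≡ V fzero c) → (∀ i → H i (fromℕ n) ≡ plus) →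
  (∀ i c → UVertex (H i (fsuc c)) (V (inject₁ i) c) (H i (inject₁ c)) (V (fsuc i) c)) →
  ∃ λ (cv : Fin (suc r) → Fin n → CSpin) → ∃ λ (ch : Fin r → Fin (suc n) → CSpin) →
    (∀ c → cv fzero c ≡ t c) × (∀ i → ch i (fromℕ n) ≡ nothing) ×
    (∀ i c → CVertex (ch i (fsuc c)) (cv (inject₁ i) c) (ch i (inject₁ c)) (cv (fsuc i) c)) ×
    (∀ k c → forget (cv k c) ≡ V k c) × (∀ i j → forget (ch i j) ≡ H i j)
colourState zero    n V H t ft Hl v =
  (λ _ → t) , (λ ()) , (λ _ → refl) , (λ ()) , (λ ()) , (λ { fzero → ft }) , λ ()
colourState (suc r) n V H t ft Hl v
  with h , b , hl , vs , fh , fb ← colourRow n (H fzero) (V (fsuc fzero)) t nothing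
         (λ c → subst (λ z → UVertex _ z _ _) (sym (ft c)) (v fzero c)) (sym (Hl fzero))
  with cv , ch , top , left , vs′ , fcv , fch ← colourState r n (λ k → V (fsuc k)) (λ i → H (fsuc i)) b fb (λ i → Hl (fsuc i)) (λ i → v (fsuc i)) =
  cv₁ , ch₁ , (λ _ → refl) , (λ { fzero → hl ; (fsuc i) → left i }) ,
  (λ { fzero c → subst (CVertex _ _ _) (sym (top c)) (vs c) ; (fsuc i) c → vs′ i c }) ,
  (λ { fzero → ft ; (fsuc k) → fcv k }) , (λ { fzero → fh ; (fsuc i) → fch i })
  where
  cv₁ : Fin (suc (suc r)) → Fin n → CSpin
  cv₁ fzero    = t
  cv₁ (fsuc k) = cv k
  ch₁ : Fin (suc r) → Fin (suc n) → CSpin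
  ch₁ fzero    = h
  ch₁ (fsuc i) = ch i

-- Inversions and left multiplication by simple reflections.

private
  swap : ℕ → ℕ → ℕ
  swap q = swapℕ q (suc q)

  swap-self : ∀ q → swap q q ≡ suc q
  swap-self q rewrite ≡ᵇ-refl q = refl

  swap-next : ∀ q → swap q (suc q) ≡ q
  swap-next q rewrite ≡ᵇ-false {suc q} {q} 1+n≢n | ≡ᵇ-refl q = refl

  swap-other : ∀ {q x} → x ≢ q → x ≢ suc q → swap q x ≡ x
  swap-other p p′ rewrite ≡ᵇ-false p | ≡ᵇ-false p′ = refl

  swap-involutive : ∀ q x → swap q (swap q x) ≡ x
  swap-involutive q x with x ≟ q | x ≟ suc q
  ... | yes refl | _        rewrite swap-self q = swap-next q
  ... | no _     | yes refl rewrite swap-next q = swap-self q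
  ... | no p     | no p′    rewrite swap-other p p′ = swap-other p p′

  <ᵇ-cong : ∀ {a b c d} → (a < b → c < d) → (c < d → a < b) → (a <ᵇ b) ≡ (c <ᵇ d)
  <ᵇ-cong {a} {b} {c} {d} f g with a <ᵇ b in e | c <ᵇ d in e′
  ... | true  | true  = refl
  ... | false | false = refl
  ... | true  | false = ⊥-elim (subst T e′ (<⇒<ᵇ (f (<ᵇ⇒< a b (subst T (sym e) _)))))
  ... | false | true  = ⊥-elim (subst T e (<⇒<ᵇ (g (<ᵇ⇒< c d (subst T (sym e′) _)))))

  swap-mono : ∀ {q} x y → x ≢ q → y ≢ q → y < x → swap q y < swap q x
  swap-mono {q} x y x≢q y≢q y<x with x ≟ suc q | y ≟ suc q
  ... | yes refl | yes refl = contradiction y<x (<-irrefl refl)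
  ... | yes refl | no y≢    rewrite swap-next q | swap-other y≢q y≢ = ≤∧≢⇒< (≤-pred y<x) y≢q
  ... | no x≢    | yes refl rewrite swap-next q | swap-other x≢q x≢ = <-trans (n<1+n q) y<x
  ... | no x≢    | no y≢    rewrite swap-other x≢q x≢ | swap-other y≢q y≢ = y<x

  swap-mono⁻ : ∀ {q} x y → x ≢ q → y ≢ q → swap q y < swap q x → y < x
  swap-mono⁻ {q} x y x≢q y≢q lt with <-cmp y x
  ... | tri< y<x _ _ = y<x
  ... | tri≈ _ refl _ = contradiction lt (<-irrefl refl)
  ... | tri> _ _ x<y = contradiction lt (<-asym (swap-mono y x y≢q x≢q x<y))

  swap-mono-head : ∀ {q} x y → x ≢ q → x ≢ suc q → y < x → swap q y < x
  swap-mono-head {q} x y x≢q x≢ y<x with y ≟ q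
  ... | yes refl rewrite swap-self q = ≤∧≢⇒< y<x (λ eq → x≢ (sym eq))
  ... | no y≢q   = subst (swap q y <_) (swap-other x≢q x≢) (swap-mono x y x≢q y≢q y<x)

  swap-mono-head⁻ : ∀ {q} x y → x ≢ q → x ≢ suc q → swap q y < x → y < x
  swap-mono-head⁻ {q} x y p p′ lt = subst (_< x) (swap-involutive q y) (swap-mono-head x (swap q y) p p′ lt)

  smaller : ℕ → List ℕ → ℕ
  smaller x = foldr (λ y acc → if y <ᵇ x then suc acc else acc) 0

  indicator : Bool → ℕ
  indicator false = 0
  indicator true  = 1

  smaller-∷ : ∀ x y l → smaller x (y ∷ l) ≡ indicator (y <ᵇ x) + smaller x l
  smaller-∷ x y l with y <ᵇ x
  ... | true  = refl
  ... | false = refl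

  smaller-cong : ∀ x x′ (f : ℕ → ℕ) l → All (λ y → (f y <ᵇ x′) ≡ (y <ᵇ x)) l → smaller x′ (map f l) ≡ smaller x l
  smaller-cong x x′ f []      []      = refl
  smaller-cong x x′ f (y ∷ l) (p ∷ h) =
    trans (smaller-∷ x′ (f y) (map f l)) (trans (cong₂ (λ b n → indicator b + n) p (smaller-cong x x′ f l h)) (sym (smaller-∷ x y l)))

  -- In the absence of q, replacing q + 1 by q does not affect the order of the values.
  invCount-swap : ∀ {q} l → All (_≢ q) l → invCount (map (swap q) l) ≡ invCount l
  invCount-swap []          _       = refl
  invCount-swap {q} (x ∷ l) (p ∷ h) = cong₂ _+_
    (smaller-cong x (swap q x) (swap q) l (All.map (λ {y} y≢q → <ᵇ-cong (swap-mono⁻ x y p y≢q) (swap-mono x y p y≢q)) h))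
    (invCount-swap l h)

  -- One-line notations with q in front of q + 1: exchanging the two values creates an inversion.
  data Up (q : ℕ) : List ℕ → Set where
    head : ∀ {l} → All (_≢ q) l → Any (_≡ suc q) l → Up q (q ∷ l)
    tail : ∀ {x l} → x ≢ q → x ≢ suc q → Up q l → Up q (x ∷ l)

  <ᵇ-true : ∀ {a b} → a < b → (a <ᵇ b) ≡ true
  <ᵇ-true {a} {b} lt with a <ᵇ b in e
  ... | true  = refl
  ... | false = ⊥-elim (subst T e (<⇒<ᵇ lt))

  <ᵇ-false : ∀ {a b} → ¬ (a < b) → (a <ᵇ b) ≡ false
  <ᵇ-false {a} {b} ≮ with a <ᵇ b in e
  ... | true  = contradiction (<ᵇ⇒< a b (subst T (sym e) _)) ≮
  ... | false = refl

  indicator-mono : ∀ {a b c d} → (a < b → c < d) → indicator (a <ᵇ b) ≤ indicator (c <ᵇ d)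
  indicator-mono {a} {b} f with a <ᵇ b in e
  ... | false = z≤n
  ... | true  rewrite <ᵇ-true (f (<ᵇ⇒< a b (subst T (sym e) _))) = ≤-refl

  swap-below : ∀ {q y} → y < q → swap q y < suc q
  swap-below y<q rewrite swap-other (<⇒≢ y<q) (<⇒≢ (m≤n⇒m≤1+n y<q)) = m≤n⇒m≤1+n y<q

  smaller-head≤ : ∀ {q} l → smaller q l ≤ smaller (suc q) (map (swap q) l)
  smaller-head≤     []      = z≤n
  smaller-head≤ {q} (y ∷ l) rewrite smaller-∷ q y l | smaller-∷ (suc q) (swap q y) (map (swap q) l) =
    +-mono-≤ (indicator-mono {y} {q} {swap q y} {suc q} swap-below) (smaller-head≤ l)

  smaller-head : ∀ {q l} → Any (_≡ suc q) l → smaller q l < smaller (suc q) (map (swap q) l)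
  smaller-head {q} {_ ∷ l} (here refl)
    rewrite swap-next q | <ᵇ-true (n<1+n q) | <ᵇ-false {suc q} {q} (<-asym (n<1+n q)) = s≤s (smaller-head≤ l)
  smaller-head {q} {y ∷ l} (there a) rewrite smaller-∷ q y l | smaller-∷ (suc q) (swap q y) (map (swap q) l) =
    +-mono-≤-< (indicator-mono {y} {q} {swap q y} {suc q} swap-below) (smaller-head a)

  invCount-up : ∀ {q l} → Up q l → invCount l < invCount (map (swap q) l)
  invCount-up {q} (head {l} h a) rewrite swap-self q | invCount-swap l h = +-monoˡ-< (invCount l) (smaller-head a)
  invCount-up {q} (tail {x} {l} p p′ u) rewrite swap-other p p′
    | smaller-cong x x (swap q) l (All.universal (λ y → <ᵇ-cong (swap-mono-head⁻ x y p p′) (swap-mono-head x y p p′)) l) = +-monoʳ-< (smaller x l) (invCount-up u)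

  up : ∀ {n q} (π : Vec ℕ n) i j → toℕ i < toℕ j → lookup π i ≡ q → lookup π j ≡ suc q →
    (∀ k → lookup π k ≡ q → k ≡ i) → (∀ k → lookup π k ≡ suc q → k ≡ j) → Up q (V.toList π)
  up (x V.∷ π) fzero    (fsuc j) _   refl ej ui uj = head (without π (λ k e → case ui (fsuc k) e of λ ())) (member π j ej)
    where
    without : ∀ {n} {q} (π : Vec ℕ n) → (∀ k → lookup π k ≢ q) → All (_≢ q) (V.toList π)
    without V.[]      h = []
    without (x V.∷ π) h = h fzero ∷ without π (λ k → h (fsuc k))
    member : ∀ {n} {q} (π : Vec ℕ n) j → lookup π j ≡ q → Any (_≡ q) (V.toList π)
    member (x V.∷ π) fzero    e = here e
    member (x V.∷ π) (fsuc j) e = there (member π j e)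
  up (x V.∷ π) (fsuc i) (fsuc j) i<j ei ej ui uj = tail (λ e → case ui fzero e of λ ()) (λ e → case uj fzero e of λ ())
    (up π i j (≤-pred i<j) ei ej (λ k e → Fin.suc-injective (ui (fsuc k) e)) (λ k e → Fin.suc-injective (uj (fsuc k) e)))

  len-up : ∀ {r q} (π : Perm r) i j → toℕ i < toℕ j → lookup π i ≡ q → lookup π j ≡ suc q →
    (∀ k → lookup π k ≡ q → k ≡ i) → (∀ k → lookup π k ≡ suc q → k ≡ j) → len π < len (sL (suc q) π)
  len-up {q = q} π i j i<j ei ej ui uj = subst (len π <_) (cong invCount (sym (V.toList-map (swap q) π))) (invCount-up (up π i j i<j ei ej ui uj))

  sL-involutive : ∀ {r} q (π : Perm r) → sL (suc q) (sL (suc q) π) ≡ π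
  sL-involutive q π = trans (sym (V.map-∘ (swap q) (swap q) π)) (trans (V.map-cong (swap-involutive q) π) (V.map-id π))

≤B⇒len≤ : ∀ {r} {u v : Perm r} → u ≤B v → len u ≤ len v
≤B⇒len≤ ≤B-refl             = ≤-refl
≤B⇒len≤ (≤B-step u≤v _ _ lt) = ≤-trans (≤B⇒len≤ u≤v) (<⇒≤ lt)

IsΠnd-functional : ∀ {r ps} {π π′ : Perm r} → IsΠnd ps π → IsΠnd ps π′ → π ≡ π′
IsΠnd-functional nd-[] nd-[] = refl
IsΠnd-functional (nd-up d _) (nd-up d′ _) with refl ← IsΠnd-functional d d′ = refl
IsΠnd-functional (nd-up d lt) (nd-stay d′ ≮) with refl ← IsΠnd-functional d d′ = contradiction lt ≮
IsΠnd-functional (nd-stay d ≮) (nd-up d′ lt) with refl ← IsΠnd-functional d d′ = contradiction lt ≮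
IsΠnd-functional (nd-stay d _) (nd-stay d′ _) = IsΠnd-functional d d′

-- Demazure action on the list of colours.

-- F is the list of colours r-1, …, 0 after rearrangement: the colour r - 1 - i, which starts in
-- position i, is now in position π i.
record Tracks {r : ℕ} (π : Perm r) (F : List ℕ) : Set where
  field
    bounded    : ∀ i → lookup π i < r
    position   : ∀ i → suc (toℕ i + at 0 F (lookup π i)) ≡ r
    surjective : ∀ q → q < r → ∃ λ i → lookup π i ≡ q

  injective : ∀ i j → lookup π i ≡ lookup π j → i ≡ j
  injective i j eq = toℕ-injective (+-cancelʳ-≡ (at 0 F (lookup π i)) (toℕ i) (toℕ j)
    (suc-injective (trans (position i) (trans (sym (position j)) (cong (λ z → suc (toℕ j + at 0 F z)) (sym eq))))))

at-++ : ∀ {A : Set} {d : A} pre xs n → at d (pre ++ xs) (length pre + n) ≡ at d xs n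
at-++ []        xs n = refl
at-++ (_ ∷ pre) xs n = at-++ pre xs n

private
  module Sort {r : ℕ} {π : Perm r} (pre : List ℕ) (x d : ℕ) (rest : List ℕ) (tr : Tracks π (pre ++ x ∷ d ∷ rest))
              (q<r : suc (length pre) < r) where
    open Tracks tr
    q = length pre
    F F′ : List ℕ
    F  = pre ++ x ∷ d ∷ rest
    F′ = pre ++ d ∷ x ∷ rest

    at-q : ∀ {a b} → at 0 (pre ++ a ∷ b ∷ rest) q ≡ a
    at-q {a} {b} = trans (cong (at 0 (pre ++ a ∷ b ∷ rest)) (sym (+-identityʳ q))) (at-++ pre _ 0)

    at-next : ∀ {a b} → at 0 (pre ++ a ∷ b ∷ rest) (suc q) ≡ b
    at-next {a} {b} = trans (cong (at 0 (pre ++ a ∷ b ∷ rest)) (sym (+-comm q 1))) (at-++ pre _ 1)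

    at-other : ∀ pre n → n ≢ length pre → n ≢ suc (length pre) → at 0 (pre ++ d ∷ x ∷ rest) n ≡ at 0 (pre ++ x ∷ d ∷ rest) n
    at-other []        zero          p _  = contradiction refl p
    at-other []        (suc zero)    _ p′ = contradiction refl p′
    at-other []        (suc (suc n)) _ _  = refl
    at-other (_ ∷ pre) zero          _ _  = refl
    at-other (_ ∷ pre) (suc n)       p p′ = at-other pre n (λ e → p (cong suc e)) (λ e → p′ (cong suc e))

    at-swap : ∀ n → at 0 F′ (swap q n) ≡ at 0 F n
    at-swap n with n ≟ q | n ≟ suc q
    ... | yes e | _     rewrite e | swap-self q = trans at-next (sym at-q)
    ... | no _  | yes e rewrite e | swap-next q = trans at-q (sym at-next)
    ... | no p  | no p′ rewrite swap-other p p′ = at-other pre n p p′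

    swap-bounded : ∀ {n} → n < r → swap q n < r
    swap-bounded {n} n<r with n ≟ q | n ≟ suc q
    ... | yes e | _     rewrite e | swap-self q = q<r
    ... | no _  | yes e rewrite e | swap-next q = <-trans (n<1+n q) q<r
    ... | no p  | no p′ rewrite swap-other p p′ = n<r

    tracks-swap : Tracks (sL (suc q) π) F′
    tracks-swap = record
      { bounded = λ i → subst (_< r) (sym (V.lookup-map i (swap q) π)) (swap-bounded (bounded i))
      ; position = λ i → trans (cong (λ z → suc (toℕ i + z)) (trans (cong (at 0 F′) (V.lookup-map i (swap q) π)) (at-swap (lookup π i)))) (position i)
      ; surjective = λ n n<r → let i , e = surjective (swap q n) (swap-bounded n<r) in
          i , trans (V.lookup-map i (swap q) π) (trans (cong (swap q) e) (swap-involutive q n))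
      }

    i j : Fin r
    i = proj₁ (surjective q (<-trans (n<1+n q) q<r))
    j = proj₁ (surjective (suc q) q<r)

    πi : lookup π i ≡ q
    πi = proj₂ (surjective q (<-trans (n<1+n q) q<r))
    πj : lookup π j ≡ suc q
    πj = proj₂ (surjective (suc q) q<r)

    i+x : suc (toℕ i + x) ≡ r
    i+x = trans (cong (λ z → suc (toℕ i + z)) (sym (trans (cong (at 0 F) πi) at-q))) (position i)
    j+d : suc (toℕ j + d) ≡ r
    j+d = trans (cong (λ z → suc (toℕ j + z)) (sym (trans (cong (at 0 F) πj) at-next))) (position j)

    i+x≡j+d : toℕ i + x ≡ toℕ j + d
    i+x≡j+d = suc-injective (trans i+x (sym j+d))

    <-of-+ : ∀ {a b m n} → a + m ≡ b + n → n < m → a < b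
    <-of-+ {a} {b} {m} {n} eq n<m = ≰⇒> λ b≤a → <-irrefl (sym eq) (+-mono-≤-< b≤a n<m)

    unique-i : ∀ k → lookup π k ≡ q → k ≡ i
    unique-i k e = injective k i (trans e (sym πi))
    unique-j : ∀ k → lookup π k ≡ suc q → k ≡ j
    unique-j k e = injective k j (trans e (sym πj))

    -- Larger colours start further left. Hence d < x gives i < j, and exchanging the values q and q
    -- + 1 lengthens π; for x < d it shortens π, while an increase in Bruhat order cannot lower the
    -- length.
    sort : ∀ {ps} → IsΠnd ps π → ∃ λ (π′ : Perm r) → IsΠnd (suc q ∷ ps) π′ × Tracks π′ (pre ++ (x ⊓ d) ∷ (x ⊔ d) ∷ rest)
    sort nd with <-cmp x d
    ... | tri> _ _ d<x rewrite m≥n⇒m⊓n≡n (<⇒≤ d<x) | m≥n⇒m⊔n≡m (<⇒≤ d<x) = sL (suc q) π ,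
      nd-up nd (≤B-step ≤B-refl q (suc q) longer , λ eq → <-irrefl (cong len eq) longer) , tracks-swap
      where longer = len-up π i j (<-of-+ i+x≡j+d d<x) πi πj unique-i unique-j
    ... | tri≈ _ x≡d _ = contradiction
      (trans (sym πi) (trans (cong (lookup π) (toℕ-injective (+-cancelʳ-≡ x _ _ (trans i+x≡j+d (cong (toℕ j +_) (sym x≡d)))))) πj))
      (<⇒≢ (n<1+n q))
    ... | tri< x<d _ _ rewrite m≤n⇒m⊓n≡m (<⇒≤ x<d) | m≤n⇒m⊔n≡n (<⇒≤ x<d) = π ,
      nd-stay nd (λ (π≤ , _) → <⇒≱ shorter (≤B⇒len≤ π≤)) , tr
      where
      open Tracks tracks-swap using () renaming (injective to injective′)
      look : ∀ k {n} → lookup π k ≡ n → lookup (sL (suc q) π) k ≡ swap q n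
      look k e = trans (V.lookup-map k (swap q) π) (cong (swap q) e)
      j′ : lookup (sL (suc q) π) j ≡ q
      j′ = trans (look j πj) (swap-next q)
      i′ : lookup (sL (suc q) π) i ≡ suc q
      i′ = trans (look i πi) (swap-self q)
      shorter : len (sL (suc q) π) < len π
      shorter = subst (λ z → len (sL (suc q) π) < len z) (sL-involutive q π)
        (len-up (sL (suc q) π) j i (<-of-+ (sym i+x≡j+d) x<d) j′ i′
          (λ k e → injective′ k j (trans e (sym j′))) (λ k e → injective′ k i (trans e (sym i′))))

-- The colours of a row are sorted at the places where two columns meet, so a row of the coloured
-- lattice acts by Demazure multiplication.
carry-tracks : ∀ {r x A X B Y z ps} {π : Perm r} pre rest → Carry x A X B Y z → IsΠnd ps π →
  Tracks π (pre ++ x ∷ X ++ rest) → length pre + length (x ∷ X) ≤ r →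
  ∃ λ (π′ : Perm r) → IsΠnd (zeroPositions (suc (length pre)) (zipWith _∸_ B A) ++ ps) π′ × Tracks π′ (pre ++ Y ++ z ∷ rest)
carry-tracks pre rest done nd tr _ = _ , nd , tr
carry-tracks {r} {ps = ps} pre rest (meet {x} {c} {d} {A} {X} {B} {Y} {z} _ cs) nd tr le
  -- Equal columns make the difference 0, so the position is circled. Its letter ends up to the
  -- right of those of the later positions and therefore multiplies first.
  rewrite n∸n≡0 c | ++-assoc (zeroPositions (2+ (length pre)) (zipWith _∸_ B A)) (suc (length pre) ∷ []) ps
  with π₁ , nd₁ , tr₁ ← Sort.sort pre x d (X ++ rest) tr (≤-trans (≤-trans (≤-reflexive (+-comm 2 (length pre))) (+-monoʳ-≤ (length pre) (s≤s (s≤s z≤n)))) le) nd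
  with π₂ , nd₂ , tr₂ ← carry-tracks (pre ++ (x ⊓ d) ∷ []) rest cs nd₁ (subst (Tracks π₁) (sym (++-assoc pre ((x ⊓ d) ∷ []) _)) tr₁)
         (≤-trans (≤-reflexive (trans (cong (_+ suc (length X)) (trans (length-++ pre) (+-comm (length pre) 1))) (sym (+-suc (length pre) (suc (length X)))))) le)
  rewrite length-++ pre {(x ⊓ d) ∷ []} | +-comm (length pre) 1 =
  π₂ , nd₂ , subst (Tracks π₂) (++-assoc pre ((x ⊓ d) ∷ []) (Y ++ z ∷ rest)) tr₂
carry-tracks {r} {ps = ps} {π} pre rest (fall {x} {a} {c} {d} {A} {X} {B} {Y} {z} a<c _ cs) nd tr le
  rewrite ≡ᵇ-false {c ∸ a} {0} (m>n⇒m∸n≢0 a<c) | ++-identityʳ (zeroPositions (2+ (length pre)) (zipWith _∸_ B A))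
  with π₂ , nd₂ , tr₂ ← carry-tracks (pre ++ x ∷ []) rest cs nd (subst (Tracks π) (sym (++-assoc pre (x ∷ []) _)) tr)
         (≤-trans (≤-reflexive (trans (cong (_+ suc (length X)) (trans (length-++ pre) (+-comm (length pre) 1))) (sym (+-suc (length pre) (suc (length X)))))) le)
  rewrite length-++ pre {x ∷ []} | +-comm (length pre) 1 =
  π₂ , nd₂ , subst (Tracks π₂) (++-assoc pre (x ∷ []) (Y ++ z ∷ rest)) tr₂

tracks-id : ∀ r → Tracks (idPerm r) (applyUpTo (λ q → r ∸ suc q) r)
tracks-id r = record
  { bounded    = λ i → subst (_< r) (sym (V.lookup∘tabulate toℕ i)) (toℕ<n i)
  ; position   = λ i → trans (cong (λ z → suc (toℕ i + at 0 (applyUpTo (λ q → r ∸ suc q) r) z)) (V.lookup∘tabulate toℕ i))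
      (trans (cong (λ z → suc (toℕ i + z)) (at-applyUpTo _ (toℕ<n i))) (m+[n∸m]≡n (toℕ<n i)))
  ; surjective = λ q q<r → fromℕ< q<r , trans (V.lookup∘tabulate toℕ (fromℕ< q<r)) (toℕ-fromℕ< q<r)
  }
  where

  at-applyUpTo : ∀ {n} f {q} → q < n → at 0 (applyUpTo f n) q ≡ f q
  at-applyUpTo {suc n} f {zero}  _        = refl
  at-applyUpTo {suc n} f {suc q} (s≤s lt) = at-applyUpTo (λ i → f (suc i)) lt

tabulate-toℕ : ∀ {A : Set} (f : ℕ → A) n → tabulate {n = n} (λ k → f (toℕ k)) ≡ applyUpTo f n
tabulate-toℕ f zero    = refl
tabulate-toℕ f (suc n) = cong (f 0 ∷_) (tabulate-toℕ (λ i → f (suc i)) n)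

map-allFin : ∀ {A : Set} (f : ℕ → A) n → map (λ k → f (toℕ k)) (allFin n) ≡ map f (upTo n)
map-allFin f n = trans (map-tabulate id (λ k → f (toℕ k))) (trans (tabulate-toℕ f n) (sym (map-upTo f n)))

foldr-allFin : ∀ {C : Set} (g : ℕ → C → C) z n → foldr (λ k → g (toℕ k)) z (allFin n) ≡ foldr g z (upTo n)
foldr-allFin g z n = trans (sym (foldr-map g toℕ z (allFin n))) (cong (foldr g z) (trans (map-allFin id n) (map-id (upTo n))))

at-applyUpTo : ∀ {A : Set} {d : A} {n} f {q} → q < n → at d (applyUpTo f n) q ≡ f q
at-applyUpTo {n = suc n} f {zero}  _        = refl
at-applyUpTo {n = suc n} f {suc q} (s≤s lt) = at-applyUpTo (λ i → f (suc i)) lt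

at-map-allFin : ∀ {A : Set} {d : A} n (f : Fin n → A) k → at d (map f (allFin n)) (toℕ k) ≡ f k
at-map-allFin {d = d} n f k = trans (cong (λ l → at d l (toℕ k)) (map-tabulate id f)) (go n f k)
  where
  go : ∀ n (f : Fin n → _) k → at d (tabulate f) (toℕ k) ≡ f k
  go (suc n) f fzero    = refl
  go (suc n) f (fsuc k) = go n (λ k → f (fsuc k)) k

at-beyond : ∀ {A : Set} {d : A} (l : List A) {n} → length l ≤ n → at d l n ≡ d
at-beyond []      _        = refl
at-beyond (_ ∷ l) (s≤s le) = at-beyond l le

readingWord-map : ∀ F n → readingWord (map F (upTo n)) ≡ rowsWord F n
readingWord-map F zero    = refl
readingWord-map F (suc n) = trans (cong (λ l → concat (reverse (map F l))) (sym (upTo-∷ʳ n)))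
  (trans (cong (λ l → concat (reverse l)) (map-++ F (upTo n) (n ∷ [])))
    (trans (cong concat (reverse-++ (map F (upTo n)) (F n ∷ []))) (cong (F n ++_) (readingWord-map F n))))

-- The tableau of a state

private
  -- A nameable copy of the `shape` local to `tableauOf`; the split on v in `tableauOf-segments`
  -- lets both unfold.
  shapeL : List (List ℕ) → ℕ → ℕ → ℕ → ℕ
  shapeL Ls r zero    k = 0
  shapeL Ls r (suc v) k = if suc v <ᵇ k then 0 else at 0 (at [] Ls (r ∸ suc v)) (k ∸ 1) ∸ (suc v ∸ k)

columnLists : ∀ r N → State Spin r N → List (List ℕ)
columnLists r N s = map (λ k → minusCols (vert s k)) (allFin (suc r))

pattern-of : ∀ r N → State Spin r N → ℕ → ℕ → ℕ
pattern-of r N s v j = shapeL (columnLists r N s) r v (suc j)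

tableauOf-segments : ∀ r N s → tableauOf r N s ≡ map (segment (pattern-of r N s) 0 r) (upTo r)
tableauOf-segments r N s = trans
  (map-cong {g = λ k → concatMap (entries k) (oneTo r)}
    (λ k → concatMap-cong {g = entries k} (λ { zero → refl ; (suc zero) → refl ; (suc (suc v)) → refl }) (oneTo r)) (oneTo r))
  (trans (sym (map-∘ (upTo r))) (map-cong rows (upTo r)))
  where
  sh = shapeL (columnLists r N s) r
  entries : ℕ → ℕ → List ℕ
  entries k v = replicate (sh v k ∸ sh (v ∸ 1) k) v
  go : ∀ j m d g → (∀ i → g i ≡ suc (m + i)) → concatMap (entries (suc j)) (applyUpTo g d) ≡ segment (pattern-of r N s) m d j
  go j m zero    g h = refl
  go j m (suc d) g h = cong₂ _++_ (cong (entries (suc j)) (trans (h 0) (cong suc (+-identityʳ m))))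
    (go j (suc m) d (λ i → g (suc i)) (λ i → trans (h (suc i)) (cong suc (+-suc m i))))
  rows : ∀ j → concatMap (entries (suc j)) (oneTo r) ≡ segment (pattern-of r N s) 0 r j
  rows j = trans (cong (concatMap (entries (suc j))) (map-upTo suc r)) (go j 0 r suc (λ _ → refl))

pattern-in : ∀ r N s {v j} → j < v → pattern-of r N s v j ≡ at 0 (at [] (columnLists r N s) (r ∸ v)) j ∸ (v ∸ suc j)
pattern-in r N s {suc v} {j} (s≤s j≤v) with v <ᵇ j in e
... | false = refl
... | true  = contradiction (<ᵇ⇒< v j (subst T (sym e) _)) (≤⇒≯ j≤v)

pattern-out : ∀ r N s {v j} → v ≤ j → pattern-of r N s v j ≡ 0
pattern-out r N s {zero}  _ = refl
pattern-out r N s {suc v} {j} v<j with v <ᵇ j in e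
... | true  = refl
... | false = ⊥-elim (subst T e (<⇒<ᵇ v<j))

length-segment : ∀ {r G} → IsGT r G → ∀ m d j → m + d ≤ r → length (segment G m d j) + G m j ≡ G (m + d) j
length-segment {G = G} gt m zero    j _  = cong (λ n → G n j) (sym (+-identityʳ m))
length-segment {G = G} gt m (suc d) j le rewrite +-suc m d = begin
  length (replicate (G (suc m) j ∸ G m j) (suc m) ++ segment G (suc m) d j) + G m j
    ≡⟨ cong (_+ G m j) (trans (length-++ (replicate (G (suc m) j ∸ G m j) (suc m))) (cong (_+ length (segment G (suc m) d j)) (length-replicate (G (suc m) j ∸ G m j)))) ⟩
  (G (suc m) j ∸ G m j + length (segment G (suc m) d j)) + G m j
    ≡⟨ cong (_+ G m j) (+-comm (G (suc m) j ∸ G m j) _) ⟩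
  (length (segment G (suc m) d j) + (G (suc m) j ∸ G m j)) + G m j
    ≡⟨ +-assoc (length (segment G (suc m) d j)) _ _ ⟩
  length (segment G (suc m) d j) + ((G (suc m) j ∸ G m j) + G m j)
    ≡⟨ cong (length (segment G (suc m) d j) +_) (m∸n+n≡m (IsGT.grow gt j (≤-trans (s≤s (m≤m+n m d)) le))) ⟩
  length (segment G (suc m) d j) + G (suc m) j
    ≡⟨ length-segment gt (suc m) d j le ⟩
  G (suc m + d) j ∎
  where open ≡-Reasoning

-- Interlacing of consecutive rows of columns

private
  carry-length : ∀ {x A X B Y z} → Carry x A X B Y z → length A ≡ length B × length X ≡ length A
  carry-length done         = refl , refl
  carry-length (meet _ c)   with p , q ← carry-length c = cong suc p , cong suc q
  carry-length (fall _ _ c) with p , q ← carry-length c = cong suc p , cong suc q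

  carry-above : ∀ {x A X B Y z} → Carry x A X B Y z → ∀ j → at 0 A j ≤ at 0 B j
  carry-above done         j       = ≤-refl
  carry-above (meet _ c)   zero    = ≤-refl
  carry-above (meet _ c)   (suc j) = carry-above c j
  carry-above (fall p _ c) zero    = <⇒≤ p
  carry-above (fall _ _ c) (suc j) = carry-above c j

  carry-below : ∀ {x a A X B Y z} → All (_< a) B → Carry x A X B Y z → ∀ j → j < length B → at 0 B j < at 0 (a ∷ A) j
  carry-below (p ∷ _) (meet _ _)   zero    _        = p
  carry-below (p ∷ _) (fall _ _ _) zero    _        = p
  carry-below _       (meet h c)   (suc j) (s≤s lt) = carry-below h c j lt
  carry-below _       (fall _ h c) (suc j) (s≤s lt) = carry-below h c j lt

  carry-length≤ : ∀ {x a A X B Y z} → All (_< a) B → Carry x A X B Y z → length A ≤ a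
  carry-length≤ _       done         = z≤n
  carry-length≤ (p ∷ _) (meet h c)   = ≤-<-trans (carry-length≤ h c) p
  carry-length≤ (p ∷ _) (fall q h c) = ≤-<-trans (carry-length≤ h c) (<-trans q p)

  -- Columns decrease strictly, so each is at least the number of columns after it. Thus no
  -- truncation occurs when the staircase is subtracted.
  carry-staircase : ∀ {x A X B Y z} → Carry x A X B Y z → ∀ j → length A ∸ suc j ≤ at 0 A j
  carry-staircase done         j       = z≤n
  carry-staircase (meet h c)   zero    = carry-length≤ h c
  carry-staircase (fall _ h c) zero    = carry-length≤ h c
  carry-staircase (meet _ c)   (suc j) = carry-staircase c j
  carry-staircase (fall _ _ c) (suc j) = carry-staircase c j

-- From the rows of the lattice to the Demazure product.

module Lattice {r : ℕ} (L X : ℕ → List ℕ) (z : ℕ → ℕ) (rows : ∀ k → k < r → Row (L k) (X k) (L (suc k)) (X (suc k)) (z k))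
  (L-bottom : L r ≡ []) (X-bottom : X r ≡ []) (X-top : X 0 ≡ applyUpTo (λ q → r ∸ suc q) r)
  {G : ℕ → ℕ → ℕ} (G-in : ∀ {v j} → j < v → G v j ≡ at 0 (L (r ∸ v)) j ∸ (v ∸ suc j)) (G-out : ∀ {v j} → v ≤ j → G v j ≡ 0) where

  private
    length-L : ∀ n k → k + n ≡ r → length (L k) ≡ n
    length-L zero    k eq rewrite trans (sym (+-identityʳ k)) eq | L-bottom = refl
    length-L (suc n) k eq with L k | X k | rows k (subst (k <_) eq (subst (k <_) (sym (+-suc k n)) (s≤s (m≤m+n k n))))
    ... | _ | _ | row _ c = cong suc (trans (proj₁ (carry-length c)) (length-L n (suc k) (trans (sym (+-suc k n)) eq)))

    level-row : ∀ {v} → v < r → Row (L (r ∸ suc v)) (X (r ∸ suc v)) (L (r ∸ v)) (X (r ∸ v)) (z (r ∸ suc v))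
    level-row {v} v<r = subst (λ k → Row (L (r ∸ suc v)) (X (r ∸ suc v)) (L k) (X k) (z (r ∸ suc v))) (sym (+-∸-assoc 1 v<r))
      (rows (r ∸ suc v) (∸-monoʳ-< (s≤s z≤n) v<r))

    length-level : ∀ {v} → v ≤ r → length (L (r ∸ v)) ≡ v
    length-level {v} v≤r = length-L v (r ∸ v) (m∸n+n≡m v≤r)

    row-below : ∀ {A X B Y z} → Row A X B Y z → ∀ j → j < length B → at 0 B j < at 0 A j
    row-below (row h c) = carry-below h c

    row-above : ∀ {A X B Y z} → Row A X B Y z → ∀ j → at 0 A (suc j) ≤ at 0 B j
    row-above (row _ c) = carry-above c

  isGT : IsGT r G
  isGT = record { beyond = G-out ; grow = grow ; strip = strip }
    where
    -- Within a row, the staircases of consecutive levels differ by one, which turns the strict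
    -- inequality of columns into a weak one of parts. In `strip` the staircases agree, as the
    -- inequality is already weak.
    grow : ∀ {v} j → v < r → G v j ≤ G (suc v) j
    grow {v} j v<r with j <? v
    ... | no j≮v  = subst (_≤ G (suc v) j) (sym (G-out (≮⇒≥ j≮v))) z≤n
    ... | yes j<v = subst₂ _≤_ (sym (G-in j<v)) (sym (trans (G-in (m≤n⇒m≤1+n j<v)) (cong (at 0 (L (r ∸ suc v)) j ∸_) (+-∸-assoc 1 j<v))))
      (∸-monoˡ-≤ (suc (v ∸ suc j)) (row-below (level-row v<r) j (subst (j <_) (sym (length-level (<⇒≤ v<r))) j<v)))
    strip : ∀ {v} j → v < r → G (suc v) (suc j) ≤ G v j
    strip {v} j v<r with j <? v
    ... | no j≮v  = subst (_≤ G v j) (sym (G-out (s≤s (≮⇒≥ j≮v)))) z≤n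
    ... | yes j<v = subst₂ _≤_ (sym (G-in (s≤s j<v))) (sym (G-in j<v)) (∸-monoˡ-≤ (v ∸ suc j) (row-above (level-row v<r) j))

  private
    diffs-zipWith : ∀ m n c Bs As → length Bs ≡ n → length As ≡ n → (∀ j → j < n → diff G m (c + j) ≡ at 0 Bs j ∸ at 0 As j) →
      diffs G m c n ≡ zipWith _∸_ Bs As
    diffs-zipWith m zero    c []       []       _  _   h = refl
    diffs-zipWith m (suc n) c (b ∷ Bs) (a ∷ As) lB lA h = cong₂ _∷_ (trans (cong (diff G m) (sym (+-identityʳ c))) (h 0 (s≤s z≤n)))
      (diffs-zipWith m n (suc c) Bs As (suc-injective lB) (suc-injective lA) (λ j lt → trans (cong (diff G m) (sym (+-suc c j))) (h (suc j) (s≤s lt))))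

    -- Part j of level m and part j + 1 of level m + 1 have the same staircase, so parts and columns
    -- have the same differences.
    diffs-row : ∀ {m a x A X′ z′} → m < r → L (r ∸ suc m) ≡ a ∷ A → Carry x A X′ (L (r ∸ m)) (X (r ∸ m)) z′ → diffs G m 0 m ≡ zipWith _∸_ (L (r ∸ m)) A
    diffs-row {m} {a} {A = A} m<r La c = diffs-zipWith m m 0 (L (r ∸ m)) A lB lA entry
      where
      lB = length-level (<⇒≤ m<r)
      lA = trans (proj₁ (carry-length c)) lB
      entry : ∀ j → j < m → diff G m j ≡ at 0 (L (r ∸ m)) j ∸ at 0 A j
      entry j j<m = trans (cong₂ _∸_ (G-in j<m) (trans (G-in (s≤s j<m)) (cong (λ l → at 0 l (suc j) ∸ (m ∸ suc j)) La)))
        (trans (∸-+-assoc (at 0 (L (r ∸ m)) j) (m ∸ suc j) (at 0 A j ∸ (m ∸ suc j))) (cong (at 0 (L (r ∸ m)) j ∸_)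
          (m+[n∸m]≡n (subst (λ n → n ∸ suc j ≤ at 0 A j) lA (carry-staircase c j)))))

  -- The latest exit comes first. Counting from 0, position p of the final list holds the colour
  -- that leaves row r - 1 - p, which is the origin of w_0.
  exits : ℕ → List ℕ
  exits zero    = []
  exits (suc k) = z k ∷ exits k

  at-exits : ∀ n {q} → q < n → at 0 (exits n) q ≡ z (n ∸ suc q)
  at-exits (suc n) {zero}  _        = refl
  at-exits (suc n) {suc q} (s≤s lt) = at-exits n lt

  Result : List ℕ → List ℕ → Set
  Result ps F = Σ (Perm r) λ π → IsΠnd ps π × Tracks π F

  -- Row n lies between levels m + 1 and m. Its exit colour lands between the colours still inside
  -- and the earlier exits, as `exits` requires.
  demazure-row : ∀ n m → suc m + n ≡ r → Result (circledWord G (suc m) n) (X n ++ exits n) → Result (circledWord G m (suc n)) (X (suc n) ++ exits (suc n))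
  demazure-row n m eq (π , nd , tr) = go (L n) (X n) refl refl (rows n n<r) tr
    where
    n<r : n < r
    n<r = subst (n <_) eq (s≤s (m≤n+m n m))
    m<r : m < r
    m<r = subst (m <_) eq (s≤s (m≤m+n m n))
    n≡ : r ∸ suc m ≡ n
    n≡ = trans (cong (_∸ suc m) (sym eq)) (m+n∸m≡n (suc m) n)
    n+1≡ : r ∸ m ≡ suc n
    n+1≡ = trans (+-∸-assoc 1 m<r) (cong suc n≡)
    go : ∀ A′ X′ → L n ≡ A′ → X n ≡ X′ → Row A′ X′ (L (suc n)) (X (suc n)) (z n) → Tracks π (X′ ++ exits n) → Result (circledWord G m (suc n)) (X (suc n) ++ exits (suc n))
    go .(a ∷ A) .(x ∷ X′) La _ (row {a} {x} {A} {X′} _ c) tr = subst (λ ds → Result (zeroPositions 1 ds ++ circledWord G (suc m) n) (X (suc n) ++ exits (suc n)))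
      (sym (trans (diffs-row m<r (trans (cong L n≡) La) (subst (λ k → Carry x A X′ (L k) (X k) (z n)) (sym n+1≡) c)) (cong (λ k → zipWith _∸_ (L k) A) n+1≡)))
      (carry-tracks [] (exits n) c nd tr
        (≤-trans (≤-reflexive (cong suc (trans (proj₂ (carry-length c)) (trans (proj₁ (carry-length c)) (length-L m (suc n) (trans (cong suc (+-comm n m)) eq)))))) m<r))

  demazure : ∀ n m → m + n ≡ r → Result (circledWord G m n) (X n ++ exits n)
  demazure zero    m eq = idPerm r , nd-[] , subst (Tracks (idPerm r)) (sym (trans (++-identityʳ (X 0)) X-top)) (tracks-id r)
  demazure (suc n) m eq = demazure-row n m (trans (sym (+-suc m n)) eq) (demazure n (suc m) (trans (sym (+-suc m n)) eq))

  exit-colours : 2 ≤ r → Σ (Perm r) λ π → IsΠnd (circledWord G 1 (r ∸ 1)) π ×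
    (∀ i → lookup π i < r × suc (toℕ i + z (r ∸ suc (lookup π i))) ≡ r)
  -- The bottom row, m = 0, has no differences and contributes no letters, so the word for m = 0 is
  -- that for m = 1.
  exit-colours (s≤s _) with π , nd , tr ← demazure r 0 refl = π , nd , λ i → Tracks.bounded tr i ,
    trans (cong (λ n → suc (toℕ i + n)) (sym (trans (cong (λ l → at 0 (l ++ exits r) (lookup π i)) X-bottom) (at-exits r (Tracks.bounded tr i))))) (Tracks.position tr i)

-- The partition

module Partition (r : ℕ) (lam : Vec ℕ r) (isPartition : IsPartition lam) where
  l : ℕ → ℕ
  l = at 0 (V.toList lam)

  private
    at-toList : ∀ {n} (xs : Vec ℕ n) k → at 0 (V.toList xs) (toℕ k) ≡ lookup xs k
    at-toList (x V.∷ xs) fzero    = refl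
    at-toList (x V.∷ xs) (fsuc k) = at-toList xs k

  l-lookup : ∀ k → l (toℕ k) ≡ lookup lam k
  l-lookup = at-toList lam

  l-beyond : ∀ {j} → r ≤ j → l j ≡ 0
  l-beyond r≤j = at-beyond (V.toList lam) (≤-trans (≤-reflexive (V.length-toList lam)) r≤j)

  l-mono : ∀ j → l (suc j) ≤ l j
  l-mono j with suc j <? r
  ... | no ≮   = subst (_≤ l j) (sym (l-beyond (≮⇒≥ ≮))) z≤n
  ... | yes lt = subst₂ _≤_ (at-fromℕ< lt) (at-fromℕ< lt′)
    (isPartition (fromℕ< lt′) (fromℕ< lt) (subst₂ _≤_ (sym (toℕ-fromℕ< lt′)) (sym (toℕ-fromℕ< lt)) (n≤1+n j)))
    where
    lt′ = <-trans (n<1+n j) lt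
    at-fromℕ< : ∀ {j} (lt : j < r) → lookup lam (fromℕ< lt) ≡ l j
    at-fromℕ< lt = trans (sym (l-lookup (fromℕ< lt))) (cong l (toℕ-fromℕ< lt))

  l-antitone : ∀ {i j} → i ≤ j → l j ≤ l i
  l-antitone {i} {j} i≤j with d , refl ← m≤n⇒∃[o]m+o≡n i≤j = go d
    where
    go : ∀ d → l (i + d) ≤ l i
    go zero    = ≤-reflexive (cong l (+-identityʳ i))
    go (suc d) = ≤-trans (≤-reflexive (cong l (+-suc i d))) (≤-trans (l-mono (i + d)) (go d))

  highestT-rows : highestT r lam ≡ map (λ j → replicate (l j) (suc j)) (upTo r)
  highestT-rows = trans (map-cong (λ k → cong (λ n → replicate n (suc (toℕ k))) (sym (l-lookup k))) (allFin r))
    (map-allFin (λ j → replicate (l j) (suc j)) r)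

  readingWord-highestT : readingWord (highestT r lam) ≡ highWord l r
  readingWord-highestT = trans (cong readingWord highestT-rows) (trans (readingWord-map _ r) (go r))
    where
    go : ∀ t → rowsWord (λ j → replicate (l j) (suc j)) t ≡ highWord l t
    go zero    = refl
    go (suc t) = cong (replicate (l t) (suc t) ++_) (go t)

  shapeT-highestT : shapeT (highestT r lam) ≡ map l (upTo r)
  shapeT-highestT = trans (cong shapeT highestT-rows) (trans (sym (map-∘ (upTo r))) (map-cong (λ j → length-replicate (l j)) (upTo r)))

  private
    height : ℕ → ℕ
    height j = foldr (λ i acc → if l i <ᵇ j then acc else suc acc) 0 (upTo r)

    lowestT-row : ℕ → Word
    lowestT-row k = map (λ j → r ∸ height j + suc k) (oneTo (l k))

    lowestT-rows : lowestT r lam ≡ map lowestT-row (upTo r)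
    lowestT-rows = trans
      (map-cong {g = λ k → lowestT-row (toℕ k)} (λ k → trans
        (map-cong {g = λ j → r ∸ height j + suc (toℕ k)} (λ j → cong (λ h → r ∸ h + suc (toℕ k)) (height-eq j)) (oneTo (lookup lam k)))
        (cong (λ n → map (λ j → r ∸ height j + suc (toℕ k)) (oneTo n)) (sym (l-lookup k)))) (allFin r))
      (map-allFin lowestT-row r)
      where
      height-eq : ∀ j → foldr (λ k acc → if lookup lam k <ᵇ j then acc else suc acc) 0 (allFin r) ≡ height j
      height-eq j = trans (foldr-cong (λ k acc → cong (λ n → if n <ᵇ j then acc else suc acc) (sym (l-lookup k))) refl (allFin r))
        (foldr-allFin (λ i acc → if l i <ᵇ j then acc else suc acc) 0 r)

    height-≡ : ∀ {h j} → h ≤ r → (∀ i → i < h → j ≤ l i) → (∀ i → h ≤ i → l i < j) → height j ≡ h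
    height-≡ {h} {j} h≤r above below = count r 0 id (λ _ → refl) h≤r
      where
      count : ∀ n c f → (∀ i → f i ≡ c + i) → h ≤ c + n → foldr (λ i acc → if l i <ᵇ j then acc else suc acc) 0 (applyUpTo f n) ≡ h ∸ c
      count zero    c f eq le = sym (m≤n⇒m∸n≡0 (subst (h ≤_) (+-identityʳ c) le))
      count (suc n) c f eq le rewrite eq 0 | +-identityʳ c
        | count n (suc c) (λ i → f (suc i)) (λ i → trans (eq (suc i)) (+-suc c i)) (subst (h ≤_) (+-suc c n) le)
        with c <? h | l c <ᵇ j in e
      ... | yes c<h | true  = contradiction (<ᵇ⇒< (l c) j (subst T (sym e) _)) (≤⇒≯ (above c c<h))
      ... | yes c<h | false = sym (+-∸-assoc 1 c<h)
      ... | no c≮h  | true  = trans (m≤n⇒m∸n≡0 (m≤n⇒m≤1+n (≮⇒≥ c≮h))) (sym (m≤n⇒m∸n≡0 (≮⇒≥ c≮h)))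
      ... | no c≮h  | false = ⊥-elim (subst T e (<⇒<ᵇ (below c (≮⇒≥ c≮h))))

    oneTo-snoc : ∀ n → oneTo (suc n) ≡ oneTo n ++ suc n ∷ []
    oneTo-snoc n = trans (cong (map suc) (sym (upTo-∷ʳ n))) (map-++ suc (upTo n) (n ∷ []))

    map-const-segment : ∀ (f : ℕ → ℕ) p n x → (∀ i → i < n → f (suc (p + i)) ≡ x) → map f (oneTo (p + n)) ≡ map f (oneTo p) ++ replicate n x
    map-const-segment f p zero    x h = trans (cong (λ m → map f (oneTo m)) (+-identityʳ p)) (sym (++-identityʳ _))
    map-const-segment f p (suc n) x h = begin
      map f (oneTo (p + suc n))                        ≡⟨ cong (λ m → map f (oneTo m)) (+-suc p n) ⟩
      map f (oneTo (suc (p + n)))                      ≡⟨ cong (map f) (oneTo-snoc (p + n)) ⟩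
      map f (oneTo (p + n) ++ suc (p + n) ∷ [])        ≡⟨ map-++ f (oneTo (p + n)) _ ⟩
      map f (oneTo (p + n)) ++ f (suc (p + n)) ∷ []    ≡⟨ cong₂ (λ u y → u ++ y ∷ []) (map-const-segment f p n x (λ i lt → h i (m≤n⇒m≤1+n lt))) (h n ≤-refl) ⟩
      (map f (oneTo p) ++ replicate n x) ++ x ∷ []     ≡⟨ ++-assoc (map f (oneTo p)) _ _ ⟩
      map f (oneTo p) ++ (replicate n x ++ x ∷ [])     ≡⟨ cong (map f (oneTo p) ++_) (trans (sym (replicate-snoc n x [])) (++-identityʳ _)) ⟩
      map f (oneTo p) ++ replicate (suc n) x           ∎
      where open ≡-Reasoning

    -- Peels off columns of equal height: those between `l (k + suc d)` and `l (k + d)` have height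
    -- k + d + 1, hence one common entry in row k.
    lowestT-row-split : ∀ k d → k + d ≤ r →
      lowestT-row k ≡ map (λ j → r ∸ height j + suc k) (oneTo (l (k + d))) ++ lowRow l k d (r ∸ (k + d) + suc k) (l (k + d))
    lowestT-row-split k zero    _  = trans (cong (λ n → map (λ j → r ∸ height j + suc k) (oneTo (l n))) (sym (+-identityʳ k))) (sym (++-identityʳ _))
    lowestT-row-split k (suc d) le = begin
      lowestT-row k ≡⟨ lowestT-row-split k d (<⇒≤ kd<r) ⟩
      map f (oneTo (l (k + d))) ++ lowRow l k d (r ∸ (k + d) + suc k) (l (k + d))
        ≡⟨ cong₂ (λ n y → map f (oneTo n) ++ lowRow l k d y (l (k + d))) (sym (m+[n∸m]≡n p≤)) x-suc ⟩
      map f (oneTo (p + (l (k + d) ∸ p))) ++ lowRow l k d (suc x) (l (k + d))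
        ≡⟨ cong (_++ lowRow l k d (suc x) (l (k + d))) (map-const-segment f p (l (k + d) ∸ p) x entry) ⟩
      (map f (oneTo p) ++ replicate (l (k + d) ∸ p) x) ++ lowRow l k d (suc x) (l (k + d))
        ≡⟨ ++-assoc (map f (oneTo p)) _ _ ⟩
      map f (oneTo p) ++ lowRow l k (suc d) x p ∎
      where
      open ≡-Reasoning
      f : ℕ → ℕ
      f j = r ∸ height j + suc k
      p x : ℕ
      p = l (k + suc d)
      x = r ∸ (k + suc d) + suc k
      kd<r : k + d < r
      kd<r = subst (_≤ r) (+-suc k d) le
      p≤ : p ≤ l (k + d)
      p≤ = l-antitone (+-monoʳ-≤ k (n≤1+n d))
      x-suc : r ∸ (k + d) + suc k ≡ suc x
      x-suc = cong (_+ suc k) (trans (+-∸-assoc 1 kd<r) (cong (λ n → suc (r ∸ n)) (sym (+-suc k d))))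
      entry : ∀ i → i < l (k + d) ∸ p → f (suc (p + i)) ≡ x
      entry i lt = cong (λ h → r ∸ h + suc k) (height-≡ {k + suc d} le
        (λ i′ lt′ → ≤-trans (subst (_≤ l (k + d)) (+-suc p i) (≤-trans (+-monoʳ-≤ p lt) (≤-reflexive (m+[n∸m]≡n p≤))))
                      (l-antitone (≤-pred (subst (suc i′ ≤_) (+-suc k d) lt′))))
        (λ i′ le′ → s≤s (≤-trans (l-antitone le′) (m≤m+n p i))))

    lowestT-row-lowRow : ∀ k d → k + d ≡ r → lowestT-row k ≡ lowRow l k d (suc k) 0
    lowestT-row-lowRow k d eq = trans (lowestT-row-split k d (≤-reflexive eq))
      (subst (λ n → map (λ j → r ∸ height j + suc k) (oneTo (l n)) ++ lowRow l k d (r ∸ n + suc k) (l n) ≡ lowRow l k d (suc k) 0) (sym eq) end)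
      where
      end : map (λ j → r ∸ height j + suc k) (oneTo (l r)) ++ lowRow l k d (r ∸ r + suc k) (l r) ≡ lowRow l k d (suc k) 0
      end rewrite l-beyond (≤-refl {r}) | n∸n≡0 r = refl

    lowestT-lowRows : lowestT r lam ≡ lowRows l 0 r 1
    lowestT-lowRows = trans lowestT-rows (trans (map-upTo lowestT-row r) (go r 0 lowestT-row refl (λ _ → refl)))
      where
      go : ∀ d k g → k + d ≡ r → (∀ i → g i ≡ lowestT-row (k + i)) → applyUpTo g d ≡ lowRows l k d (suc k)
      go zero    k g eq h = refl
      go (suc d) k g eq h = cong₂ _∷_ (trans (h 0) (trans (cong lowestT-row (+-identityʳ k)) (lowestT-row-lowRow k (suc d) eq)))
        (go d (suc k) (λ i → g (suc i)) (trans (sym (+-suc k d)) eq) (λ i → trans (h (suc i)) (cong lowestT-row (+-suc k i))))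

  lowestT≈star-highestT : readingWord (lowestT r lam) ≈ star r (readingWord (highestT r lam))
  lowestT≈star-highestT = subst₂ (λ T w → readingWord T ≈ star r w)
    (trans (cong (λ n → lowRows l 0 r (suc n)) (n∸n≡0 r)) (sym lowestT-lowRows)) (sym readingWord-highestT)
    (low≈star-high l l-mono r r ≤-refl)

  -- The top boundary

  private
    column colour : ℕ × ℕ → ℕ
    column = proj₁
    colour = proj₂

    assoc : List (ℕ × ℕ) → ℕ → CSpin
    assoc P c = foldr (λ p acc → if c ≡ᵇ column p then just (colour p) else acc) nothing P

    Descending : List (ℕ × ℕ) → Set
    Descending = AllPairs (λ p q → column q < column p)

    assoc-absent : ∀ {n} P → All (λ p → column p < n) P → assoc P n ≡ nothing
    assoc-absent []      []       = refl
    assoc-absent (p ∷ P) (lt ∷ h) rewrite ≡ᵇ-false (λ eq → <⇒≢ lt (sym eq)) = assoc-absent P h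

    below-max : ∀ {n a} P → a ≤ n → All (λ p → column p < a) P → All (λ p → column p < n) P
    below-max P le = All.map (λ lt → <-≤-trans lt le)

    -- As the columns of P decrease strictly, a scan from column n - 1 downwards meets the pairs in
    -- the order of the list.
    assoc-lists : ∀ n P (f : Fin n → CSpin) → Descending P → All (λ p → column p < n) P → (∀ c → f c ≡ assoc P (toℕ c)) →
      cols n (λ c → forget (f c)) ≡ map column P × colours n f ≡ map colour P
    assoc-lists zero    []            f _       _       h = refl , refl
    assoc-lists zero    (_ ∷ _)       f _       (() ∷ _) h
    assoc-lists (suc n) []            f _       _       h
      rewrite h (fromℕ n) = assoc-lists n [] (λ c → f (inject₁ c)) [] [] (λ c → h (inject₁ c))
    assoc-lists (suc n) ((a , x) ∷ P) f (d ∷ D) (a≤n ∷ _) h with a ≟ n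
    ... | yes refl rewrite h (fromℕ n) | toℕ-fromℕ n | ≡ᵇ-refl n
      with p , q ← assoc-lists n P (λ c → f (inject₁ c)) D d
             (λ c → trans (h (inject₁ c)) (subst (λ m → assoc ((n , x) ∷ P) m ≡ assoc P (toℕ c)) (sym (toℕ-inject₁ c)) (cong (λ b → if b then just x else assoc P (toℕ c)) (≡ᵇ-false (<⇒≢ (toℕ<n c)))))) = cong (n ∷_) p , cong (x ∷_) q
    ... | no a≢n rewrite h (fromℕ n) | toℕ-fromℕ n
      | assoc-absent {n} ((a , x) ∷ P) (≤∧≢⇒< (≤-pred a≤n) a≢n ∷ below-max P (≤-pred a≤n) d) =
      assoc-lists n ((a , x) ∷ P) (λ c → f (inject₁ c)) (d ∷ D) (≤∧≢⇒< (≤-pred a≤n) a≢n ∷ below-max P (≤-pred a≤n) d)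
        (λ c → trans (h (inject₁ c)) (cong (assoc ((a , x) ∷ P)) (toℕ-inject₁ c)))

    topPairs : List (ℕ × ℕ)
    topPairs = applyUpTo (λ j → l j + (r ∸ suc j) , r ∸ suc j) r

    topC-assoc : ∀ c → topC r lam c ≡ assoc topPairs c
    topC-assoc c = trans
      (foldr-cong (λ k acc → cong (λ n → if c ≡ᵇ n + (r ∸ suc (toℕ k)) then just (r ∸ suc (toℕ k)) else acc) (sym (l-lookup k))) refl (allFin r))
      (trans (foldr-allFin (λ j acc → if c ≡ᵇ l j + (r ∸ suc j) then just (r ∸ suc j) else acc) nothing r)
        (trans (sym (foldr-map _ (λ j → l j + (r ∸ suc j) , r ∸ suc j) nothing (upTo r))) (cong (λ P → assoc P c) (map-upTo _ r))))

    topPairs-descending : Descending topPairs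
    topPairs-descending = AllPairs.applyUpTo⁺₁ _ r (λ {i} {j} i<j j<r → +-mono-≤-< (l-antitone (<⇒≤ i<j)) (∸-monoʳ-< (s≤s i<j) j<r))

  forget-topC : ∀ c → forget (topC r lam c) ≡ topU r lam c
  forget-topC c = go (allFin r)
    where
    go : ∀ ks → forget (foldr (λ k acc → if c ≡ᵇ (lookup lam k + (r ∸ suc (toℕ k))) then just (color r (suc (toℕ k))) else acc) nothing ks) ≡
                foldr (λ k acc → if c ≡ᵇ (lookup lam k + (r ∸ suc (toℕ k))) then minus else acc) plus ks
    go []       = refl
    go (k ∷ ks) with c ≡ᵇ (lookup lam k + (r ∸ suc (toℕ k)))
    ... | true  = refl
    ... | false = go ks

  module _ {N : ℕ} (fits : part1 lam + (r ∸ 1) ≤ N) (f : Fin (suc N) → CSpin) (top : ∀ c → f c ≡ topC r lam (toℕ c)) where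
    private
      part1-l : ∀ {n} (xs : Vec ℕ n) → part1 xs ≡ at 0 (V.toList xs) 0
      part1-l V.[]      = refl
      part1-l (_ V.∷ _) = refl

      lists = assoc-lists (suc N) topPairs f topPairs-descending
        -- By `fits` even the largest column, λ_1 + r - 1, lies on the grid.
        (All.applyUpTo⁺₁ _ r (λ {j} _ → s≤s (≤-trans (+-mono-≤ (≤-trans (l-antitone z≤n) (≤-reflexive (sym (part1-l lam)))) (∸-monoʳ-≤ r (s≤s z≤n))) fits)))
        (λ c → trans (top c) (topC-assoc (toℕ c)))

    top-cols : cols (suc N) (λ c → forget (f c)) ≡ applyUpTo (λ j → l j + (r ∸ suc j)) r
    top-cols = trans (proj₁ lists) (trans (cong (map column) (sym (map-upTo _ r))) (trans (sym (map-∘ (upTo r))) (map-upTo _ r)))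

    top-colours : colours (suc N) f ≡ applyUpTo (λ j → r ∸ suc j) r
    top-colours = trans (proj₂ lists) (trans (cong (map colour) (sym (map-upTo _ r))) (trans (sym (map-∘ (upTo r))) (map-upTo _ r)))

-- The theorem for a given uncoloured state.

-- A colouring whose right boundary, the one place where w enters, is left open. The bottom boundary
-- is recovered through `forget-v`.
record Lift (r N : ℕ) (lam : Vec ℕ r) (s : State Spin r N) (cs : State CSpin r N) : Set where
  field
    top      : ∀ c → vert cs fzero c ≡ topC r lam (toℕ c)
    left     : ∀ i → horiz cs i (fromℕ (suc N)) ≡ nothing
    vertices : ∀ i c → CVertex (horiz cs i (fsuc c)) (vert cs (inject₁ i) c) (horiz cs i (inject₁ c)) (vert cs (fsuc i) c)
    forget-v : ∀ k c → forget (vert cs k c) ≡ vert s k c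
    forget-h : ∀ i j → forget (horiz cs i j) ≡ horiz s i j

colourOf : CSpin → ℕ
colourOf nothing  = 0
colourOf (just x) = x

minus-colour : ∀ {x} → forget x ≡ minus → x ≡ just (colourOf x)
minus-colour {just x} _ = refl

plus-nothing : ∀ {x} → forget x ≡ plus → x ≡ nothing
plus-nothing {nothing} _ = refl

highWord-cong : ∀ {f g} → (∀ j → f j ≡ g j) → ∀ t → highWord f t ≡ highWord g t
highWord-cong h zero    = refl
highWord-cong h (suc t) = cong₂ (λ n w → replicate n (suc t) ++ w) (h t) (highWord-cong h t)

module UncolouredState (r : ℕ) (2≤r : 2 ≤ r) (lam : Vec ℕ r) (isPartition : IsPartition lam) (N : ℕ) (fits : part1 lam + (r ∸ 1) ≤ N)
            (s : State Spin r N) (adm : AdmissibleU r N lam s) where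
  open Partition r lam isPartition

  private
    topU-s : ∀ c → vert s fzero c ≡ topU r lam (toℕ c)
    topU-s = proj₁ adm
    bottom-s : ∀ c → vert s (fromℕ r) c ≡ plus
    bottom-s = proj₁ (proj₂ adm)
    left-s : ∀ i → horiz s i (fromℕ (suc N)) ≡ plus
    left-s = proj₁ (proj₂ (proj₂ adm))
    right-s : ∀ i → horiz s i fzero ≡ minus
    right-s = proj₁ (proj₂ (proj₂ (proj₂ adm)))
    vertices-s : ∀ i c → UVertex (horiz s i (fsuc c)) (vert s (inject₁ i) c) (horiz s i (inject₁ c)) (vert s (fsuc i) c)
    vertices-s = proj₂ (proj₂ (proj₂ (proj₂ adm)))

    G : ℕ → ℕ → ℕ
    G = pattern-of r N s

  lift-exists : ∃ (Lift r N lam s)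
  lift-exists with cv , ch , top , left , vs , fv , fh ← colourState r (suc N) (vert s) (horiz s) (λ c → topC r lam (toℕ c))
                     (λ c → trans (forget-topC (toℕ c)) (sym (topU-s c))) left-s vertices-s =
    record { vert = cv ; horiz = ch } , record { top = top ; left = left ; vertices = vs ; forget-v = fv ; forget-h = fh }

  module _ {cs : State CSpin r N} (lift : Lift r N lam s cs) where
    open Lift lift

    exit : Fin r → ℕ
    exit i = colourOf (horiz cs i fzero)

    horiz-exit : ∀ i → horiz cs i fzero ≡ just (exit i)
    horiz-exit i = minus-colour (trans (forget-h i fzero) (right-s i))

    bottom-nothing : ∀ c → vert cs (fromℕ r) c ≡ nothing
    bottom-nothing c = plus-nothing (trans (forget-v (fromℕ r) c) (bottom-s c))

    private
      L X : ℕ → List ℕ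
      L = at [] (columnLists r N s)
      X = at [] (map (λ k → colours (suc N) (vert cs k)) (allFin (suc r)))
      z : ℕ → ℕ
      z = at 0 (map exit (allFin r))

      L-at : ∀ k → L (toℕ k) ≡ cols (suc N) (λ c → forget (vert cs k c))
      L-at k = trans (at-map-allFin (suc r) (λ k → minusCols (vert s k)) k)
        (trans (minusCols-cols (vert s k)) (cols-cong (suc N) (λ c → sym (forget-v k c))))

      X-at : ∀ k → X (toℕ k) ≡ colours (suc N) (vert cs k)
      X-at k = at-map-allFin (suc r) (λ k → colours (suc N) (vert cs k)) k

      rows : ∀ k → k < r → Row (L k) (X k) (L (suc k)) (X (suc k)) (z k)
      rows k k<r = subst (λ k → Row (L k) (X k) (L (suc k)) (X (suc k)) (z k)) (toℕ-fromℕ< k<r) (at-row (fromℕ< k<r))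
        where
        at-row : ∀ i → Row (L (toℕ i)) (X (toℕ i)) (L (suc (toℕ i))) (X (suc (toℕ i))) (z (toℕ i))
        at-row i rewrite L-at (fsuc i) | X-at (fsuc i) | at-map-allFin {d = 0} r exit i
          | sym (toℕ-inject₁ i) | L-at (inject₁ i) | X-at (inject₁ i) =
          colouredRow (suc N) (horiz cs i) (vert cs (inject₁ i)) (vert cs (fsuc i)) (exit i) (horiz-exit i) (left i) (vertices i)

      L-bottom : L r ≡ []
      L-bottom = trans (cong L (sym (toℕ-fromℕ r))) (trans (L-at (fromℕ r)) (cols-plus (suc N) (λ c → cong forget (bottom-nothing c))))

      X-bottom : X r ≡ []
      X-bottom = trans (cong X (sym (toℕ-fromℕ r))) (trans (X-at (fromℕ r)) (colours-nothing (suc N) bottom-nothing))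

      open Lattice L X z rows L-bottom X-bottom (trans (X-at fzero) (top-colours fits (vert cs fzero) top))
        {G} (λ {v} → pattern-in r N s {v}) (λ {v} → pattern-out r N s {v})

    -- A fact about the uncoloured state, drawn from a colouring because `Row` yields the
    -- interlacing together with the colours.
    lift-isGT : IsGT r G
    lift-isGT = isGT

    pattern-top : ∀ j → G r j ≡ l j
    pattern-top j with j <? r
    ... | no j≮r  = trans (pattern-out r N s {r} (≮⇒≥ j≮r)) (sym (l-beyond (≮⇒≥ j≮r)))
    ... | yes j<r = trans (pattern-in r N s j<r) (trans (cong (λ k → at 0 (L k) j ∸ (r ∸ suc j)) (n∸n≡0 r))
      (trans (cong (λ w → at 0 w j ∸ (r ∸ suc j)) (trans (L-at fzero) (top-cols fits (vert cs fzero) top)))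
        (trans (cong (_∸ (r ∸ suc j)) (at-applyUpTo (λ j → l j + (r ∸ suc j)) j<r)) (m+n∸n≡m (l j) (r ∸ suc j)))))

    -- Serves for an arbitrary colouring in one direction and for the constructed one in the other;
    -- the word, and so π, depends only on the uncoloured state.
    exits-by-π : Σ (Perm r) λ π → IsΠnd (circledWord G 1 (r ∸ 1)) π × (∀ i → lookup π i < r) ×
      (∀ i k → toℕ k ≡ r ∸ suc (lookup π i) → suc (toℕ i + exit k) ≡ r)
    exits-by-π with π , nd , ex ← exit-colours 2≤r = π , nd , (λ i → proj₁ (ex i)) , λ i k eq →
      trans (cong (λ n → suc (toℕ i + n)) (trans (sym (at-map-allFin r exit k)) (cong z eq))) (proj₂ (ex i))

  private
    lift₀ : Lift r N lam s (proj₁ lift-exists)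
    lift₀ = proj₂ lift-exists

    open Strings (lift-isGT lift₀)

    readingWord-s : readingWord (tableauOf r N s) ≡ tableauWord G r
    readingWord-s = trans (cong readingWord (tableauOf-segments r N s)) (readingWord-map (segment G 0 r) r)

    bounded-s : All (_≤ r) (readingWord (tableauOf r N s))
    bounded-s = subst (All (_≤ r)) (sym readingWord-s) (tableauWord-bounded G r r)

    shapeT-s : shapeT (tableauOf r N s) ≡ map l (upTo r)
    shapeT-s = trans (cong shapeT (tableauOf-segments r N s)) (trans (sym (map-∘ (upTo r))) (map-cong (λ j →
      trans (sym (+-identityʳ _)) (trans (cong (length (segment G 0 r j) +_) (sym (pattern-out r N s {0} {j} z≤n)))
        (trans (length-segment (lift-isGT lift₀) 0 r j ≤-refl) (pattern-top lift₀ j)))) (upTo r)))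

    reach : Reachable (tableauOf r N s) (highestT r lam)
    reach = let T₁ , rw , sh , f = climb-to-highest {tableauOf r N s} readingWord-s in
      f ([] , [] , cong just (readingWord-injective
        (trans sh (trans shapeT-s (sym shapeT-highestT)))
        (trans rw (trans tableauWord-trunc (trans (highWord-cong (pattern-top lift₀) r) (sym readingWord-highestT))))))

    dual : ∀ is → All (λ i → 1 ≤ i × i < r) is → applyE is (tableauOf r N s) ≡ just (highestT r lam) →
      ∃ λ T′ → applyE (map (r ∸_) (reverse is)) (lowestT r lam) ≡ just T′ × readingWord T′ ≈ star r (readingWord (tableauOf r N s))
    dual is = dual-path {L = lowestT r lam} lowestT≈star-highestT is (tableauOf r N s) bounded-s

  involution-exists : Σ Tableau (IsLusztig r lam (tableauOf r N s))
  involution-exists =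
    let is , his , eq = reach
        T′ , eq′ , _  = dual is his eq
    in  T′ , is , his , eq , eq′

  -- Every path to the highest weight tableau leads `dual` into the Knuth class of the starred word,
  -- and the class determines the circles.
  omegaWord-involution : ∀ T′ → IsLusztig r lam (tableauOf r N s) T′ → omegaWord r T′ ≡ circledWord G 1 (r ∸ 1)
  omegaWord-involution T′ (is , his , eq , eq′) with T″ , eq″ , T″≈ ← dual is his eq with refl ← trans (sym eq′) eq″ =
    omegaWord-circled T′ 2≤r (≈-trans T″≈ (≈-reflexive (cong (star r) readingWord-s)))

  private
    flip-< : ∀ {a} → a < r → r ∸ suc a < r
    flip-< a<r = ∸-monoʳ-< (s≤s z≤n) a<r

    flip-flip : ∀ {a b} → suc (a + b) ≡ r → b ≡ r ∸ suc a
    flip-flip {a} {b} refl = sym (m+n∸m≡n a b)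

    flip-flip′ : ∀ {a} → a < r → r ∸ suc (r ∸ suc a) ≡ a
    flip-flip′ {a} a<r = sym (flip-flip (trans (+-comm (suc (r ∸ suc a)) a) (trans (+-suc a _) (m+[n∸m]≡n a<r))))

  image⇒omega : ∀ {w} → IsColorForgetImage r N lam w s → Σ (Perm r) λ π → IsΠnd (circledWord G 1 (r ∸ 1)) π × w0L π ≡ toPerm w
  image⇒omega {w} (cs , (top , _ , left , right , vs) , fv , fh)
    with π , nd , π<r , ex ← exits-by-π record { top = top ; left = left ; vertices = vs ; forget-v = fv ; forget-h = fh } =
    π , nd , trans (sym (V.tabulate∘lookup (w0L π))) (V.tabulate-cong λ i → trans (V.lookup-map i _ π) (entry i))
    where
    entry : ∀ i → r ∸ suc (lookup π i) ≡ toℕ (w ⟨$⟩ʳ i)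
    -- Row k is where the colour that starts in position i leaves. The right boundary of `cs`
    -- assigns to this row the colour with index w⁻¹ k, so w i = k.
    entry i = trans (sym k≡) (cong toℕ (trans (sym (inverseʳ w)) (cong (w ⟨$⟩ʳ_) (sym i≡))))
      where
      k : Fin r
      k = fromℕ< (flip-< (π<r i))
      k≡ : toℕ k ≡ r ∸ suc (lookup π i)
      k≡ = toℕ-fromℕ< (flip-< (π<r i))
      i≡ : i ≡ w ⟨$⟩ˡ k
      i≡ = toℕ-injective (trans
        (flip-flip (trans (cong suc (+-comm (colourOf (horiz cs k fzero)) (toℕ i))) (ex i k k≡)))
        (trans (cong (λ x → r ∸ suc (colourOf x)) (right k)) (flip-flip′ (toℕ<n (w ⟨$⟩ˡ k)))))

  omega⇒image : ∀ {w π} → IsΠnd (circledWord G 1 (r ∸ 1)) π → w0L π ≡ toPerm w → IsColorForgetImage r N lam w s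
  omega⇒image {w} {π} nd w₀π with π′ , nd′ , _ , ex ← exits-by-π lift₀ with refl ← IsΠnd-functional nd nd′ =
    proj₁ lift-exists , (Lift.top lift₀ , bottom-nothing lift₀ , Lift.left lift₀ , right , Lift.vertices lift₀) , Lift.forget-v lift₀ , Lift.forget-h lift₀
    where
    right : ∀ k → horiz (proj₁ lift-exists) k fzero ≡ just (color r (suc (toℕ (w ⟨$⟩ˡ k))))
    right k = trans (horiz-exit lift₀ k) (cong just (flip-flip (ex i k k≡)))
      where
      i = w ⟨$⟩ˡ k
      k≡ : toℕ k ≡ r ∸ suc (lookup π i)
      k≡ = trans (cong toℕ (sym (inverseʳ w))) (trans (sym (V.lookup∘tabulate (λ i → toℕ (w ⟨$⟩ʳ i)) i))
        (trans (cong (λ v → lookup v i) (sym w₀π)) (V.lookup-map i _ π)))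

theorem6p1 : (r : ℕ) → 2 ≤ r → (lam : Vec ℕ r) → IsPartition lam →
    (N : ℕ) → part1 lam + (r ∸ 1) ≤ N → (w : Permutation′ r) →
    (s : State Spin r N) → AdmissibleU r N lam s →
    Σ Tableau (λ T' → IsLusztig r lam (tableauOf r N s) T') ×
    ((T' : Tableau) → IsLusztig r lam (tableauOf r N s) T' →
    (IsColorForgetImage r N lam w s ⇔ W0OmegaIs r T' w))
theorem6p1 r 2≤r lam isPartition N fits w s adm = involution-exists , λ T' lusztig → mk⇔
  (λ image → let π , nd , w₀π = image⇒omega {w} image in
    π , subst (λ ps → IsΠnd ps π) (sym (omegaWord-involution T' lusztig)) nd , w₀π)
  (λ (π , nd , w₀π) → omega⇒image {w} (subst (λ ps → IsΠnd ps π) (omegaWord-involution T' lusztig) nd) w₀π)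
  where open UncolouredState r 2≤r lam isPartition N fits s adm
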